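{- Let $k\geq 5$, $r\ge1$, $s_1\geq\cdots\geq s_r\geq 1$ and $\beta\ge0$ be fixed integers with $\gamma=1+\beta\leq k-2$, and let $n$ be sufficiently large (depending on $s_1,\ldots,s_r,k,\gamma$). Let $\mathcal{F}\subseteq\binom{[n]}{k}$ be such that $KG_{n,k}[\mathcal{F}]$ contains no subgraph isomorphic to $K_{s_1,\ldots,s_r,1}$ and $\ell_{r+1}(\mathcal{F})\geq\gamma$. Then $$|\mathcal{F}|\leq\binom{n}{k}-\binom{n-r}{k}-\binom{n-k-r+1}{k-1}+\binom{n-k-r-\gamma+1}{k-\gamma-1}+\gamma s_r.$$ Equality holds if and only if $\mathcal{F}$ is isomorphic to a family $\mathcal{J}^{1,s_r}_{\gamma,r}$ (as defined in the context).
   Context: $KG_{n,k}$ is the Kneser graph on $\binom{[n]}{k}$ (adjacent iff disjoint); $KG_{n,k}[\mathcal{F}]$ is the induced subgraph. $\ell_{r+1}(\mathcal{F})$ is the minimum number of members of $\mathcal{F}$ whose removal leaves a family with no $r+1$ pairwise disjoint members. $\mathcal{S}_i=\{A\in\binom{[n]}{k}:i\in A\}$. Construction $\mathcal{J}^{1,t}_{\gamma,r}$: take $J=\{1,\ldots,r,x_1,\ldots,x_\gamma\}$ (an $(r+\gamma)$-set), a $(k-1)$-set $E\subseteq[n]\setminus J$, and $A_j=E\cup\{x_j\}$ for $j\le\gamma$. Let $\mathcal{S}_r^{[r-1]}(A_1,\ldots,A_\gamma:1)$ be the family of $k$-sets $A$ with $r\in A$, $A\cap[r-1]=\varnothing$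 and $A\cap A_j\neq\varnothing$ for all $j$. For each $j\le\gamma$, let $\mathcal{B}_j$ be a family of $t-1$ distinct $k$-sets $B$ with $B\cap E=\varnothing$ and $J\setminus B=\{1,\ldots,r-1,x_j\}$. Then $\mathcal{J}^{1,t}_{\gamma,r}=\bigcup_{l=1}^{r-1}\mathcal{S}_l\cup\mathcal{S}_r^{[r-1]}(A_1,\ldots,A_\gamma:1)\cup\{A_1,\ldots,A_\gamma\}\cup\mathcal{B}_1\cup\cdots\cup\mathcal{B}_\gamma$. Two families are isomorphic if some permutation of $[n]$ maps one onto the other. -}

module Defs where

open import Data.Nat using (ℕ; zero; suc; _+_; _∸_; _≤_; _<_)
open import Data.Fin using (Fin; toℕ)
open import Data.Fin.Subset using (Subset; _∈_; _∉_; _∪_; ⁅_⁆; ∣_∣)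
open import Data.Fin.Permutation using (Permutation′; _⟨$⟩ˡ_)
open import Data.Vec using (tabulate; lookup)
open import Data.List using (List; map; length)
open import Data.List.Membership.Propositional renaming (_∈_ to _∈ᴸ_; _∉_ to _∉ᴸ_)
open import Data.List.Relation.Unary.All using (All)
open import Data.List.Relation.Unary.Unique.Propositional using (Unique)
open import Data.Product using (Σ; ∃; ∃-syntax; _×_; _,_)
open import Data.Sum using (_⊎_)
open import Data.Empty using (⊥)
open import Relation.Nullary using (¬_)
open import Relation.Binary.PropositionalEquality using (_≡_; _≢_)
open import Function.Bundles using (_⇔_)
open import Function.Definitions using (Injective)

-- Ground set [n] is represented by Fin n; the paper's element i (1 ≤ i ≤ n)
-- is the element of Fin n with toℕ equal to i - 1.
-- A family of k-sets is a duplicate-free list of subsets of Fin n.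

Disjoint : ∀ {n} → Subset n → Subset n → Set
Disjoint A B = ∀ x → x ∈ A → x ∈ B → ⊥

Intersects : ∀ {n} → Subset n → Subset n → Set
Intersects A B = ∃[ x ] (x ∈ A × x ∈ B)

-- KG_{n,k}[F] contains a (not necessarily induced) subgraph isomorphic to the
-- complete multipartite graph with parts of sizes sz i (i : Fin m):
-- an injective assignment of members of F to the vertices such that vertices
-- in different parts receive disjoint sets.
ContainsCompleteMultipartite : ∀ {n m} → List (Subset n) → (Fin m → ℕ) → Set
ContainsCompleteMultipartite {n} {m} F sz =
  Σ (Σ (Fin m) (λ i → Fin (sz i)) → Subset n) λ f →
    Injective _≡_ _≡_ f
    × (∀ p → f p ∈ᴸ F)
    × (∀ p q → Σ.proj₁ p ≢ Σ.proj₁ q → Disjoint (f p) (f q))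
  where open Data.Product

HasDisjointAvoiding : ∀ {n} → List (Subset n) → ℕ → List (Subset n) → Set
HasDisjointAvoiding {n} F q R =
  Σ (Fin q → Subset n) λ g →
    Injective _≡_ _≡_ g
    × (∀ i → g i ∈ᴸ F)
    × (∀ i → g i ∉ᴸ R)
    × (∀ i j → i ≢ j → Disjoint (g i) (g j))

ℓ≥ : ∀ {n} → List (Subset n) → ℕ → ℕ → Set
ℓ≥ {n} F q γ = (R : List (Subset n)) → length R < γ → HasDisjointAvoiding F q R

image : ∀ {n} → Permutation′ n → Subset n → Subset n
image σ A = tabulate (λ i → lookup A (σ ⟨$⟩ˡ i))

-- The family J^{1,t}_{γ,r}, described by all its parameters (x_j, E, B_j),
-- with [r] = {1,…,r} the elements with toℕ < r, [r-1] those with toℕ < r ∸ 1,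
-- and the element r the one with toℕ ≡ r ∸ 1.
-- IsJFamily n k r γ t G : the predicate G (on k-sets) is exactly such a family
-- for some admissible choice of parameters.
IsJFamily : (n k r γ t : ℕ) → (Subset n → Set) → Set
IsJFamily n k r γ t G =
  Σ (Fin γ → Fin n) λ x →
    Injective _≡_ _≡_ x × (∀ j → r ≤ toℕ (x j)) ×
  Σ (Subset n) λ E →
    ∣ E ∣ ≡ k ∸ 1 ×
    (∀ y → y ∈ E → r ≤ toℕ y × (∀ j → y ≢ x j)) ×
  Σ (Fin γ → List (Subset n)) λ B →
    (∀ j → Unique (B j)) ×
    (∀ j → length (B j) ≡ t ∸ 1) ×
    (∀ j b → b ∈ᴸ B j →
        ∣ b ∣ ≡ k × Disjoint b E ×
        (∀ y → (toℕ y < r ⊎ ∃[ i ] y ≡ x i) →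
              (y ∉ b ⇔ (toℕ y < r ∸ 1 ⊎ y ≡ x j)))) ×
    (∀ A → ∣ A ∣ ≡ k → (G A ⇔ JMem x E B A))
  where
  Aj : (Fin γ → Fin n) → Subset n → Fin γ → Subset n
  Aj x E j = E ∪ ⁅ x j ⁆
  JMem : (Fin γ → Fin n) → Subset n → (Fin γ → List (Subset n)) → Subset n → Set
  JMem x E B A =
    (∃[ a ] (a ∈ A × toℕ a < r ∸ 1))
    ⊎ ((∃[ a ] (a ∈ A × toℕ a ≡ r ∸ 1))
        × (∀ a → a ∈ A → ¬ (toℕ a < r ∸ 1))
        × (∀ j → Intersects A (Aj x E j)))
    ⊎ (∃[ j ] A ≡ Aj x E j)
    ⊎ (∃[ j ] A ∈ᴸ B j)

{-# OPTIONS --safe #-}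
module Submission where

-- Call an element big if it lies in at least a constant times C(n, k − 2) members of F.  Without
-- r − 1 big elements, F would be too small or a greedy choice would produce K_{1,s₁,…,s_r}.  Let Z
-- consist of r − 1 big elements and let G be the members of F that avoid Z.  Stars at the big
-- elements extend any K_{1,t} in KG[G], t = s_r, to the forbidden graph, so a member of G is
-- disjoint from fewer than t others, whereas G needs γ deletions to become intersecting.
-- Take disjoint S₀, S₁ ∈ G.  All but 2(t − 1) members of G contain a pair from S₀ × S₁, and a pair
-- contained in many members (compared with C(n, k − 3)) meets every member of G.  Hence such heavy
-- pairs share a coordinate, and the size of G forces k − 1 of them: {x, e} for e in a (k − 1)-set E.
-- So a member of G contains x or is E ∪ {y} for one of m elements y, with m ≥ γ.  For m > γ the
-- sets through x meeting all E ∪ {y} are too few; for m = γ the count is the claimed bound, and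
-- equality makes each E ∪ {y} miss exactly t − 1 members through x, no member being missed twice.

open import Defs
open import Level using (0ℓ)
open import Data.Nat using (ℕ; zero; suc; _+_; _*_; _∸_; _≤_; _<_; z≤n; s≤s; z<s; _≤?_; _<?_; ≤′-refl; ≤′-step)
open import Data.Nat.Properties
open import Data.Nat.Combinatorics using (_C_; nCk≡nC[n∸k]; nCn≡1; nC1≡n; nCk+nC[k+1]≡[n+1]C[k+1]; k>n⇒nCk≡0)
open import Data.Nat.Tactic.RingSolver using (solve-∀)
open import Data.Bool using (true; false)
import Data.Bool.Properties as Bool
open import Data.Fin as Fin using (Fin; zero; suc; toℕ; fromℕ; inject≤; inject₁; fromℕ<)
import Data.Fin.Properties as Fin
open import Data.Fin.Relation.Unary.Top using (View; view; ‵fromℕ; ‵inject₁)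
open import Data.Fin.Permutation as Perm using (Permutation′; _⟨$⟩ˡ_; _⟨$⟩ʳ_)
open import Data.Fin.Subset using (Subset; _∈_; _∉_; _⊆_; _∪_; ⁅_⁆; ∣_∣; ⋃) renaming (⊥ to ∅)
open import Data.Fin.Subset.Properties
open import Data.Vec as Vec using ([]; _∷_)
import Data.Vec.Properties as Vec
import Data.Vec.Functional as Vector
open import Data.List using (List; []; _∷_; _++_; map; length; filter; lookup; tabulate; allFin; take; concat; cartesianProduct)
open import Data.List.Properties using (length-++; length-map; filter-++; length-tabulate; length-take)
open import Data.List.Membership.Propositional renaming (_∈_ to _∈ᴸ_; _∉_ to _∉ᴸ_)
open import Data.List.Membership.Propositional.Properties
import Data.List.Membership.DecPropositional as DecMem
open import Data.List.Relation.Unary.Any as Any using (Any; here; there)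
open import Data.List.Relation.Unary.All as All using (All; []; _∷_)
import Data.List.Relation.Unary.All.Properties as All
open import Data.List.Relation.Unary.AllPairs using ([]; _∷_)
import Data.List.Relation.Unary.AllPairs.Properties as AllPairs
open import Data.List.Relation.Unary.Unique.Propositional using (Unique)
import Data.List.Relation.Unary.Unique.Propositional.Properties as Unique
open import Data.Product using (Σ; ∃; ∃-syntax; _×_; _,_; proj₁; proj₂)
open import Data.Sum as Sum using (_⊎_; inj₁; inj₂; [_,_]′)
open import Data.Empty using (⊥; ⊥-elim)
open import Relation.Nullary using (¬_; Dec; yes; no; contradiction)
open import Relation.Nullary.Decidable using (_×-dec_; ¬?; _→-dec_; decidable-stable; dec-true; dec-false)
open import Relation.Unary using (Pred; Decidable)
open import Relation.Binary using (DecidableEquality)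
open import Relation.Binary.PropositionalEquality
open import Function using (_∘_; id)
open import Function.Bundles using (_⇔_; mk⇔; Equivalence)
open import Function.Definitions using (Injective)

-- Counting families of subsets

-- The bound and its equality case come from one implication: a family at least as large as the
-- bound is a copy of J, and a copy of J has exactly that size. The number k - 1 of heavy pairs is
-- an order of magnitude: G needs about (k - 1) C(n, k - 2) members, one pair lies in at most C(n, k
-- - 2) sets, and all light pairs together give O(C(n, k - 3)). The delicate point is m > γ. Meeting
-- one more set E ∪ {y} costs C(q, k - γ - 1) sets through x, where n = r + k + γ + q. For γ = k - 2
-- this is only linear in n, like the number of possible y. So m is compared with the constant t k.
-- Up to it, the loss beats a constant gain. Beyond it, fewer than t members through x miss E, and
-- the whole term C(q + 1, k - γ - 1) is lost against at most γ + q + 1 sets E ∪ {y}. For γ = k - 2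
-- the linear terms then cancel, and the contradiction comes from γ ≥ 2 and t ≥ 2. Counting
-- identities are written without subtraction, with negative terms moved to the other side.

unique-⊆⇒length-≤ : ∀ {A : Set} {xs ys : List A} → Unique xs →
                    (∀ {x} → x ∈ᴸ xs → x ∈ᴸ ys) → length xs ≤ length ys
unique-⊆⇒length-≤ {xs = []} _ _ = z≤n
unique-⊆⇒length-≤ {xs = x ∷ xs} (x∉ ∷ u) xs⊆ with ∈-∃++ (xs⊆ (here refl))
... | ys₁ , ys₂ , refl = begin
  suc (length xs)                 ≤⟨ s≤s (unique-⊆⇒length-≤ u xs⊆′) ⟩
  suc (length (ys₁ ++ ys₂))       ≡⟨ cong suc (length-++ ys₁) ⟩
  suc (length ys₁ + length ys₂)   ≡⟨ +-suc (length ys₁) _ ⟨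
  length ys₁ + suc (length ys₂)   ≡⟨ length-++ ys₁ ⟨
  length (ys₁ ++ x ∷ ys₂)         ∎
  where
  open ≤-Reasoning
  xs⊆′ : ∀ {z} → z ∈ᴸ xs → z ∈ᴸ ys₁ ++ ys₂
  xs⊆′ z∈ with ∈-++⁻ ys₁ (xs⊆ (there z∈))
  ... | inj₁ z∈₁ = ∈-++⁺ˡ z∈₁
  ... | inj₂ (here refl) = ⊥-elim (All.lookup x∉ z∈ refl)
  ... | inj₂ (there z∈₂) = ∈-++⁺ʳ ys₁ z∈₂

unique-⊆⇒⊇ : ∀ {A : Set} (_≟_ : DecidableEquality A) {xs ys : List A} → Unique xs →
             (∀ {x} → x ∈ᴸ xs → x ∈ᴸ ys) → length ys ≤ length xs →
             ∀ {y} → y ∈ᴸ ys → y ∈ᴸ xs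
unique-⊆⇒⊇ _≟_ {xs} {ys} u xs⊆ len {y} y∈ with DecMem._∈?_ _≟_ y xs
... | yes y∈xs = y∈xs
... | no  y∉xs = contradiction (≤-trans (unique-⊆⇒length-≤ u′ ⊆′) len) (n≮n _)
  where
  u′ : Unique (y ∷ xs)
  u′ = All.¬Any⇒All¬ xs y∉xs ∷ u
  ⊆′ : ∀ {z} → z ∈ᴸ y ∷ xs → z ∈ᴸ ys
  ⊆′ (here refl) = y∈
  ⊆′ (there z∈) = xs⊆ z∈

lookup-injective : ∀ {A : Set} {xs : List A} → Unique xs → Injective _≡_ _≡_ (lookup xs)
lookup-injective {xs = x ∷ xs} (x∉ ∷ u) {zero} {zero} _ = refl
lookup-injective {xs = x ∷ xs} (x∉ ∷ u) {zero} {suc j} eq = ⊥-elim (All.lookup x∉ (∈-lookup j) eq)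
lookup-injective {xs = x ∷ xs} (x∉ ∷ u) {suc i} {zero} eq = ⊥-elim (All.lookup x∉ (∈-lookup i) (sym eq))
lookup-injective {xs = x ∷ xs} (x∉ ∷ u) {suc i} {suc j} eq = cong suc (lookup-injective u eq)

initial : ∀ {A : Set} {xs : List A} {q} → Unique xs → q ≤ length xs →
          ∃[ g ] (Injective {A = Fin q} {B = A} _≡_ _≡_ g × (∀ i → g i ∈ᴸ xs))
initial {xs = xs} u q≤ =
  (λ i → lookup xs (inject≤ i q≤)) ,
  (λ eq → Fin.inject≤-injective q≤ q≤ _ _ (lookup-injective u eq)) ,
  (λ i → ∈-lookup (inject≤ i q≤))

infix 4 _≟ˢ_ _∈ˢ?_

_≟ˢ_ : ∀ {n} → DecidableEquality (Subset n)
_≟ˢ_ = Vec.≡-dec Bool._≟_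

_∈ˢ?_ : ∀ {n} (A : Subset n) F → Dec (A ∈ᴸ F)
_∈ˢ?_ = DecMem._∈?_ _≟ˢ_

subsets : ∀ n → List (Subset n)
subsets zero = [] ∷ []
subsets (suc n) = map (true ∷_) (subsets n) ++ map (false ∷_) (subsets n)

∈-subsets : ∀ {n} (A : Subset n) → A ∈ᴸ subsets n
∈-subsets [] = here refl
∈-subsets (true ∷ A) = ∈-++⁺ˡ (∈-map⁺ (true ∷_) (∈-subsets A))
∈-subsets {suc n} (false ∷ A) = ∈-++⁺ʳ (map (true ∷_) (subsets n)) (∈-map⁺ (false ∷_) (∈-subsets A))

subsets-unique : ∀ n → Unique (subsets n)
subsets-unique zero = [] ∷ []
subsets-unique (suc n) =
  Unique.++⁺ (Unique.map⁺ Vec.∷-injectiveʳ (subsets-unique n))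
             (Unique.map⁺ Vec.∷-injectiveʳ (subsets-unique n))
             disj
  where
  disj : ∀ {A} → A ∈ᴸ map (true ∷_) (subsets n) × A ∈ᴸ map (false ∷_) (subsets n) → ⊥
  disj (p , q) with ∈-map⁻ (true ∷_) p | ∈-map⁻ (false ∷_) q
  ... | _ , _ , refl | _ , _ , ()

module _ {n : ℕ} {P : Pred (Subset n) 0ℓ} (P? : Decidable P) where

  enum : List (Subset n)
  enum = filter P? (subsets n)

  opaque

    # : ℕ
    # = length enum

    #-def : # ≡ length enum
    #-def = refl

  enum-unique : Unique enum
  enum-unique = Unique.filter⁺ P? (subsets-unique n)

  ∈-enum⁺ : ∀ {A} → P A → A ∈ᴸ enum
  ∈-enum⁺ {A} = ∈-filter⁺ P? (∈-subsets A)

  ∈-enum⁻ : ∀ {A} → A ∈ᴸ enum → P A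
  ∈-enum⁻ A∈ = proj₂ (∈-filter⁻ P? {xs = subsets n} A∈)

  length≤# : ∀ {L} → Unique L → (∀ {A} → A ∈ᴸ L → P A) → length L ≤ #
  length≤# u L⊆P = ≤-trans (unique-⊆⇒length-≤ u (∈-enum⁺ ∘ L⊆P)) (≤-reflexive (sym #-def))

  #≤length : ∀ {L} → (∀ {A} → P A → A ∈ᴸ L) → # ≤ length L
  #≤length P⊆L = ≤-trans (≤-reflexive #-def) (unique-⊆⇒length-≤ enum-unique (P⊆L ∘ ∈-enum⁻))

  choose : ∀ {q} → q ≤ # → ∃[ g ] (Injective {A = Fin q} {B = Subset n} _≡_ _≡_ g × (∀ i → P (g i)))
  choose q≤ with initial enum-unique (≤-trans q≤ (≤-reflexive #-def))
  ... | g , inj , g∈ = g , inj , ∈-enum⁻ ∘ g∈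

  inhabitant : 1 ≤ # → ∃ P
  inhabitant 1≤ with choose 1≤
  ... | g , _ , Pg = g zero , Pg zero

  #≥1 : ∀ {A} → P A → 1 ≤ #
  #≥1 {A} PA = length≤# {L = A ∷ []} ([] ∷ []) λ where (here refl) → PA

module _ {n : ℕ} {P Q : Pred (Subset n) 0ℓ} (P? : Decidable P) (Q? : Decidable Q) where

  #-mono : (∀ {A} → P A → Q A) → # P? ≤ # Q?
  #-mono P⊆Q = ≤-trans (#≤length P? (∈-enum⁺ Q? ∘ P⊆Q)) (≤-reflexive (sym (#-def Q?)))

module _ {n : ℕ} {P Q : Pred (Subset n) 0ℓ} (P? : Decidable P) (Q? : Decidable Q) where

  #-cong : (∀ {A} → P A → Q A) → (∀ {A} → Q A → P A) → # P? ≡ # Q?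
  #-cong P⊆Q Q⊆P = ≤-antisym (#-mono P? Q? P⊆Q) (#-mono Q? P? Q⊆P)

module _ {n : ℕ} {P Q R : Pred (Subset n) 0ℓ}
         (P? : Decidable P) (Q? : Decidable Q) (R? : Decidable R) where

  private
    length-Q++R : length (enum Q? ++ enum R?) ≡ # Q? + # R?
    length-Q++R = trans (length-++ (enum Q?)) (sym (cong₂ _+_ (#-def Q?) (#-def R?)))

  #-cover₂ : (∀ {A} → P A → Q A ⊎ R A) → # P? ≤ # Q? + # R?
  #-cover₂ P⊆ = subst (# P? ≤_) length-Q++R
    (#≤length P? λ PA → [ (λ q → ∈-++⁺ˡ (∈-enum⁺ Q? q)) , (λ r → ∈-++⁺ʳ (enum Q?) (∈-enum⁺ R? r)) ]′ (P⊆ PA))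

  #-pack₂ : (∀ {A} → Q A → P A) → (∀ {A} → R A → P A) → (∀ {A} → Q A → R A → ⊥) →
            # Q? + # R? ≤ # P?
  #-pack₂ Q⊆ R⊆ Q∦R = subst (_≤ # P?) length-Q++R
    (length≤# P?
      (Unique.++⁺ (enum-unique Q?) (enum-unique R?) λ (q , r) → Q∦R (∈-enum⁻ Q? q) (∈-enum⁻ R? r))
      (λ A∈ → [ (λ q → Q⊆ (∈-enum⁻ Q? q)) , (λ r → R⊆ (∈-enum⁻ R? r)) ]′ (∈-++⁻ (enum Q?) A∈)))

  #-split : (∀ {A} → P A → Q A ⊎ R A) → (∀ {A} → Q A → P A) → (∀ {A} → R A → P A) →
            (∀ {A} → Q A → R A → ⊥) → # P? ≡ # Q? + # R?
  #-split P⊆ Q⊆ R⊆ Q∦R = ≤-antisym (#-cover₂ P⊆) (#-pack₂ Q⊆ R⊆ Q∦R)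

module _ {n : ℕ} {I : Set} {Q : I → Pred (Subset n) 0ℓ} (Q? : ∀ i → Decidable (Q i)) (c : ℕ) where

  private
    U? : ∀ L → Decidable (λ A → Any (λ i → Q i A) L)
    U? L A = Any.any? (λ i → Q? i A) L

    step : ∀ i L → # (U? (i ∷ L)) ≤ # (Q? i) + # (U? L)
    step i L = #-cover₂ (U? (i ∷ L)) (Q? i) (U? L) λ where
      (here q) → inj₁ q
      (there q) → inj₂ q

    #-Any : ∀ L → (∀ {i} → i ∈ᴸ L → # (Q? i) ≤ c) → # (U? L) ≤ length L * c
    #-Any [] _ = #≤length (U? []) {L = []} λ ()
    #-Any (i ∷ L) bound = ≤-trans (step i L) (+-mono-≤ (bound (here refl)) (#-Any L (bound ∘ there)))

    #-Any-< : ∀ L → (∀ {i} → i ∈ᴸ L → # (Q? i) ≤ c) → ∀ {i} → i ∈ᴸ L → # (Q? i) < c →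
              # (U? L) < length L * c
    #-Any-< (i ∷ L) bound (here refl) strict =
      ≤-<-trans (step i L) (+-mono-<-≤ strict (#-Any L (bound ∘ there)))
    #-Any-< (i ∷ L) bound (there j∈) strict =
      ≤-<-trans (step i L) (+-mono-≤-< (bound (here refl)) (#-Any-< L (bound ∘ there) j∈ strict))

  module _ {P : Pred (Subset n) 0ℓ} (P? : Decidable P) (L : List I)
           (cover : ∀ {A} → P A → ∃[ i ] (i ∈ᴸ L × Q i A))
           (bound : ∀ {i} → i ∈ᴸ L → # (Q? i) ≤ c) where

    private
      P⊆U : # P? ≤ # (U? L)
      P⊆U = #-mono P? (U? L) λ PA → let (i , i∈ , q) = cover PA in Any.map (λ where refl → q) i∈

    #-cover : # P? ≤ length L * c
    #-cover = ≤-trans P⊆U (#-Any L bound)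

    -- Strictness of one bound makes the union bound strict. Read backwards: if the union attains
    -- the total, every subfamily attains its bound.
    #-cover-< : ∀ {i} → i ∈ᴸ L → # (Q? i) < c → # P? < length L * c
    #-cover-< i∈ strict = ≤-<-trans P⊆U (#-Any-< L bound i∈ strict)

length-filter-map : ∀ {A B : Set} {P : Pred B 0ℓ} (P? : Decidable P) (f : A → B) xs →
                    length (filter P? (map f xs)) ≡ length (filter (P? ∘ f) xs)
length-filter-map P? f [] = refl
length-filter-map P? f (x ∷ xs) with P? (f x)
... | yes _ = cong suc (length-filter-map P? f xs)
... | no _ = length-filter-map P? f xs

-- Condition on whether element zero is chosen; this is the recursion behind the exact counts.
#-suc : ∀ {n} {P : Pred (Subset (suc n)) 0ℓ} (P? : Decidable P) →
        # P? ≡ # (P? ∘ (true ∷_)) + # (P? ∘ (false ∷_))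
#-suc {n} P? = begin
  # P?
    ≡⟨ #-def P? ⟩
  length (filter P? (map (true ∷_) (subsets n) ++ map (false ∷_) (subsets n)))
    ≡⟨ cong length (filter-++ P? (map (true ∷_) (subsets n)) _) ⟩
  length (filter P? (map (true ∷_) (subsets n)) ++ filter P? (map (false ∷_) (subsets n)))
    ≡⟨ length-++ (filter P? (map (true ∷_) (subsets n))) ⟩
  length (filter P? (map (true ∷_) (subsets n))) + length (filter P? (map (false ∷_) (subsets n)))
    ≡⟨ cong₂ _+_ (length-filter-map P? (true ∷_) (subsets n)) (length-filter-map P? (false ∷_) (subsets n)) ⟩
  length (enum (P? ∘ (true ∷_))) + length (enum (P? ∘ (false ∷_)))
    ≡⟨ cong₂ _+_ (#-def (P? ∘ (true ∷_))) (#-def (P? ∘ (false ∷_))) ⟨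
  # (P? ∘ (true ∷_)) + # (P? ∘ (false ∷_)) ∎
  where open ≡-Reasoning

-- Binomial coefficients

pascal : ∀ n j → suc n C suc j ≡ n C j + n C suc j
pascal n j = sym (nCk+nC[k+1]≡[n+1]C[k+1] n j)

C-zero : ∀ n → n C 0 ≡ 1
C-zero n = trans (nCk≡nC[n∸k] {0} {n} z≤n) (nCn≡1 n)

0C-suc : ∀ j → 0 C suc j ≡ 0
0C-suc j = k>n⇒nCk≡0 {0} {suc j} z<s

C-suc-≤ : ∀ n j → n C j ≤ suc n C j
C-suc-≤ n zero = ≤-reflexive (trans (C-zero n) (sym (C-zero (suc n))))
C-suc-≤ n (suc j) = ≤-trans (m≤n+m (n C suc j) (n C j)) (≤-reflexive (sym (pascal n j)))

C-mono-≤ : ∀ {m n} j → m ≤ n → m C j ≤ n C j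
C-mono-≤ j m≤n with ≤⇒≤′ m≤n
... | ≤′-refl = ≤-refl
... | ≤′-step {n} le = ≤-trans (C-mono-≤ j (≤′⇒≤ le)) (C-suc-≤ n j)

C-pos : ∀ {n j} → j ≤ n → 1 ≤ n C j
C-pos {n} {j} j≤n = ≤-trans (≤-reflexive (sym (nCn≡1 j))) (C-mono-≤ j j≤n)

-- Pascal's rule telescopes: the difference C(w + a, j + 1) - C(a, j + 1) is the sum of the w terms
-- C(a + i, j) with i < w. Here each is replaced by the largest possible value, in `C-increment-≥`
-- by the smallest.
C-increment-≤ : ∀ w a j → (w + a) C suc j ≤ a C suc j + w * ((w + a) C j)
C-increment-≤ zero a j = m≤m+n _ _
C-increment-≤ (suc w) a j = begin
  suc (w + a) C suc j                                 ≡⟨ pascal (w + a) j ⟩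
  (w + a) C j + (w + a) C suc j                       ≤⟨ +-monoʳ-≤ ((w + a) C j) (C-increment-≤ w a j) ⟩
  (w + a) C j + (a C suc j + w * ((w + a) C j))         ≡⟨ rearrange ((w + a) C j) (a C suc j) _ ⟩
  a C suc j + suc w * ((w + a) C j)                     ≤⟨ +-monoʳ-≤ (a C suc j) (*-monoʳ-≤ (suc w) (C-suc-≤ (w + a) j)) ⟩
  a C suc j + suc w * (suc (w + a) C j)                 ∎
  where
  open ≤-Reasoning
  rearrange : ∀ x y z → x + (y + z) ≡ y + (x + z)
  rearrange = solve-∀

C-increment-≥ : ∀ w a j → a C suc j + w * (a C j) ≤ (w + a) C suc j
C-increment-≥ zero a j = ≤-reflexive (+-identityʳ _)
C-increment-≥ (suc w) a j = begin
  a C suc j + (a C j + w * (a C j))                     ≡⟨ rearrange (a C suc j) (a C j) _ ⟩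
  a C j + (a C suc j + w * (a C j))                     ≤⟨ +-mono-≤ (C-mono-≤ j (m≤n+m a w)) (C-increment-≥ w a j) ⟩
  (w + a) C j + (w + a) C suc j                       ≡⟨ pascal (w + a) j ⟨
  suc (w + a) C suc j                                 ∎
  where
  open ≤-Reasoning
  rearrange : ∀ x y z → x + (y + z) ≡ y + (x + z)
  rearrange = solve-∀

-- The absorption identity (j + 1) C(n, j + 1) = (n − j) C(n, j), without subtraction.
C-absorb : ∀ n j → suc j * (n C suc j) + j * (n C j) ≡ n * (n C j)
C-absorb zero zero = trans (+-identityʳ _) (trans (+-identityʳ _) (0C-suc 0))
C-absorb zero (suc j) = cong₂ _+_ (trans (cong (suc (suc j) *_) (0C-suc (suc j))) (*-zeroʳ (suc (suc j))))
                                   (trans (cong (suc j *_) (0C-suc j)) (*-zeroʳ (suc j)))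
C-absorb (suc n) zero = begin
  1 * (suc n C 1) + 0   ≡⟨ trans (+-identityʳ _) (+-identityʳ _) ⟩
  suc n C 1           ≡⟨ nC1≡n (suc n) ⟩
  suc n               ≡⟨ *-identityʳ (suc n) ⟨
  suc n * 1           ≡⟨ cong (suc n *_) (C-zero (suc n)) ⟨
  suc n * (suc n C 0)   ∎
  where open ≡-Reasoning
C-absorb (suc n) (suc i) = begin
  suc (suc i) * (suc n C suc (suc i)) + suc i * (suc n C suc i)
    ≡⟨ cong₂ (λ x y → suc (suc i) * x + suc i * y) (pascal n (suc i)) (pascal n i) ⟩
  suc (suc i) * (b + c) + suc i * (a + b)
    ≡⟨ split i a b c ⟩
  (suc (suc i) * c + suc i * b) + (suc i * b + i * a) + (a + b)
    ≡⟨ cong₂ (λ x y → x + y + (a + b)) (C-absorb n (suc i)) (C-absorb n i) ⟩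
  n * b + n * a + (a + b)
    ≡⟨ merge n a b ⟩
  suc n * (a + b)
    ≡⟨ cong (suc n *_) (pascal n i) ⟨
  suc n * (suc n C suc i) ∎
  where
  open ≡-Reasoning
  a = n C i
  b = n C suc i
  c = n C suc (suc i)
  split : ∀ i a b c → suc (suc i) * (b + c) + suc i * (a + b) ≡
          (suc (suc i) * c + suc i * b) + (suc i * b + i * a) + (a + b)
  split = solve-∀
  merge : ∀ n a b → n * b + n * a + (a + b) ≡ suc n * (a + b)
  merge = solve-∀

-- By absorption the ratio of the two coefficients is (n - j) / (j + 1), so for n beyond this
-- threshold one step up in the lower index swallows the constant D.
C-ratio : ∀ D n j → suc j * D + j ≤ n → D * (n C j) ≤ n C suc j
C-ratio D n j le = *-cancelˡ-≤ (suc j) (+-cancelʳ-≤ (j * (n C j)) _ _ (begin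
  suc j * (D * (n C j)) + j * (n C j)   ≡⟨ factor j D (n C j) ⟩
  (suc j * D + j) * (n C j)           ≤⟨ *-monoˡ-≤ (n C j) le ⟩
  n * (n C j)                         ≡⟨ C-absorb n j ⟨
  suc j * (n C suc j) + j * (n C j)     ∎))
  where
  open ≤-Reasoning
  factor : ∀ j D c → suc j * (D * c) + j * c ≡ (suc j * D + j) * c
  factor = solve-∀

-- Once n exceeds j, Pascal's rule adds at least one at each step. Linear growth is enough against
-- the constant and linear terms of the final comparison.
C-linear : ∀ n j → n ≤ j + n C suc j
C-linear n zero = ≤-reflexive (sym (nC1≡n n))
C-linear zero (suc j) = z≤n
C-linear (suc n) (suc j) with suc j ≤? n
... | yes j<n = begin
  suc n                                     ≡⟨ +-comm 1 n ⟩
  n + 1                                     ≤⟨ +-monoʳ-≤ n (C-pos j<n) ⟩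
  n + n C suc j                             ≤⟨ +-monoˡ-≤ (n C suc j) (C-linear n (suc j)) ⟩
  suc j + n C suc (suc j) + n C suc j       ≡⟨ rearrange (suc j) (n C suc (suc j)) (n C suc j) ⟩
  suc j + (n C suc j + n C suc (suc j))     ≡⟨ cong (suc j +_) (pascal n (suc j)) ⟨
  suc j + suc n C suc (suc j)               ∎
  where
  open ≤-Reasoning
  rearrange : ∀ x y z → x + y + z ≡ x + (z + y)
  rearrange = solve-∀
... | no j≮n = ≤-trans (≰⇒> j≮n) (m≤m+n _ _)

-- Sets with prescribed elements

disjoint? : ∀ {n} (A B : Subset n) → Dec (Disjoint A B)
disjoint? A B = Fin.all? λ x → (x ∈? A) →-dec ((x ∈? B) →-dec no id)

intersects? : ∀ {n} (A B : Subset n) → Dec (Intersects A B)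
intersects? A B = Fin.any? λ x → (x ∈? A) ×-dec (x ∈? B)

Disjoint-sym : ∀ {n} {A B : Subset n} → Disjoint A B → Disjoint B A
Disjoint-sym d x x∈B x∈A = d x x∈A x∈B

Disjoint-∪ : ∀ {n} {A B D : Subset n} → Disjoint A B → Disjoint A D → Disjoint A (B ∪ D)
Disjoint-∪ {B = B} {D} d e x x∈A x∈∪ = [ d x x∈A , e x x∈A ]′ (x∈p∪q⁻ B D x∈∪)

Disjoint-∅ : ∀ {n} {A : Subset n} → Disjoint A ∅
Disjoint-∅ x _ x∈ = ∉⊥ x∈

Disjoint-⁅⁆ : ∀ {n} {A : Subset n} {y} → y ∉ A → Disjoint A ⁅ y ⁆
Disjoint-⁅⁆ {A = A} {y} y∉ x x∈A x∈ = y∉ (subst (_∈ A) (x∈⁅y⁆⇒x≡y y x∈) x∈A)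

¬Disjoint⇒Intersects : ∀ {n} {A B : Subset n} → ¬ Disjoint A B → Intersects A B
¬Disjoint⇒Intersects {A = A} {B} ¬d with intersects? A B
... | yes i = i
... | no ¬i = contradiction (λ x x∈A x∈B → ¬i (x , x∈A , x∈B)) ¬d

Intersects⇒¬Disjoint : ∀ {n} {A B : Subset n} → Intersects A B → ¬ Disjoint A B
Intersects⇒¬Disjoint (x , x∈A , x∈B) d = d x x∈A x∈B

disjoint⊎intersects : ∀ {n} (A B : Subset n) → Disjoint A B ⊎ Intersects A B
disjoint⊎intersects A B with disjoint? A B
... | yes d = inj₁ d
... | no ¬d = inj₂ (¬Disjoint⇒Intersects ¬d)

elems : ∀ {n} → Subset n → List (Fin n)
elems [] = []
elems (true ∷ A) = zero ∷ map suc (elems A)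
elems (false ∷ A) = map suc (elems A)

length-elems : ∀ {n} (A : Subset n) → length (elems A) ≡ ∣ A ∣
length-elems [] = refl
length-elems (true ∷ A) = cong suc (trans (length-map suc (elems A)) (length-elems A))
length-elems (false ∷ A) = trans (length-map suc (elems A)) (length-elems A)

∈-elems⁺ : ∀ {n} {A : Subset n} {x} → x ∈ A → x ∈ᴸ elems A
∈-elems⁺ {A = true ∷ A} Vec.here = here refl
∈-elems⁺ {A = true ∷ A} (Vec.there x∈) = there (∈-map⁺ suc (∈-elems⁺ x∈))
∈-elems⁺ {A = false ∷ A} (Vec.there x∈) = ∈-map⁺ suc (∈-elems⁺ x∈)

∈-elems⁻ : ∀ {n} {A : Subset n} {x} → x ∈ᴸ elems A → x ∈ A
∈-elems⁻ {A = true ∷ A} (here refl) = Vec.here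
∈-elems⁻ {A = true ∷ A} (there x∈) with ∈-map⁻ suc x∈
... | _ , y∈ , refl = Vec.there (∈-elems⁻ y∈)
∈-elems⁻ {A = false ∷ A} x∈ with ∈-map⁻ suc x∈
... | _ , y∈ , refl = Vec.there (∈-elems⁻ y∈)

elems-unique : ∀ {n} (A : Subset n) → Unique (elems A)
elems-unique [] = []
elems-unique (true ∷ A) =
  All.map⁺ (All.tabulate λ _ ()) ∷ Unique.map⁺ Fin.suc-injective (elems-unique A)
elems-unique (false ∷ A) = Unique.map⁺ Fin.suc-injective (elems-unique A)

length≤∣∣ : ∀ {n} {A : Subset n} {L} → Unique L → (∀ {x} → x ∈ᴸ L → x ∈ A) → length L ≤ ∣ A ∣
length≤∣∣ {A = A} {L} u L⊆A = subst (length L ≤_) (length-elems A) (unique-⊆⇒length-≤ u (∈-elems⁺ ∘ L⊆A))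

∣∣≤length : ∀ {n} {A : Subset n} {L} → (∀ {x} → x ∈ A → x ∈ᴸ L) → ∣ A ∣ ≤ length L
∣∣≤length {A = A} {L} A⊆L =
  subst (_≤ length L) (length-elems A) (unique-⊆⇒length-≤ (elems-unique A) (A⊆L ∘ ∈-elems⁻))

fromList : ∀ {n} → List (Fin n) → Subset n
fromList L = ⋃ (map ⁅_⁆ L)

∈-fromList⁺ : ∀ {n} {L : List (Fin n)} {x} → x ∈ᴸ L → x ∈ fromList L
∈-fromList⁺ {L = y ∷ L} (here refl) = x∈p∪q⁺ (inj₁ (x∈⁅x⁆ y))
∈-fromList⁺ {L = y ∷ L} (there x∈) = x∈p∪q⁺ {p = ⁅ y ⁆} (inj₂ (∈-fromList⁺ x∈))

∈-fromList⁻ : ∀ {n} {L : List (Fin n)} {x} → x ∈ fromList L → x ∈ᴸ L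
∈-fromList⁻ {L = []} x∈ = ⊥-elim (∉⊥ x∈)
∈-fromList⁻ {L = y ∷ L} x∈ with x∈p∪q⁻ ⁅ y ⁆ (fromList L) x∈
... | inj₁ p = here (x∈⁅y⁆⇒x≡y y p)
... | inj₂ p = there (∈-fromList⁻ p)

∣fromList∣ : ∀ {n} {L : List (Fin n)} → Unique L → ∣ fromList L ∣ ≡ length L
∣fromList∣ {L = L} u = ≤-antisym (∣∣≤length {L = L} ∈-fromList⁻) (length≤∣∣ u ∈-fromList⁺)

fromFun : ∀ {n γ} → (Fin γ → Fin n) → Subset n
fromFun y = fromList (tabulate y)

∈-fromFun⁺ : ∀ {n γ} (y : Fin γ → Fin n) j → y j ∈ fromFun y
∈-fromFun⁺ y j = ∈-fromList⁺ (∈-tabulate⁺ j)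

∈-fromFun⁻ : ∀ {n γ} (y : Fin γ → Fin n) {x} → x ∈ fromFun y → ∃[ j ] x ≡ y j
∈-fromFun⁻ y x∈ = ∈-tabulate⁻ (∈-fromList⁻ x∈)

∣fromFun∣ : ∀ {n γ} {y : Fin γ → Fin n} → Injective _≡_ _≡_ y → ∣ fromFun y ∣ ≡ γ
∣fromFun∣ {y = y} inj = trans (∣fromList∣ (Unique.tabulate⁺ inj)) (length-tabulate y)

∣∪∣-disjoint : ∀ {n} (A B : Subset n) → Disjoint A B → ∣ A ∪ B ∣ ≡ ∣ A ∣ + ∣ B ∣
∣∪∣-disjoint [] [] d = refl
∣∪∣-disjoint (true ∷ A) (true ∷ B) d = ⊥-elim (d zero Vec.here Vec.here)
∣∪∣-disjoint (true ∷ A) (false ∷ B) d =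
  cong suc (∣∪∣-disjoint A B λ x p q → d (suc x) (Vec.there p) (Vec.there q))
∣∪∣-disjoint (false ∷ A) (true ∷ B) d =
  trans (cong suc (∣∪∣-disjoint A B λ x p q → d (suc x) (Vec.there p) (Vec.there q))) (sym (+-suc ∣ A ∣ ∣ B ∣))
∣∪∣-disjoint (false ∷ A) (false ∷ B) d = ∣∪∣-disjoint A B λ x p q → d (suc x) (Vec.there p) (Vec.there q)

∣∪∣≤ : ∀ {n} (A B : Subset n) → ∣ A ∪ B ∣ ≤ ∣ A ∣ + ∣ B ∣
∣∪∣≤ [] [] = z≤n
∣∪∣≤ (true ∷ A) (true ∷ B) = s≤s (≤-trans (∣∪∣≤ A B) (+-monoʳ-≤ ∣ A ∣ (n≤1+n _)))
∣∪∣≤ (true ∷ A) (false ∷ B) = s≤s (∣∪∣≤ A B)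
∣∪∣≤ (false ∷ A) (true ∷ B) = ≤-trans (s≤s (∣∪∣≤ A B)) (≤-reflexive (sym (+-suc ∣ A ∣ ∣ B ∣)))
∣∪∣≤ (false ∷ A) (false ∷ B) = ∣∪∣≤ A B

∣∪⁅⁆∣ : ∀ {n} {A : Subset n} {y} → y ∉ A → ∣ A ∪ ⁅ y ⁆ ∣ ≡ suc ∣ A ∣
∣∪⁅⁆∣ {A = A} {y} y∉ = trans (∣∪∣-disjoint A ⁅ y ⁆ (Disjoint-⁅⁆ y∉))
  (trans (cong (∣ A ∣ +_) (∣⁅x⁆∣≡1 y)) (+-comm ∣ A ∣ 1))

⊆∧≥⇒≡ : ∀ {n} {A B : Subset n} → A ⊆ B → ∣ B ∣ ≤ ∣ A ∣ → A ≡ B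
⊆∧≥⇒≡ {A = A} {B} A⊆B le with B ⊆? A
... | yes B⊆A = ⊆-antisym A⊆B B⊆A
... | no B⊈A with Fin.any? (λ x → (x ∈? B) ×-dec ¬? (x ∈? A))
...   | yes (x , x∈B , x∉A) = contradiction (p⊂q⇒∣p∣<∣q∣ (A⊆B , x , x∈B , x∉A)) (≤⇒≯ le)
...   | no none = contradiction (λ {x} x∈B → decidable-stable (x ∈? A) λ x∉A → none (x , x∈B , x∉A)) B⊈A

∣∣<⇒∃∉ : ∀ {n} {A B : Subset n} → ∣ A ∣ < ∣ B ∣ → ∃[ x ] (x ∈ B × x ∉ A)
∣∣<⇒∃∉ {A = A} {B} lt with Fin.any? (λ x → (x ∈? B) ×-dec ¬? (x ∈? A))
... | yes p = p
... | no none = contradiction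
  (p⊆q⇒∣p∣≤∣q∣ {p = B} {q = A} λ {x} x∈B → decidable-stable (x ∈? A) λ x∉A → none (x , x∈B , x∉A)) (<⇒≱ lt)

⊆⇒≡∪⁅⁆ : ∀ {n} {E A : Subset n} → E ⊆ A → ∣ A ∣ ≡ suc ∣ E ∣ → ∃[ y ] (y ∉ E × A ≡ E ∪ ⁅ y ⁆)
⊆⇒≡∪⁅⁆ {E = E} {A} E⊆A eq with ∣∣<⇒∃∉ {A = E} {A} (≤-reflexive (sym eq))
... | y , y∈A , y∉E = y , y∉E , sym (⊆∧≥⇒≡ ⊆A (≤-reflexive (trans eq (sym (∣∪⁅⁆∣ y∉E)))))
  where
  ⊆A : E ∪ ⁅ y ⁆ ⊆ A
  ⊆A {x} x∈ with x∈p∪q⁻ E ⁅ y ⁆ x∈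
  ... | inj₁ x∈E = E⊆A x∈E
  ... | inj₂ x∈y = subst (_∈ A) (sym (x∈⁅y⁆⇒x≡y y x∈y)) y∈A

-- Counting sets between a forced and a forbidden set

record Between {n} (k : ℕ) (V W A : Subset n) : Set where
  constructor between
  field
    size : ∣ A ∣ ≡ k
    contains : V ⊆ A
    avoids : Disjoint A W

open Between

between? : ∀ {n} k (V W : Subset n) → Decidable (Between k V W)
between? k V W A with ∣ A ∣ ≟ k | V ⊆? A | disjoint? A W
... | yes s | yes c | yes a = yes (between s c a)
... | no ¬s | _ | _ = no (¬s ∘ size)
... | yes _ | no ¬c | _ = no λ b → ¬c (contains b)
... | yes _ | yes _ | no ¬a = no (¬a ∘ avoids)

#-empty : ∀ {n} {P : Pred (Subset n) 0ℓ} (P? : Decidable P) → (∀ {A} → P A → ⊥) → # P? ≡ 0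
#-empty P? none = n≤0⇒n≡0 (#≤length P? {L = []} λ p → ⊥-elim (none p))

free : ∀ {n} → Subset n → Subset n → ℕ
free [] [] = 0
free (false ∷ V) (false ∷ W) = suc (free V W)
free (_ ∷ V) (_ ∷ W) = free V W

Disjoint-tail : ∀ {n} {V W : Subset n} {a b} → Disjoint (a ∷ V) (b ∷ W) → Disjoint V W
Disjoint-tail d x p q = d (suc x) (Vec.there p) (Vec.there q)

free-eq : ∀ {n} (V W : Subset n) → Disjoint V W → ∣ V ∣ + ∣ W ∣ + free V W ≡ n
free-eq [] [] d = refl
free-eq (true ∷ V) (true ∷ W) d = ⊥-elim (d zero Vec.here Vec.here)
free-eq (true ∷ V) (false ∷ W) d = cong suc (free-eq V W (Disjoint-tail d))
free-eq (false ∷ V) (true ∷ W) d =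
  trans (cong (_+ free V W) (+-suc ∣ V ∣ ∣ W ∣)) (cong suc (free-eq V W (Disjoint-tail d)))
free-eq (false ∷ V) (false ∷ W) d = trans (+-suc _ _) (cong suc (free-eq V W (Disjoint-tail d)))

-- A forced or forbidden coordinate leaves a single choice; a free one is Pascal's rule. The form
-- `∣ V ∣ + j` of the size keeps the number j of further elements explicit.
#-between-free : ∀ {n} (V W : Subset n) j → Disjoint V W →
                 # (between? (∣ V ∣ + j) V W) ≡ free V W C j
#-between-free [] [] zero d = ≤-antisym
  (≤-trans (#≤length (between? 0 [] []) {L = [] ∷ []} λ { {[]} _ → here refl }) (≤-reflexive (sym (C-zero 0))))
  (≤-trans (≤-reflexive (C-zero 0)) (#≥1 (between? 0 [] []) {A = []} (between refl id d)))
#-between-free [] [] (suc j) d =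
  trans (#-empty (between? (suc j) [] []) λ { {[]} (between () _ _) }) (sym (0C-suc j))
#-between-free (true ∷ V) (true ∷ W) j d = ⊥-elim (d zero Vec.here Vec.here)
#-between-free (true ∷ V) (false ∷ W) j d = begin
  # B?                                   ≡⟨ #-suc B? ⟩
  # (B? ∘ (true ∷_)) + # (B? ∘ (false ∷_))
    ≡⟨ cong₂ _+_ (#-cong (B? ∘ (true ∷_)) (between? (∣ V ∣ + j) V W)
                   (λ (between s c a) → between (suc-injective s) (drop-∷-⊆ c) (Disjoint-tail a))
                   (λ (between s c a) → between (cong suc s) (s⊆s c) λ where (suc x) (Vec.there p) (Vec.there q) → a x p q))
                 (#-empty (B? ∘ (false ∷_)) λ b → contradiction (contains b Vec.here) λ ()) ⟩
  # (between? (∣ V ∣ + j) V W) + 0       ≡⟨ +-identityʳ _ ⟩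
  # (between? (∣ V ∣ + j) V W)           ≡⟨ #-between-free V W j (Disjoint-tail d) ⟩
  free V W C j                           ∎
  where
  open ≡-Reasoning
  B? = between? (suc (∣ V ∣ + j)) (true ∷ V) (false ∷ W)
#-between-free (false ∷ V) (true ∷ W) j d = begin
  # B?                                   ≡⟨ #-suc B? ⟩
  # (B? ∘ (true ∷_)) + # (B? ∘ (false ∷_))
    ≡⟨ cong₂ _+_ (#-empty (B? ∘ (true ∷_)) λ b → avoids b zero Vec.here Vec.here)
                 (#-cong (B? ∘ (false ∷_)) (between? (∣ V ∣ + j) V W)
                   (λ (between s c a) → between s (drop-∷-⊆ c) (Disjoint-tail a))
                   (λ (between s c a) → between s (s⊆s c) λ where (suc x) (Vec.there p) (Vec.there q) → a x p q)) ⟩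
  # (between? (∣ V ∣ + j) V W)           ≡⟨ #-between-free V W j (Disjoint-tail d) ⟩
  free V W C j                           ∎
  where
  open ≡-Reasoning
  B? = between? (∣ V ∣ + j) (false ∷ V) (true ∷ W)
#-between-free (false ∷ V) (false ∷ W) j d = begin
  # (B? j)                               ≡⟨ #-suc (B? j) ⟩
  # (B? j ∘ (true ∷_)) + # (B? j ∘ (false ∷_))
    ≡⟨ cong (# (B? j ∘ (true ∷_)) +_) (trans
         (#-cong (B? j ∘ (false ∷_)) (between? (∣ V ∣ + j) V W)
           (λ (between s c a) → between s (drop-∷-⊆ c) (Disjoint-tail a))
           (λ (between s c a) → between s (s⊆s c) (extend a)))
         (#-between-free V W j (Disjoint-tail d))) ⟩
  # (B? j ∘ (true ∷_)) + free V W C j    ≡⟨ with-zero j ⟩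
  suc (free V W) C j                     ∎
  where
  open ≡-Reasoning
  B? : ∀ j → Decidable (Between (∣ V ∣ + j) (false ∷ V) (false ∷ W))
  B? j = between? (∣ V ∣ + j) (false ∷ V) (false ∷ W)
  extend : ∀ {A b} → Disjoint A W → Disjoint (b ∷ A) (false ∷ W)
  extend a (suc x) (Vec.there p) (Vec.there q) = a x p q
  with-zero : ∀ j → # (B? j ∘ (true ∷_)) + free V W C j ≡ suc (free V W) C j
  -- For j = 0 the forced elements already fill the set, so it cannot contain a free coordinate.
  with-zero zero = trans
    (cong₂ _+_ (#-empty (B? 0 ∘ (true ∷_)) λ {A} (between s c a) →
                  contradiction (p⊆q⇒∣p∣≤∣q∣ (drop-∷-⊆ c)) (<⇒≱ (≤-reflexive (trans s (+-identityʳ _)))))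
               (C-zero (free V W)))
    (sym (C-zero (suc (free V W))))
  with-zero (suc j) = trans
    (cong (_+ free V W C suc j) (trans
      (#-cong (B? (suc j) ∘ (true ∷_)) (between? (∣ V ∣ + j) V W)
        (λ (between s c a) → between (suc-injective (trans s (+-suc ∣ V ∣ j))) (drop-∷-⊆ c) (Disjoint-tail a))
        (λ (between s c a) → between (trans (cong suc s) (sym (+-suc ∣ V ∣ j))) (out⊆ c) (extend a)))
      (#-between-free V W j (Disjoint-tail d))))
    (sym (pascal (free V W) j))

#-between : ∀ {n k j f} {V W : Subset n} → Disjoint V W → ∣ V ∣ + j ≡ k → ∣ V ∣ + ∣ W ∣ + f ≡ n →
            # (between? k V W) ≡ f C j
#-between {j = j} {f} {V} {W} d refl eq = trans (#-between-free V W j d)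
  (cong (_C j) (+-cancelˡ-≡ (∣ V ∣ + ∣ W ∣) _ _ (trans (free-eq V W d) (sym eq))))

#-contains≤ : ∀ {n k j} {V : Subset n} → ∣ V ∣ + j ≡ k → # (between? k V ∅) ≤ n C j
#-contains≤ {n} {k} {j} {V} refl = begin
  # (between? (∣ V ∣ + j) V ∅)   ≡⟨ #-between-free V ∅ j Disjoint-∅ ⟩
  free V ∅ C j                   ≤⟨ C-mono-≤ j (≤-trans (m≤n+m _ _) (≤-reflexive (free-eq V ∅ Disjoint-∅))) ⟩
  n C j                          ∎
  where open ≤-Reasoning

meets? : ∀ {n} k (Z : Subset n) → Decidable (λ A → ∣ A ∣ ≡ k × Intersects A Z)
meets? k Z A = (∣ A ∣ ≟ k) ×-dec intersects? A Z

#-meets : ∀ {n k f} {Z : Subset n} → ∣ Z ∣ + f ≡ n → # (meets? k Z) + f C k ≡ n C k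
#-meets {n} {k} {f} {Z} eq = sym (begin
  n C k                                   ≡⟨ #-between {j = k} {V = ∅} {∅} Disjoint-∅ (cong (_+ k) (∣⊥∣≡0 n))
                                              (cong₂ (λ a b → a + b + n) (∣⊥∣≡0 n) (∣⊥∣≡0 n)) ⟨
  # (between? k ∅ ∅)                      ≡⟨ #-split (between? k ∅ ∅) (meets? k Z) (between? k ∅ Z)
      (λ {A} b → [ (λ d → inj₂ (between (size b) (contains b) d)) , (λ i → inj₁ (size b , i)) ]′ (disjoint⊎intersects A Z))
      (λ (s , i) → between s ⊥⊆ Disjoint-∅)
      (λ b → between (size b) (contains b) Disjoint-∅)
      (λ (s , i) b → Intersects⇒¬Disjoint i (avoids b)) ⟩
  # (meets? k Z) + # (between? k ∅ Z)     ≡⟨ cong (# (meets? k Z) +_) (#-between {j = k} {f} {V = ∅} {Z} (λ x x∈ _ → ∉⊥ x∈)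
                                               (cong (_+ k) (∣⊥∣≡0 n)) (trans (cong (λ a → a + ∣ Z ∣ + f) (∣⊥∣≡0 n)) eq)) ⟩
  # (meets? k Z) + f C k                  ∎)
  where open ≡-Reasoning

module _ {n : ℕ} {P : Pred (Subset n) 0ℓ} (P? : Decidable P) (W : Subset n) where

  disjointPart? : Decidable (λ A → P A × Disjoint A W)
  disjointPart? A = P? A ×-dec disjoint? A W

  star? : ∀ y → Decidable (λ A → P A × y ∈ A)
  star? y A = P? A ×-dec (y ∈? A)

  #-avoid : ∀ {c} → (∀ {y} → y ∈ W → # (star? y) ≤ c) → # P? ≤ # disjointPart? + ∣ W ∣ * c
  #-avoid {c} bound = begin
    # P?                                  ≤⟨ #-cover₂ P? disjointPart? M? (λ {A} p →
                                               [ (λ d → inj₁ (p , d)) , (λ i → inj₂ (p , i)) ]′ (disjoint⊎intersects A W)) ⟩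
    # disjointPart? + # M?                ≤⟨ +-monoʳ-≤ (# disjointPart?)
                                               (#-cover star? c M? (elems W) (λ (p , y , y∈A , y∈W) → y , ∈-elems⁺ y∈W , p , y∈A)
                                                 (bound ∘ ∈-elems⁻)) ⟩
    # disjointPart? + length (elems W) * c ≡⟨ cong (λ l → # disjointPart? + l * c) (length-elems W) ⟩
    # disjointPart? + ∣ W ∣ * c           ∎
    where
    open ≤-Reasoning
    M? : Decidable (λ A → P A × Intersects A W)
    M? A = P? A ×-dec intersects? A W

  -- A member lost to y ∈ W contains V and y, which are ∣V∣ + 1 elements. Used with V a big element,
  -- where j = k - 2, and with V a heavy pair, where j = k - 3.
  #-avoid-contains : ∀ {k j} {V : Subset n} → (∀ {A} → P A → ∣ A ∣ ≡ k) → (∀ {A} → P A → V ⊆ A) →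
                     Disjoint V W → suc ∣ V ∣ + j ≡ k → # P? ≤ # disjointPart? + ∣ W ∣ * (n C j)
  #-avoid-contains {k} {j} {V} size V⊆ V∦W eq = #-avoid λ {y} y∈W → ≤-trans
    (#-mono (star? y) (between? k (V ∪ ⁅ y ⁆) ∅) λ {A} (p , y∈A) → between (size p)
      (λ {x} x∈ → [ V⊆ p , (λ q → subst (_∈ A) (sym (x∈⁅y⁆⇒x≡y y q)) y∈A) ]′ (x∈p∪q⁻ V ⁅ y ⁆ x∈)) Disjoint-∅)
    (#-contains≤ {j = j} (trans (cong (_+ j) (∣∪⁅⁆∣ λ y∈V → V∦W y y∈V y∈W)) eq))

-- Greedy choice of complete multipartite subgraphs

∈-⋃⁺ : ∀ {n q} (g : Fin q → Subset n) j {x} → x ∈ g j → x ∈ ⋃ (tabulate g)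
∈-⋃⁺ g zero x∈ = x∈p∪q⁺ (inj₁ x∈)
∈-⋃⁺ g (suc j) x∈ = x∈p∪q⁺ {p = g zero} (inj₂ (∈-⋃⁺ (g ∘ suc) j x∈))

∈-⋃⁻ : ∀ {n q} (g : Fin q → Subset n) {x} → x ∈ ⋃ (tabulate g) → ∃[ j ] x ∈ g j
∈-⋃⁻ {q = zero} g x∈ = ⊥-elim (∉⊥ x∈)
∈-⋃⁻ {q = suc q} g x∈ with x∈p∪q⁻ (g zero) (⋃ (tabulate (g ∘ suc))) x∈
... | inj₁ p = zero , p
... | inj₂ p = let (j , x∈j) = ∈-⋃⁻ (g ∘ suc) p in suc j , x∈j

∣⋃∣≤ : ∀ {n q c} (g : Fin q → Subset n) → (∀ j → ∣ g j ∣ ≤ c) → ∣ ⋃ (tabulate g) ∣ ≤ q * c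
∣⋃∣≤ {n} {zero} g _ = ≤-reflexive (∣⊥∣≡0 n)
∣⋃∣≤ {q = suc q} g le = ≤-trans (∣∪∣≤ (g zero) _) (+-mono-≤ (le zero) (∣⋃∣≤ (g ∘ suc) (le ∘ suc)))

record Parts {n p : ℕ} (F : List (Subset n)) (T : Subset n) (sz : Fin p → ℕ) : Set where
  field
    member : ∀ i → Fin (sz i) → Subset n
    member-injective : ∀ i → Injective _≡_ _≡_ (member i)
    member∈ : ∀ i j → member i j ∈ᴸ F
    member-avoids : ∀ i j → Disjoint (member i j) T
    cross : ∀ {i i′} j j′ → i ≢ i′ → Disjoint (member i j) (member i′ j′)

open Parts

-- A hub is what the members offered for a part may be forced to contain, so only sets T disjoint
-- from it can be avoided. It is empty when degrees are small, and a single big element when a part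
-- is taken from a star.
Supply : ∀ {n p} → List (Subset n) → (Fin p → Subset n) → ℕ → (Fin p → ℕ) → Set
Supply {n} F hub D sz = ∀ i (T : Subset n) → ∣ T ∣ ≤ D → Disjoint (hub i) T →
  ∃[ g ] (Injective {A = Fin (sz i)} {B = Subset n} _≡_ _≡_ g × (∀ j → g j ∈ᴸ F × Disjoint (g j) T))

module _ {n k : ℕ} {F : List (Subset n)} (size-F : ∀ {A} → A ∈ᴸ F → ∣ A ∣ ≡ k) where

  -- While part i is being chosen, the hubs of the later parts are avoided as well,
  -- so that those parts stay available.
  greedy : ∀ {σ D p} {sz : Fin p → ℕ} {hub : Fin p → Subset n} →
           (∀ i → sz i ≤ σ) → (∀ i → ∣ hub i ∣ ≤ 1) →
           (∀ {i i′} → i ≢ i′ → Disjoint (hub i) (hub i′)) → Supply F hub D sz →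
           ∀ T → (∀ i → Disjoint (hub i) T) → ∣ T ∣ + p * suc (σ * k) ≤ D → Parts F T sz
  greedy {p = zero} _ _ _ _ T _ _ = record
    { member = λ () ; member-injective = λ () ; member∈ = λ () ; member-avoids = λ ()
    ; cross = λ { {()} } }
  greedy {σ} {D} {suc p} {sz} {hub} sz≤ hub≤ hubs supply T hub∦T budget = record
    { member = mem ; member-injective = mem-inj ; member∈ = mem∈ ; member-avoids = mem-avoids ; cross = mem-cross }
    where
    open ≤-Reasoning
    H T₁ T₂ : Subset n
    H = ⋃ (tabulate (hub ∘ suc))
    T₁ = T ∪ H
    -- Each remaining part is budgeted σ k elements for its members and one for its hub.
    ∣T₁∣≤ : ∣ T₁ ∣ ≤ D
    ∣T₁∣≤ = begin
      ∣ T ∪ H ∣                       ≤⟨ ∣∪∣≤ T H ⟩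
      ∣ T ∣ + ∣ H ∣                   ≤⟨ +-monoʳ-≤ ∣ T ∣ (∣⋃∣≤ (hub ∘ suc) (hub≤ ∘ suc)) ⟩
      ∣ T ∣ + p * 1                   ≤⟨ +-monoʳ-≤ ∣ T ∣ (*-mono-≤ (n≤1+n p) (s≤s z≤n)) ⟩
      ∣ T ∣ + suc p * suc (σ * k)     ≤⟨ budget ⟩
      D                               ∎
    hub₀∦T₁ : Disjoint (hub zero) T₁
    hub₀∦T₁ = Disjoint-∪ (hub∦T zero) λ x x∈ x∈H →
      let (j , x∈j) = ∈-⋃⁻ (hub ∘ suc) x∈H in hubs (λ ()) x x∈ x∈j
    chosen = supply zero T₁ ∣T₁∣≤ hub₀∦T₁
    g : Fin (sz zero) → Subset n
    g = proj₁ chosen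
    g-avoids : ∀ j → Disjoint (g j) T₁
    g-avoids j = proj₂ (proj₂ (proj₂ chosen) j)
    g∈ : ∀ j → g j ∈ᴸ F
    g∈ j = proj₁ (proj₂ (proj₂ chosen) j)
    T₂ = T ∪ ⋃ (tabulate g)
    budget₂ : ∣ T₂ ∣ + p * suc (σ * k) ≤ D
    budget₂ = begin
      ∣ T₂ ∣ + p * suc (σ * k)
        ≤⟨ +-monoˡ-≤ _ (≤-trans (∣∪∣≤ T _) (+-monoʳ-≤ ∣ T ∣ (∣⋃∣≤ g λ j → ≤-reflexive (size-F (g∈ j))))) ⟩
      ∣ T ∣ + sz zero * k + p * suc (σ * k)
        ≤⟨ +-monoˡ-≤ _ (+-monoʳ-≤ ∣ T ∣ (≤-trans (*-monoˡ-≤ k (sz≤ zero)) (n≤1+n _))) ⟩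
      ∣ T ∣ + suc (σ * k) + p * suc (σ * k)
        ≡⟨ +-assoc ∣ T ∣ _ _ ⟩
      ∣ T ∣ + suc p * suc (σ * k)
        ≤⟨ budget ⟩
      D ∎
    hub∦T₂ : ∀ i → Disjoint (hub (suc i)) T₂
    hub∦T₂ i = Disjoint-∪ (hub∦T (suc i)) λ x x∈ x∈⋃ →
      let (j , x∈j) = ∈-⋃⁻ g x∈⋃ in
      g-avoids j x x∈j (x∈p∪q⁺ {p = T} (inj₂ (∈-⋃⁺ (hub ∘ suc) i x∈)))
    rest : Parts F T₂ (sz ∘ suc)
    rest = greedy (sz≤ ∘ suc) (hub≤ ∘ suc) (λ i≢ → hubs (i≢ ∘ Fin.suc-injective))
                  (supply ∘ suc) T₂ hub∦T₂ budget₂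
    mem : ∀ i → Fin (sz i) → Subset n
    mem zero = g
    mem (suc i) = member rest i
    mem-inj : ∀ i → Injective _≡_ _≡_ (mem i)
    mem-inj zero = proj₁ (proj₂ chosen)
    mem-inj (suc i) = member-injective rest i
    mem∈ : ∀ i j → mem i j ∈ᴸ F
    mem∈ zero = g∈
    mem∈ (suc i) = member∈ rest i
    mem-avoids : ∀ i j → Disjoint (mem i j) T
    mem-avoids zero j x x∈ x∈T = g-avoids j x x∈ (x∈p∪q⁺ (inj₁ x∈T))
    mem-avoids (suc i) j x x∈ x∈T = member-avoids rest i j x x∈ (x∈p∪q⁺ (inj₁ x∈T))
    g∦rest : ∀ i j j′ → Disjoint (g j′) (member rest i j)
    g∦rest i j j′ x x∈g x∈ = member-avoids rest i j x x∈ (x∈p∪q⁺ {p = T} (inj₂ (∈-⋃⁺ g j′ x∈g)))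
    mem-cross : ∀ {i i′} j j′ → i ≢ i′ → Disjoint (mem i j) (mem i′ j′)
    mem-cross {zero} {zero} j j′ i≢ = contradiction refl i≢
    mem-cross {zero} {suc i′} j j′ _ = g∦rest i′ j′ j
    mem-cross {suc i} {zero} j j′ _ = Disjoint-sym (g∦rest i j j′)
    mem-cross {suc i} {suc i′} j j′ i≢ = cross rest j j′ (i≢ ∘ cong suc)

  module _ (1≤k : 1 ≤ k) where

    ∃∈ : ∀ {A} → A ∈ᴸ F → ∃[ x ] x ∈ A
    ∃∈ {A} A∈ with ∣∣<⇒∃∉ {A = ∅} {A} (subst₂ _<_ (sym (∣⊥∣≡0 n)) (sym (size-F A∈)) 1≤k)
    ... | x , x∈ , _ = x , x∈

    disjoint⇒≢ : ∀ {A B} → A ∈ᴸ F → Disjoint A B → A ≢ B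
    disjoint⇒≢ A∈ d refl = let (x , x∈) = ∃∈ A∈ in d x x∈ x∈

    -- Injectivity across different parts costs nothing: disjoint members are distinct because k ≥ 1
    -- makes them non-empty.
    multipartite : ∀ {m} {sz : Fin m → ℕ} {T} → Parts F T sz → ContainsCompleteMultipartite F sz
    multipartite {m} {sz} P =
      (λ (i , j) → member P i j) , inj , (λ (i , j) → member∈ P i j) ,
      λ (i , j) (i′ , j′) i≢ → cross P j j′ i≢
      where
      inj : ∀ {u v : Σ (Fin m) (Fin ∘ sz)} → member P (proj₁ u) (proj₂ u) ≡ member P (proj₁ v) (proj₂ v) → u ≡ v
      inj {i , j} {i′ , j′} eq with i Fin.≟ i′
      ... | yes refl = cong (i ,_) (member-injective P i eq)
      ... | no i≢ = contradiction eq (disjoint⇒≢ (member∈ P i j) (cross P j j′ i≢))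

    -- Completes a K_{1,t} to the forbidden graph. A is the part of size 1 and g the last part, of
    -- size s_r; `view` separates that top index from the other r - 1 parts, which were chosen
    -- outside T and hence are disjoint from the whole K_{1,t}.
    multipartite-∷ : ∀ {r′} {s : Fin (suc r′) → ℕ} {T} → Parts F T (s ∘ inject₁) →
      ∀ {A} → A ∈ᴸ F → A ⊆ T → (g : Fin (s (fromℕ r′)) → Subset n) → Injective _≡_ _≡_ g →
      (∀ j → g j ∈ᴸ F × g j ⊆ T × Disjoint A (g j)) → ContainsCompleteMultipartite F (1 Vector.∷ s)
    multipartite-∷ {r′} {s} {T} P {A} A∈ A⊆T g g-inj gp = multipartite {T = ∅} (record
      { member = mem ; member-injective = mem-inj ; member∈ = mem∈
      ; member-avoids = λ _ _ → Disjoint-∅ ; cross = λ {i} {i′} → mem-cross {i} {i′} })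
      where
      pick : ∀ {i} → View i → Fin (s i) → Subset n
      pick ‵fromℕ = g
      pick (‵inject₁ i) = member P i
      pick-inj : ∀ {i} (v : View i) → Injective _≡_ _≡_ (pick v)
      pick-inj ‵fromℕ = g-inj
      pick-inj (‵inject₁ i) = member-injective P i
      pick∈ : ∀ {i} (v : View i) j → pick v j ∈ᴸ F
      pick∈ ‵fromℕ j = proj₁ (gp j)
      pick∈ (‵inject₁ i) = member∈ P i
      A∦pick : ∀ {i} (v : View i) j → Disjoint A (pick v j)
      A∦pick ‵fromℕ j = proj₂ (proj₂ (gp j))
      A∦pick (‵inject₁ i) j x x∈A x∈ = member-avoids P i j x x∈ (A⊆T x∈A)
      pick-cross : ∀ {i i′} (v : View i) (v′ : View i′) j j′ → i ≢ i′ → Disjoint (pick v j) (pick v′ j′)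
      pick-cross ‵fromℕ ‵fromℕ j j′ i≢ = contradiction refl i≢
      pick-cross ‵fromℕ (‵inject₁ i′) j j′ _ x x∈ x∈′ = member-avoids P i′ j′ x x∈′ (proj₁ (proj₂ (gp j)) x∈)
      pick-cross (‵inject₁ i) ‵fromℕ j j′ _ x x∈ x∈′ = member-avoids P i j x x∈ (proj₁ (proj₂ (gp j′)) x∈′)
      pick-cross (‵inject₁ i) (‵inject₁ i′) j j′ i≢ = cross P j j′ (i≢ ∘ cong inject₁)
      sz = 1 Vector.∷ s
      mem : ∀ i → Fin (sz i) → Subset n
      mem zero _ = A
      mem (suc i) = pick (view i)
      mem-inj : ∀ i → Injective _≡_ _≡_ (mem i)
      mem-inj zero {zero} {zero} _ = refl
      mem-inj (suc i) = pick-inj (view i)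
      mem∈ : ∀ i j → mem i j ∈ᴸ F
      mem∈ zero _ = A∈
      mem∈ (suc i) = pick∈ (view i)
      mem-cross : ∀ {i i′} j j′ → i ≢ i′ → Disjoint (mem i j) (mem i′ j′)
      mem-cross {zero} {zero} j j′ i≢ = contradiction refl i≢
      mem-cross {zero} {suc i′} j j′ _ = A∦pick (view i′) j′
      mem-cross {suc i} {zero} j j′ _ = Disjoint-sym (A∦pick (view i) j)
      mem-cross {suc i} {suc i′} j j′ i≢ = pick-cross (view i) (view i′) j j′ (i≢ ∘ cong suc)

-- Elements of large degree

-- The budget bounds every set T that the greedy choice has to avoid.  At most ∣T∣ C₂ of the
-- k-sets through an element outside T meet T, so the degree threshold θ C₂ leaves σ members.
budget : ℕ → ℕ → ℕ → ℕ
budget σ r′ k = suc (suc r′) * suc (σ * k) + suc σ * k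

module Bigs {n k₃ r′ : ℕ} (s : Fin (suc r′) → ℕ) (σ : ℕ) (1≤σ : 1 ≤ σ) (s≤σ : ∀ i → s i ≤ σ)
  (F : List (Subset n)) (size-F : ∀ {A} → A ∈ᴸ F → ∣ A ∣ ≡ 3 + k₃)
  (free-F : ¬ ContainsCompleteMultipartite F (1 Vector.∷ s)) where

  k D θ C₂ : ℕ
  k = 3 + k₃
  D = budget σ r′ k
  θ = D + σ
  C₂ = n C (suc k₃)

  member? : Decidable (_∈ᴸ F)
  member? A = A ∈ˢ? F

  avoiding? : ∀ Z → Decidable (λ A → A ∈ᴸ F × Disjoint A Z)
  avoiding? = disjointPart? member?

  Big : Fin n → Set
  Big y = θ * C₂ ≤ # (star? member? ∅ y)

  -- If no degree is large, a set T of at most D elements meets at most D θ C₂ members, so in a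
  -- larger family the greedy choice with empty hubs never gets stuck and builds all r + 1 parts.
  sparse⇒small : ∀ Z → (∀ y → # (star? (avoiding? Z) ∅ y) ≤ θ * C₂) → # (avoiding? Z) < σ + D * (θ * C₂)
  sparse⇒small Z sparse = ≰⇒> λ large → free-F (multipartite size-F (s≤s z≤n)
    (greedy size-F {σ} {D} sz≤ (λ _ → ≤-trans (≤-reflexive (∣⊥∣≡0 n)) z≤n) (λ _ x x∈ _ → ∉⊥ x∈)
      (supply large) ∅ (λ _ x x∈ _ → ∉⊥ x∈)
      (≤-trans (≤-reflexive (cong (_+ suc (suc r′) * suc (σ * k)) (∣⊥∣≡0 n))) (m≤m+n _ _))))
    where
    sz≤ : ∀ i → (1 Vector.∷ s) i ≤ σ
    sz≤ zero = 1≤σ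
    sz≤ (suc i) = s≤σ i
    supply : σ + D * (θ * C₂) ≤ # (avoiding? Z) → Supply F (λ _ → ∅) D (1 Vector.∷ s)
    supply large i T T≤ _ =
      let (g , inj , gp) = choose (disjointPart? (avoiding? Z) T) enough
      in g , inj , λ j → proj₁ (proj₁ (gp j)) , proj₂ (gp j)
      where
      open ≤-Reasoning
      enough : (1 Vector.∷ s) i ≤ # (disjointPart? (avoiding? Z) T)
      enough = ≤-trans (sz≤ i) (+-cancelʳ-≤ (D * (θ * C₂)) _ _ (begin
        σ + D * (θ * C₂)                                             ≤⟨ large ⟩
        # (avoiding? Z)                                              ≤⟨ #-avoid (avoiding? Z) T (λ {y} _ → sparse y) ⟩
        # (disjointPart? (avoiding? Z) T) + ∣ T ∣ * (θ * C₂)         ≤⟨ +-monoʳ-≤ _ (*-monoˡ-≤ (θ * C₂) T≤) ⟩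
        # (disjointPart? (avoiding? Z) T) + D * (θ * C₂)             ∎))

  module _ (C₂≥1 : 1 ≤ C₂) where

    big⇒many : ∀ {y} T → Big y → ∣ T ∣ ≤ D → Disjoint ⁅ y ⁆ T → σ ≤ # (disjointPart? (star? member? ∅ y) T)
    big⇒many {y} T big T≤ y∦T = ≤-trans (≤-trans (≤-reflexive (sym (*-identityʳ σ))) (*-monoʳ-≤ σ C₂≥1))
      (+-cancelʳ-≤ (D * C₂) _ _ (begin
        σ * C₂ + D * C₂                                     ≡⟨ *-distribʳ-+ C₂ σ D ⟨
        (σ + D) * C₂                                        ≡⟨ cong (_* C₂) (+-comm σ D) ⟩
        θ * C₂                                              ≤⟨ big ⟩
        # (star? member? ∅ y)                               ≤⟨ #-avoid-contains (star? member? ∅ y) T {j = suc k₃} {V = ⁅ y ⁆} (size-F ∘ proj₁)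
                                                                 (λ {A} (_ , y∈) x∈ → subst (_∈ A) (sym (x∈⁅y⁆⇒x≡y y x∈)) y∈) y∦T
                                                                 (cong (λ c → suc c + suc k₃) (∣⁅x⁆∣≡1 y)) ⟩
        # (disjointPart? (star? member? ∅ y) T) + ∣ T ∣ * C₂ ≤⟨ +-monoʳ-≤ _ (*-monoˡ-≤ C₂ T≤) ⟩
        # (disjointPart? (star? member? ∅ y) T) + D * C₂     ∎))
      where open ≤-Reasoning

    module _ {N : ℕ} (n≡ : r′ + N ≡ n) (unique-F : Unique F)
             (large-F : n C k ≤ length F + N C k)
             (large-n : (r′ + (D * θ + σ)) * C₂ ≤ n C (2 + k₃)) where

      -- At least N + 1 elements lie outside Z. Even if F contains every k-set meeting Z, at least
      -- C(N + 1, k) - C(N, k) = C(N, k - 1) members must avoid Z, and this dominates multiples of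
      -- C(n, k - 2).
      #-avoiding≥ : ∀ {z} Z → z < r′ → ∣ Z ∣ ≡ z → σ + D * (θ * C₂) ≤ # (avoiding? Z)
      #-avoiding≥ {z} Z z<r′ refl = +-cancelʳ-≤ (r′ * C₂) _ _ (begin
        σ + D * (θ * C₂) + r′ * C₂      ≤⟨ +-monoˡ-≤ (r′ * C₂) (+-monoˡ-≤ (D * (θ * C₂))
                                            (≤-trans (≤-reflexive (sym (*-identityʳ σ))) (*-monoʳ-≤ σ C₂≥1))) ⟩
        σ * C₂ + D * (θ * C₂) + r′ * C₂ ≡⟨ collect σ D θ r′ C₂ ⟩
        (r′ + (D * θ + σ)) * C₂         ≤⟨ large-n ⟩
        n C (2 + k₃)                    ≡⟨ cong (_C (2 + k₃)) n≡ ⟨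
        (r′ + N) C (2 + k₃)             ≤⟨ C-increment-≤ r′ N (suc k₃) ⟩
        N C (2 + k₃) + r′ * ((r′ + N) C (suc k₃)) ≡⟨ cong (λ m → N C (2 + k₃) + r′ * (m C (suc k₃))) n≡ ⟩
        N C (2 + k₃) + r′ * C₂          ≤⟨ +-monoˡ-≤ (r′ * C₂) N≤ ⟩
        # (avoiding? Z) + r′ * C₂       ∎)
        where
        open ≤-Reasoning
        collect : ∀ σ D θ r c → σ * c + D * (θ * c) + r * c ≡ (r + (D * θ + σ)) * c
        collect = solve-∀
        f = n ∸ ∣ Z ∣
        N<f : suc N ≤ f
        N<f = +-cancelˡ-≤ z _ _ (begin
          z + suc N   ≡⟨ +-suc z N ⟩
          suc z + N   ≤⟨ +-monoˡ-≤ N z<r′ ⟩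
          r′ + N      ≡⟨ n≡ ⟩
          n           ≡⟨ m+[n∸m]≡n (∣p∣≤n Z) ⟨
          z + f       ∎)
        rearrange : ∀ a b c d → a + b + (c + d) ≡ a + (c + (b + d))
        rearrange = solve-∀
        N≤ : N C (2 + k₃) ≤ # (avoiding? Z)
        N≤ = +-cancelˡ-≤ (# (meets? k Z) + N C k) _ _ (begin
          # (meets? k Z) + N C k + N C (2 + k₃)       ≡⟨ trans (+-assoc (# (meets? k Z)) _ _) (cong (# (meets? k Z) +_) (trans (+-comm (N C k) _) (sym (pascal N (2 + k₃))))) ⟩
          # (meets? k Z) + suc N C k                  ≤⟨ +-monoʳ-≤ (# (meets? k Z)) (C-mono-≤ k N<f) ⟩
          # (meets? k Z) + f C k                      ≡⟨ #-meets {k = k} {Z = Z} (m+[n∸m]≡n (∣p∣≤n Z)) ⟩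
          n C k                                       ≤⟨ large-F ⟩
          length F + N C k                            ≤⟨ +-monoˡ-≤ (N C k) (length≤# member? unique-F id) ⟩
          # member? + N C k                           ≤⟨ +-monoˡ-≤ (N C k) (#-cover₂ member? (meets? k Z) (avoiding? Z) λ {A} A∈ →
                                                           [ (λ d → inj₂ (A∈ , d)) , (λ i → inj₁ (size-F A∈ , i)) ]′ (disjoint⊎intersects A Z)) ⟩
          # (meets? k Z) + # (avoiding? Z) + N C k    ≡⟨ swap₃ (# (meets? k Z)) (# (avoiding? Z)) (N C k) ⟩
          # (meets? k Z) + N C k + # (avoiding? Z)    ∎)
          where
          swap₃ : ∀ a b c → a + b + c ≡ a + c + b
          swap₃ = solve-∀

      -- The next element is found among the members that avoid all earlier ones. Its degree there
      -- is positive, whereas the earlier elements have degree zero there, so it is new.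
      bigs : ∀ z → z ≤ r′ → ∃[ v ] (Injective {A = Fin z} {B = Fin n} _≡_ _≡_ v × (∀ i → Big (v i)))
      bigs zero _ = (λ ()) , (λ { {()} }) , λ ()
      bigs (suc z) z<r′ with bigs z (<⇒≤ z<r′)
      ... | v , v-inj , v-big with Fin.any? (λ y → (θ * C₂) <? # (star? (avoiding? (fromFun v)) ∅ y))
      ...   | no none = contradiction (#-avoiding≥ (fromFun v) z<r′ (∣fromFun∣ v-inj))
                          (<⇒≱ (sparse⇒small (fromFun v) λ y → ≮⇒≥ λ lt → none (y , lt)))
      ...   | yes (y , y-big) = y Vector.∷ v , inj , big
        where
        y≢v : ∀ i → y ≢ v i
        y≢v i refl =
          let (A , (_ , A∦Z) , y∈A) = inhabitant (star? (avoiding? (fromFun v)) ∅ y) (≤-trans (s≤s z≤n) y-big)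
          in A∦Z y y∈A (∈-fromFun⁺ v i)
        inj : Injective _≡_ _≡_ (y Vector.∷ v)
        inj {zero} {zero} _ = refl
        inj {zero} {suc j} eq = contradiction eq (y≢v j)
        inj {suc i} {zero} eq = contradiction (sym eq) (y≢v i)
        inj {suc i} {suc j} eq = cong suc (v-inj eq)
        big : ∀ i → Big ((y Vector.∷ v) i)
        big zero = ≤-trans (<⇒≤ y-big)
          (#-mono (star? (avoiding? (fromFun v)) ∅ y) (star? member? ∅ y) λ ((A∈ , _) , y∈) → A∈ , y∈)
        big (suc i) = v-big i

    module _ {v : Fin r′ → Fin n} (v-inj : Injective _≡_ _≡_ v) (v-big : ∀ i → Big (v i)) where

      Z : Subset n
      Z = fromFun v

      degree< : ∀ {A} → A ∈ᴸ F → Disjoint A Z → # (disjointPart? (avoiding? Z) A) < s (fromℕ r′)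
      degree< {A} A∈ A∦Z = ≰⇒> λ many →
        let (g , g-inj , gp) = choose (disjointPart? (avoiding? Z) A) many
        in free-F (dense g g-inj gp)
        where
        dense : (g : Fin (s (fromℕ r′)) → Subset n) → Injective _≡_ _≡_ g →
                (∀ j → (g j ∈ᴸ F × Disjoint (g j) Z) × Disjoint (g j) A) →
                ContainsCompleteMultipartite F (1 Vector.∷ s)
        dense g g-inj gp = multipartite-∷ size-F (s≤s z≤n) parts A∈ (λ x∈ → x∈p∪q⁺ (inj₁ x∈)) g g-inj
          (λ j → proj₁ (proj₁ (gp j)) , (λ x∈ → x∈p∪q⁺ {p = A} (inj₂ (∈-⋃⁺ g j x∈))) , Disjoint-sym (proj₂ (gp j)))
          where
          open ≤-Reasoning
          T : Subset n
          T = A ∪ ⋃ (tabulate g)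
          v∉T : ∀ i → v i ∉ T
          v∉T i v∈T with x∈p∪q⁻ A _ v∈T
          ... | inj₁ v∈A = A∦Z (v i) v∈A (∈-fromFun⁺ v i)
          ... | inj₂ v∈⋃ = let (j , v∈g) = ∈-⋃⁻ g v∈⋃ in proj₂ (proj₁ (gp j)) (v i) v∈g (∈-fromFun⁺ v i)
          hub∦T : ∀ i → Disjoint ⁅ v i ⁆ T
          hub∦T i x x∈ x∈T = v∉T i (subst (_∈ T) (x∈⁅y⁆⇒x≡y (v i) x∈) x∈T)
          supply : Supply F (λ i → ⁅ v i ⁆) D (s ∘ inject₁)
          supply i T′ T′≤ i∦T′ =
            let (h , h-inj , hp) = choose (disjointPart? (star? member? ∅ (v i)) T′)
                                     (≤-trans (s≤σ (inject₁ i)) (big⇒many T′ (v-big i) T′≤ i∦T′))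
            in h , h-inj , λ j → proj₁ (proj₁ (hp j)) , proj₂ (hp j)
          ∣T∣≤ : ∣ T ∣ ≤ suc σ * k
          ∣T∣≤ = begin
            ∣ T ∣                               ≤⟨ ∣∪∣≤ A _ ⟩
            ∣ A ∣ + ∣ ⋃ (tabulate g) ∣          ≤⟨ +-mono-≤ (≤-reflexive (size-F A∈)) (∣⋃∣≤ g λ j → ≤-reflexive (size-F (proj₁ (proj₁ (gp j))))) ⟩
            k + s (fromℕ r′) * k                ≤⟨ +-monoʳ-≤ k (*-monoˡ-≤ k (s≤σ (fromℕ r′))) ⟩
            suc σ * k                           ∎
          parts : Parts F T (s ∘ inject₁)
          parts = greedy size-F {σ} {D} (s≤σ ∘ inject₁) (λ i → ≤-reflexive (∣⁅x⁆∣≡1 (v i)))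
            (λ {i} {i′} i≢ x x∈ x∈′ → i≢ (v-inj (trans (sym (x∈⁅y⁆⇒x≡y (v i) x∈)) (x∈⁅y⁆⇒x≡y (v i′) x∈′))))
            -- The summand `suc σ * k` of the budget pays for the K_{1,t} already contained in T,
            -- the other summand for the parts still to be chosen.
            supply T hub∦T (begin
              ∣ T ∣ + r′ * suc (σ * k)                            ≤⟨ +-mono-≤ ∣T∣≤ (*-monoˡ-≤ (suc (σ * k)) (≤-trans (n≤1+n r′) (n≤1+n _))) ⟩
              suc σ * k + suc (suc r′) * suc (σ * k)              ≡⟨ +-comm (suc σ * k) _ ⟩
              D                                                   ∎)

-- Pigeonhole: a set meeting v is sent to a point of v in it and every other set to hole zero,
-- so disjoint sets can only collide at hole zero.
disjoint-pair : ∀ {n r′} {F : List (Subset n)} {R} (v : Fin r′ → Fin n) → HasDisjointAvoiding F (suc (suc r′)) R →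
  ∃[ A ] ∃[ B ] ((A ∈ᴸ F × Disjoint A (fromFun v)) × (B ∈ᴸ F × Disjoint B (fromFun v)) × A ∉ᴸ R × B ∉ᴸ R × Disjoint A B)
disjoint-pair {n} {r′} v (g , g-inj , g∈ , g∉ , g-disj) =
  let (i , j , i<j , eq) = Fin.pigeonhole (n<1+n (suc r′)) hole
  in result i j (λ i≡j → Fin.<-irrefl i≡j i<j) eq
  where
  meet? : ∀ i → Dec (∃[ j ] v j ∈ g i)
  meet? i = Fin.any? λ j → v j ∈? g i
  hole′ : ∀ {i} → Dec (∃[ j ] v j ∈ g i) → Fin (suc r′)
  hole′ (yes (j , _)) = suc j
  hole′ (no _) = zero
  hole : Fin (suc (suc r′)) → Fin (suc r′)
  hole i = hole′ (meet? i)
  missed : ∀ i → ¬ (∃[ j ] v j ∈ g i) → Disjoint (g i) (fromFun v)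
  missed i none x x∈ x∈Z = let (j , x≡) = ∈-fromFun⁻ v x∈Z in none (j , subst (_∈ g i) x≡ x∈)
  result : ∀ i j → i ≢ j → hole i ≡ hole j → _
  result i j i≢j eq with meet? i | meet? j
  result i j i≢j refl | yes (l , v∈) | yes (.l , v∈′) = contradiction v∈′ (g-disj i j i≢j (v l) v∈)
  ... | no none | no none′ = g i , g j , (g∈ i , missed i none) , (g∈ j , missed j none′) , g∉ i , g∉ j , g-disj i j i≢j

-- Pairs of large codegree

length-cartesianProduct : ∀ {X Y : Set} (xs : List X) (ys : List Y) →
                          length (cartesianProduct xs ys) ≡ length xs * length ys
length-cartesianProduct [] ys = refl
length-cartesianProduct (x ∷ xs) ys = trans (length-++ (map (x ,_) ys))
  (cong₂ _+_ (length-map (x ,_) ys) (length-cartesianProduct xs ys))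

record Star {n : ℕ} (k₃ : ℕ) (Z : Subset n) (G : Pred (Subset n) 0ℓ) : Set where
  constructor star
  field
    x : Fin n
    E : Subset n
    x∉Z : x ∉ Z
    x∉E : x ∉ E
    E∦Z : Disjoint E Z
    ∣E∣ : ∣ E ∣ ≡ 2 + k₃
    x∈⊎E⊆ : ∀ {A} → G A → x ∈ A ⊎ E ⊆ A

module _ {I X Y : Set} (f : I → X) (g : I → Y) (_≟_ : DecidableEquality X)
         (fg-injective : ∀ {i j} → f i ≡ f j → g i ≡ g j → i ≡ j) where

  -- Read f and g as the row and the column of a grid point. A point outside the row shared by i and
  -- j would have to lie in the column of both, which are different columns. Keeping f and g
  -- abstract lets rows and columns be interchanged.
  common-coordinate : ∀ {i j L} → i ∈ᴸ L → j ∈ᴸ L → i ≢ j → f i ≡ f j →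
                      (∀ {i j} → i ∈ᴸ L → j ∈ᴸ L → f i ≡ f j ⊎ g i ≡ g j) → ∀ {l} → l ∈ᴸ L → f l ≡ f i
  common-coordinate {i} {j} i∈ j∈ i≢j fi≡fj share {l} l∈ with f l ≟ f i
  ... | yes eq = eq
  ... | no f≢ with share l∈ i∈ | share l∈ j∈
  ...   | inj₁ eq | _ = eq
  ...   | inj₂ _ | inj₁ eq = trans eq (sym fi≡fj)
  ...   | inj₂ gl≡gi | inj₂ gl≡gj = contradiction (fg-injective fi≡fj (trans (sym gl≡gi) gl≡gj)) i≢j

module Heavy {n k₃ t : ℕ} {Z : Subset n} {G : Pred (Subset n) 0ℓ} (G? : Decidable G)
  (size-G : ∀ {A} → G A → ∣ A ∣ ≡ 3 + k₃) (G∦Z : ∀ {A} → G A → Disjoint A Z)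
  (degree : ∀ {A} → G A → # (disjointPart? G? A) < t) (C₃≥1 : 1 ≤ n C k₃) where

  k θ C₂ C₃ : ℕ
  k = 3 + k₃
  θ = k + t
  C₂ = n C suc k₃
  C₃ = n C k₃

  codegree? : ∀ a b → Decidable (λ A → (G A × a ∈ A) × b ∈ A)
  codegree? a b = star? (star? G? ∅ a) ∅ b

  IsHeavy : Fin n × Fin n → Set
  IsHeavy (a , b) = θ * C₃ ≤ # (codegree? a b)

  heavy? : Decidable IsHeavy
  heavy? (a , b) = (θ * C₃) ≤? # (codegree? a b)

  ∣pair∣ : ∀ {a b : Fin n} → a ≢ b → ∣ ⁅ a ⁆ ∪ ⁅ b ⁆ ∣ ≡ 2
  ∣pair∣ {a} {b} a≢b = trans (∣∪⁅⁆∣ λ b∈ → a≢b (sym (x∈⁅y⁆⇒x≡y a b∈))) (cong suc (∣⁅x⁆∣≡1 a))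

  pair⊆ : ∀ {a b : Fin n} {A} → a ∈ A → b ∈ A → ⁅ a ⁆ ∪ ⁅ b ⁆ ⊆ A
  pair⊆ {a} {b} {A} a∈ b∈ x∈ with x∈p∪q⁻ ⁅ a ⁆ ⁅ b ⁆ x∈
  ... | inj₁ p = subst (_∈ A) (sym (x∈⁅y⁆⇒x≡y a p)) a∈
  ... | inj₂ p = subst (_∈ A) (sym (x∈⁅y⁆⇒x≡y b p)) b∈

  -- At most k C₃ of the sets through both a and b meet W. The threshold θ = k + t therefore leaves
  -- t C₃ ≥ t members.
  heavy⇒avoidable : ∀ {a b} → a ≢ b → IsHeavy (a , b) → ∀ W → ∣ W ∣ ≤ k → a ∉ W → b ∉ W →
                    t ≤ # (disjointPart? (codegree? a b) W)
  heavy⇒avoidable {a} {b} a≢b heavy W W≤ a∉ b∉ =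
    ≤-trans (≤-trans (≤-reflexive (sym (*-identityʳ t))) (*-monoʳ-≤ t C₃≥1)) (+-cancelʳ-≤ (k * C₃) _ _ (begin
      t * C₃ + k * C₃                                  ≡⟨ *-distribʳ-+ C₃ t k ⟨
      (t + k) * C₃                                     ≡⟨ cong (_* C₃) (+-comm t k) ⟩
      θ * C₃                                           ≤⟨ heavy ⟩
      # (codegree? a b)                                ≤⟨ #-avoid-contains (codegree? a b) W {j = k₃} {V = ⁅ a ⁆ ∪ ⁅ b ⁆}
                                                            (λ ((GA , _) , _) → size-G GA) (λ ((_ , a∈) , b∈) → pair⊆ a∈ b∈)
                                                            (λ x x∈ x∈W → [ (λ p → a∉ (subst (_∈ W) (x∈⁅y⁆⇒x≡y a p) x∈W))
                                                                          , (λ p → b∉ (subst (_∈ W) (x∈⁅y⁆⇒x≡y b p) x∈W)) ]′ (x∈p∪q⁻ ⁅ a ⁆ ⁅ b ⁆ x∈))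
                                                            (cong (λ c → suc c + k₃) (∣pair∣ a≢b)) ⟩
      # (disjointPart? (codegree? a b) W) + ∣ W ∣ * C₃ ≤⟨ +-monoʳ-≤ _ (*-monoˡ-≤ C₃ W≤) ⟩
      # (disjointPart? (codegree? a b) W) + k * C₃     ∎))
    where open ≤-Reasoning

  -- A member containing neither a nor b would be disjoint from t of the members through the pair,
  -- against the degree bound.
  heavy-meets : ∀ {a b} → a ≢ b → IsHeavy (a , b) → ∀ {A} → G A → a ∈ A ⊎ b ∈ A
  heavy-meets {a} {b} a≢b heavy {A} GA with a ∈? A | b ∈? A
  ... | yes a∈ | _ = inj₁ a∈
  ... | no _ | yes b∈ = inj₂ b∈
  ... | no a∉ | no b∉ = contradiction
    (≤-trans (heavy⇒avoidable a≢b heavy A (≤-reflexive (size-G GA)) a∉ b∉)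
             (#-mono (disjointPart? (codegree? a b) A) (disjointPart? G? A) λ (((GB , _) , _) , d) → GB , d))
    (<⇒≱ (degree GA))

  star-from : ∀ {x} → x ∉ Z → (L : List (Fin n)) → Unique L → 2 + k₃ ≤ length L →
              (∀ {b} → b ∈ᴸ L → b ≢ x × b ∉ Z × (∀ {A} → G A → x ∈ A ⊎ b ∈ A)) → Star k₃ Z G
  star-from {x} x∉Z L u long prop = star x E x∉Z (λ x∈E → proj₁ (prop′ x∈E) refl) (λ b b∈E → proj₁ (proj₂ (prop′ b∈E)))
    (trans (∣fromList∣ (Unique.take⁺ (2 + k₃) u)) (trans (length-take (2 + k₃) L) (m≤n⇒m⊓n≡m long))) cover
    where
    E : Subset n
    -- Exactly k - 1 elements are kept, so that a member containing E has just one further element;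
    -- surplus partners of x are dropped.
    E = fromList (take (2 + k₃) L)
    prop′ : ∀ {b} → b ∈ E → b ≢ x × b ∉ Z × (∀ {A} → G A → x ∈ A ⊎ b ∈ A)
    prop′ b∈ = prop (All.lookup (All.take⁺ (2 + k₃) (All.tabulate id)) (∈-fromList⁻ {L = take (2 + k₃) L} b∈))
    cover : ∀ {A} → G A → x ∈ A ⊎ E ⊆ A
    cover {A} GA with x ∈? A
    ... | yes x∈ = inj₁ x∈
    ... | no x∉ = inj₂ λ b∈ → [ (λ x∈ → contradiction x∈ x∉) , id ]′ (proj₂ (proj₂ (prop′ b∈)) GA)

  module _ {S₀ S₁ : Subset n} (GS₀ : G S₀) (GS₁ : G S₁) (S₀∦S₁ : Disjoint S₀ S₁)
           (large : t + t + suc k₃ * C₂ + k * k * (θ * C₃) < # G?) where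

    pairs heavies lights : List (Fin n × Fin n)
    pairs = cartesianProduct (elems S₀) (elems S₁)
    heavies = filter heavy? pairs
    lights = filter (¬? ∘ heavy?) pairs

    ∈-pairs⁻ : ∀ {a b} → (a , b) ∈ᴸ pairs → a ∈ S₀ × b ∈ S₁
    ∈-pairs⁻ p = let (a∈ , b∈) = ∈-cartesianProduct⁻ (elems S₀) (elems S₁) p in ∈-elems⁻ a∈ , ∈-elems⁻ b∈

    ∈-heavies⁻ : ∀ {a b} → (a , b) ∈ᴸ heavies → a ∈ S₀ × b ∈ S₁ × IsHeavy (a , b)
    ∈-heavies⁻ p = let (p∈ , h) = ∈-filter⁻ heavy? {xs = pairs} p
                       (a∈ , b∈) = ∈-pairs⁻ p∈ in a∈ , b∈ , h

    apart : ∀ {a b} → a ∈ S₀ → b ∈ S₁ → a ≢ b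
    apart a∈ b∈ refl = S₀∦S₁ _ a∈ b∈

    heavies-unique : Unique heavies
    heavies-unique = Unique.filter⁺ heavy? (Unique.cartesianProduct⁺ (elems-unique S₀) (elems-unique S₁))

    Covers : Fin n × Fin n → Pred (Subset n) 0ℓ
    Covers (a , b) A = (G A × a ∈ A) × b ∈ A

    covers? : ∀ ab → Decidable (Covers ab)
    covers? (a , b) = codegree? a b

    -- Fewer than t members miss S₀ and fewer than t miss S₁. The rest contain a pair: a heavy one
    -- lies in at most C₂ sets, a light one in fewer than θ C₃ members, and there are k² pairs.
    -- Against `large`, k - 2 heavy pairs are too few.
    #-G≤ : # G? ≤ t + t + length heavies * C₂ + k * k * (θ * C₃)
    #-G≤ = begin
      # G?
        ≤⟨ #-cover₂ G? (disjointPart? G? S₀) hit₀? (λ {A} GA →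
             [ (λ d → inj₁ (GA , d)) , (λ i → inj₂ (GA , i)) ]′ (disjoint⊎intersects A S₀)) ⟩
      # (disjointPart? G? S₀) + # hit₀?
        ≤⟨ +-mono-≤ (<⇒≤ (degree GS₀)) (#-cover₂ hit₀? (disjointPart? G? S₁) hit? (λ {A} (GA , i₀) →
             [ (λ d → inj₁ (GA , d)) , (λ i → inj₂ (GA , i₀ , i)) ]′ (disjoint⊎intersects A S₁))) ⟩
      t + (# (disjointPart? G? S₁) + # hit?)
        ≤⟨ +-monoʳ-≤ t (+-mono-≤ (<⇒≤ (degree GS₁)) (#-cover₂ hit? hitHeavy? hitLight? classify)) ⟩
      t + (t + (# hitHeavy? + # hitLight?))
        ≤⟨ +-monoʳ-≤ t (+-monoʳ-≤ t (+-mono-≤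
             (#-cover covers? C₂ hitHeavy? heavies (λ any → let (ab , ab∈ , c) = find any in ab , ab∈ , c) heavy-bound)
             (#-cover covers? (θ * C₃) hitLight? lights (λ any → let (ab , ab∈ , c) = find any in ab , ab∈ , c) light-bound))) ⟩
      t + (t + (length heavies * C₂ + length lights * (θ * C₃)))
        ≤⟨ +-monoʳ-≤ t (+-monoʳ-≤ t (+-monoʳ-≤ (length heavies * C₂) (*-monoˡ-≤ (θ * C₃) lights≤))) ⟩
      t + (t + (length heavies * C₂ + k * k * (θ * C₃)))
        ≡⟨ reassoc t (length heavies * C₂) (k * k * (θ * C₃)) ⟩
      t + t + length heavies * C₂ + k * k * (θ * C₃) ∎
      where
      open ≤-Reasoning
      reassoc : ∀ t a b → t + (t + (a + b)) ≡ t + t + a + b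
      reassoc = solve-∀
      hit₀? : Decidable (λ A → G A × Intersects A S₀)
      hit₀? A = G? A ×-dec intersects? A S₀
      hit? : Decidable (λ A → G A × Intersects A S₀ × Intersects A S₁)
      hit? A = G? A ×-dec (intersects? A S₀ ×-dec intersects? A S₁)
      hitHeavy? : Decidable (λ A → Any (λ ab → Covers ab A) heavies)
      hitHeavy? A = Any.any? (λ ab → covers? ab A) heavies
      hitLight? : Decidable (λ A → Any (λ ab → Covers ab A) lights)
      hitLight? A = Any.any? (λ ab → covers? ab A) lights
      classify : ∀ {A} → G A × Intersects A S₀ × Intersects A S₁ →
                 Any (λ ab → Covers ab A) heavies ⊎ Any (λ ab → Covers ab A) lights
      classify (GA , (a , a∈ , a∈S₀) , (b , b∈ , b∈S₁)) with heavy? (a , b)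
      ... | yes h = inj₁ (lose (∈-filter⁺ heavy? (∈-cartesianProduct⁺ (∈-elems⁺ a∈S₀) (∈-elems⁺ b∈S₁)) h) ((GA , a∈) , b∈))
      ... | no ¬h = inj₂ (lose (∈-filter⁺ (¬? ∘ heavy?) (∈-cartesianProduct⁺ (∈-elems⁺ a∈S₀) (∈-elems⁺ b∈S₁)) ¬h) ((GA , a∈) , b∈))
      heavy-bound : ∀ {ab} → ab ∈ᴸ heavies → # (covers? ab) ≤ C₂
      heavy-bound {a , b} p = let (a∈ , b∈ , _) = ∈-heavies⁻ p in ≤-trans
        (#-mono (codegree? a b) (between? k (⁅ a ⁆ ∪ ⁅ b ⁆) ∅)
          λ ((GA , a∈A) , b∈A) → between (size-G GA) (pair⊆ a∈A b∈A) Disjoint-∅)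
        (#-contains≤ {j = suc k₃} (cong (_+ suc k₃) (∣pair∣ (apart a∈ b∈))))
      light-bound : ∀ {ab} → ab ∈ᴸ lights → # (covers? ab) ≤ θ * C₃
      light-bound {a , b} p = <⇒≤ (≰⇒> (proj₂ (∈-filter⁻ (¬? ∘ heavy?) {xs = pairs} p)))
      lights≤ : length lights ≤ k * k
      lights≤ = begin
        length lights                              ≤⟨ unique-⊆⇒length-≤
                                                       (Unique.filter⁺ (¬? ∘ heavy?) (Unique.cartesianProduct⁺ (elems-unique S₀) (elems-unique S₁)))
                                                       (λ p → proj₁ (∈-filter⁻ (¬? ∘ heavy?) {xs = pairs} p)) ⟩
        length pairs                               ≡⟨ length-cartesianProduct (elems S₀) (elems S₁) ⟩
        length (elems S₀) * length (elems S₁)      ≡⟨ cong₂ _*_ (trans (length-elems S₀) (size-G GS₀)) (trans (length-elems S₁) (size-G GS₁)) ⟩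
        k * k                                      ∎

    many-heavies : 2 + k₃ ≤ length heavies
    many-heavies = ≰⇒> λ few → contradiction (≤-trans large (≤-trans #-G≤
      (+-monoˡ-≤ (k * k * (θ * C₃)) (+-monoʳ-≤ (t + t) (*-monoˡ-≤ C₂ few))))) (n≮n _)

    -- If both coordinates differ, the four elements are distinct, and heaviness of (a, b) yields a
    -- member through a and b avoiding c and d. But the heavy pair (c, d) meets every member.
    shares : ∀ {ab cd} → ab ∈ᴸ heavies → cd ∈ᴸ heavies → proj₁ ab ≡ proj₁ cd ⊎ proj₂ ab ≡ proj₂ cd
    shares {a , b} {c , d} p p′ with a Fin.≟ c | b Fin.≟ d
    ... | yes eq | _ = inj₁ eq
    ... | no _ | yes eq = inj₂ eq
    ... | no a≢c | no b≢d = ⊥-elim ([ (λ c∈ → cd∦A c (x∈p∪q⁺ (inj₁ (x∈⁅x⁆ c))) c∈)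
                                    , (λ d∈ → cd∦A d (x∈p∪q⁺ {p = ⁅ c ⁆} (inj₂ (x∈⁅x⁆ d))) d∈) ]′
                                    (heavy-meets (apart c∈ d∈) heavy-cd GA))
      where
      a∈ = proj₁ (∈-heavies⁻ p)
      b∈ = proj₁ (proj₂ (∈-heavies⁻ p))
      c∈ = proj₁ (∈-heavies⁻ p′)
      d∈ = proj₁ (proj₂ (∈-heavies⁻ p′))
      heavy-cd = proj₂ (proj₂ (∈-heavies⁻ p′))
      avoiding-cd = inhabitant (disjointPart? (codegree? a b) (⁅ c ⁆ ∪ ⁅ d ⁆)) (≤-trans (≤-trans (s≤s z≤n) (degree GS₀))
        (heavy⇒avoidable (apart a∈ b∈) (proj₂ (proj₂ (∈-heavies⁻ p))) (⁅ c ⁆ ∪ ⁅ d ⁆)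
          (≤-trans (≤-reflexive (∣pair∣ (apart c∈ d∈))) (s≤s (s≤s z≤n)))
          (λ a∈cd → [ (λ q → a≢c (x∈⁅y⁆⇒x≡y c q)) , (λ q → apart a∈ d∈ (x∈⁅y⁆⇒x≡y d q)) ]′ (x∈p∪q⁻ ⁅ c ⁆ ⁅ d ⁆ a∈cd))
          (λ b∈cd → [ (λ q → apart c∈ b∈ (sym (x∈⁅y⁆⇒x≡y c q))) , (λ q → b≢d (x∈⁅y⁆⇒x≡y d q)) ]′ (x∈p∪q⁻ ⁅ c ⁆ ⁅ d ⁆ b∈cd))))
      GA = proj₁ (proj₁ (proj₁ (proj₂ avoiding-cd)))
      cd∦A = Disjoint-sym (proj₂ (proj₂ avoiding-cd))

    centred₀ : ∀ {a} → a ∈ S₀ → (∀ {ab} → ab ∈ᴸ heavies → proj₁ ab ≡ a) → Star k₃ Z G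
    centred₀ {a} a∈ all-a = star-from (G∦Z GS₀ a a∈) L (Unique.filter⁺ (λ b → heavy? (a , b)) (elems-unique S₁))
      (≤-trans many-heavies (≤-trans (unique-⊆⇒length-≤ heavies-unique heavies⊆) (≤-reflexive (length-map (a ,_) L))))
      λ p → let (b∈L , h) = ∈-filter⁻ (λ b → heavy? (a , b)) {xs = elems S₁} p
                b∈ = ∈-elems⁻ b∈L
            in (λ eq → apart a∈ b∈ (sym eq)) , G∦Z GS₁ _ b∈ , heavy-meets (apart a∈ b∈) h
      where
      L = filter (λ b → heavy? (a , b)) (elems S₁)
      heavies⊆ : ∀ {ab} → ab ∈ᴸ heavies → ab ∈ᴸ map (a ,_) L
      heavies⊆ {c , b} p with all-a p | ∈-heavies⁻ p
      ... | refl | _ , b∈ , h = ∈-map⁺ (a ,_) (∈-filter⁺ (λ b → heavy? (a , b)) (∈-elems⁺ b∈) h)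

    centred₁ : ∀ {b} → b ∈ S₁ → (∀ {ab} → ab ∈ᴸ heavies → proj₂ ab ≡ b) → Star k₃ Z G
    centred₁ {b} b∈ all-b = star-from (G∦Z GS₁ b b∈) L (Unique.filter⁺ (λ a → heavy? (a , b)) (elems-unique S₀))
      (≤-trans many-heavies (≤-trans (unique-⊆⇒length-≤ heavies-unique heavies⊆) (≤-reflexive (length-map (_, b) L))))
      λ p → let (a∈L , h) = ∈-filter⁻ (λ a → heavy? (a , b)) {xs = elems S₀} p
                a∈ = ∈-elems⁻ a∈L
            in apart a∈ b∈ , G∦Z GS₀ _ a∈ , λ GA → [ inj₂ , inj₁ ]′ (heavy-meets (apart a∈ b∈) h GA)
      where
      L = filter (λ a → heavy? (a , b)) (elems S₀)
      heavies⊆ : ∀ {ab} → ab ∈ᴸ heavies → ab ∈ᴸ map (_, b) L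
      heavies⊆ {a , c} p with all-b p | ∈-heavies⁻ p
      ... | refl | a∈ , _ , h = ∈-map⁺ (_, b) (∈-filter⁺ (λ a → heavy? (a , b)) (∈-elems⁺ a∈) h)

    heavy-star : Star k₃ Z G
    heavy-star =
      -- Two distinct heavy pairs exist because k - 1 ≥ 2, and the coordinate they share is the one
      -- common to all heavy pairs.
      let (g , g-inj , g∈) = initial {q = 2} heavies-unique (≤-trans (s≤s (s≤s z≤n)) many-heavies)
          distinct = λ eq → contradiction (g-inj {zero} {suc zero} eq) λ ()
      in [ (λ eq → centred₀ (proj₁ (∈-heavies⁻ (g∈ zero)))
                     (common-coordinate proj₁ proj₂ Fin._≟_ (cong₂ _,_) (g∈ zero) (g∈ (suc zero)) distinct eq shares))
         , (λ eq → centred₁ (proj₁ (proj₂ (∈-heavies⁻ (g∈ zero))))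
                     (common-coordinate proj₂ proj₁ Fin._≟_ (λ p q → cong₂ _,_ q p) (g∈ zero) (g∈ (suc zero)) distinct eq
                       λ p q → Sum.swap (shares p q))) ]′
         (shares (g∈ zero) (g∈ (suc zero)))

-- Sets through the centre

-- Turns equality of counts into equality of families; this is how a tight bound becomes structure.
#-full : ∀ {n} {P Q : Pred (Subset n) 0ℓ} (P? : Decidable P) (Q? : Decidable Q) →
         (∀ {A} → P A → Q A) → # Q? ≤ # P? → ∀ {A} → Q A → P A
#-full P? Q? P⊆Q Q≤P q = ∈-enum⁻ P? (unique-⊆⇒⊇ _≟ˢ_ (enum-unique P?) (λ p → ∈-enum⁺ Q? (P⊆Q (∈-enum⁻ P? p)))
  (subst₂ _≤_ (#-def Q?) (#-def P?) Q≤P) (∈-enum⁺ Q? q))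

Hits : ∀ {n γ} → Subset n → (Fin γ → Fin n) → Subset n → Set
Hits E y A = ∀ j → Intersects A (E ∪ ⁅ y j ⁆)

hits? : ∀ {n γ} E (y : Fin γ → Fin n) → Decidable (Hits E y)
hits? E y A = Fin.all? λ j → intersects? A (E ∪ ⁅ y j ⁆)

-- A set that misses E can meet E ∪ {y j} only in y j, so it has to contain every y j.
Hits⁻ : ∀ {n γ} {E} {y : Fin γ → Fin n} {A} → Hits E y A → Intersects A E ⊎ fromFun y ⊆ A
Hits⁻ {E = E} {y} {A} h with intersects? A E
... | yes i = inj₁ i
... | no ¬i = inj₂ λ z∈ → let (j , z≡) = ∈-fromFun⁻ y z∈ in subst (_∈ A) (sym z≡) (y∈A j)
  where
  y∈A : ∀ j → y j ∈ A
  y∈A j with h j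
  ... | z , z∈A , z∈ with x∈p∪q⁻ E ⁅ y j ⁆ z∈
  ...   | inj₁ z∈E = contradiction (z , z∈A , z∈E) ¬i
  ...   | inj₂ z∈y = subst (_∈ A) (x∈⁅y⁆⇒x≡y (y j) z∈y) z∈A

Hits⁺ : ∀ {n γ} {E} {y : Fin γ → Fin n} {A} → Intersects A E ⊎ fromFun y ⊆ A → Hits E y A
Hits⁺ (inj₁ (z , z∈A , z∈E)) j = z , z∈A , x∈p∪q⁺ (inj₁ z∈E)
Hits⁺ {E = E} {y} (inj₂ Y⊆A) j = y j , Y⊆A (∈-fromFun⁺ y j) , x∈p∪q⁺ {p = E} (inj₂ (x∈⁅x⁆ (y j)))

hitting? : ∀ {n γ} k (x : Fin n) Z E (y : Fin γ → Fin n) → Decidable (λ A → Between k ⁅ x ⁆ Z A × Hits E y A)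
hitting? k x Z E y A = between? k ⁅ x ⁆ Z A ×-dec hits? E y A

module _ {n k : ℕ} {x : Fin n} {Z E : Subset n} (x∉Z : x ∉ Z) (x∉E : x ∉ E) (E∦Z : Disjoint E Z)
         {j₂ f₁ f₂ : ℕ} (k≡ : suc j₂ ≡ k) (n≡₁ : suc (∣ Z ∣ + f₁) ≡ n) (n≡₂ : suc (∣ Z ∣ + ∣ E ∣) + f₂ ≡ n) where

  private
    ∣Z∪E∣ : ∣ Z ∪ E ∣ ≡ ∣ Z ∣ + ∣ E ∣
    ∣Z∪E∣ = ∣∪∣-disjoint Z E (Disjoint-sym E∦Z)

    x∉Z∪E : x ∉ Z ∪ E
    x∉Z∪E x∈ = [ x∉Z , x∉E ]′ (x∈p∪q⁻ Z E x∈)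

    ⁅x⁆∦ : ∀ {W} → x ∉ W → Disjoint ⁅ x ⁆ W
    ⁅x⁆∦ {W} x∉ z z∈ z∈W = x∉ (subst (_∈ W) (x∈⁅y⁆⇒x≡y x z∈) z∈W)

  #-link : # (between? k ⁅ x ⁆ Z) ≡ f₁ C j₂
  #-link = #-between {j = j₂} (⁅x⁆∦ x∉Z) (trans (cong (_+ j₂) (∣⁅x⁆∣≡1 x)) k≡)
    (trans (cong (λ c → c + ∣ Z ∣ + f₁) (∣⁅x⁆∣≡1 x)) n≡₁)

  #-link-avoiding : # (between? k ⁅ x ⁆ (Z ∪ E)) ≡ f₂ C j₂
  #-link-avoiding = #-between {j = j₂} (⁅x⁆∦ x∉Z∪E) (trans (cong (_+ j₂) (∣⁅x⁆∣≡1 x)) k≡)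
    (trans (cong₂ (λ c d → c + d + f₂) (∣⁅x⁆∣≡1 x) ∣Z∪E∣) n≡₂)

  linkMeeting? : Decidable (λ A → Between k ⁅ x ⁆ Z A × Intersects A E)
  linkMeeting? A = between? k ⁅ x ⁆ Z A ×-dec intersects? A E

  #-link-meeting : # linkMeeting? + f₂ C j₂ ≡ f₁ C j₂
  #-link-meeting = trans (cong (# linkMeeting? +_) (sym #-link-avoiding)) (trans
    (sym (#-split (between? k ⁅ x ⁆ Z) linkMeeting? (between? k ⁅ x ⁆ (Z ∪ E))
      (λ {A} b → [ (λ d → inj₂ (between (size b) (contains b) (Disjoint-∪ (avoids b) d))) , (λ i → inj₁ (b , i)) ]′ (disjoint⊎intersects A E))
      proj₁
      (λ b → between (size b) (contains b) λ z z∈ z∈Z → avoids b z z∈ (x∈p∪q⁺ (inj₁ z∈Z)))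
      (λ (_ , z , z∈ , z∈E) b → avoids b z z∈ (x∈p∪q⁺ {p = Z} (inj₂ z∈E)))))
    #-link)

  -- Inclusion–exclusion: a set through x misses some E ∪ {y j} iff it misses E and omits some y j.
  #-hitting : ∀ {γ j₃ f₃} {y : Fin γ → Fin n} → Injective _≡_ _≡_ y → (∀ j → y j ∉ Z) → (∀ j → y j ∉ E) →
              (∀ j → y j ≢ x) → suc γ + j₃ ≡ k → suc γ + (∣ Z ∣ + ∣ E ∣) + f₃ ≡ n →
              # (hitting? k x Z E y) + f₂ C j₂ ≡ f₁ C j₂ + f₃ C j₃
  #-hitting {γ} {j₃} {f₃} {y} y-inj y∉Z y∉E y≢x k≡₃ n≡₃ = begin
    # (hitting? k x Z E y) + f₂ C j₂
      ≡⟨ cong (# (hitting? k x Z E y) +_) (trans (sym #-link-avoiding) splitV) ⟩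
    # (hitting? k x Z E y) + (# omitting? + # (between? k (⁅ x ⁆ ∪ Y) (Z ∪ E)))
      ≡⟨ +-assoc (# (hitting? k x Z E y)) _ _ ⟨
    # (hitting? k x Z E y) + # omitting? + # (between? k (⁅ x ⁆ ∪ Y) (Z ∪ E))
      ≡⟨ cong₂ _+_ (trans (sym splitU) #-link) #-all ⟩
    f₁ C j₂ + f₃ C j₃ ∎
    where
    open ≡-Reasoning
    Y = fromFun y
    omitting? : Decidable (λ A → Between k ⁅ x ⁆ (Z ∪ E) A × ¬ (Y ⊆ A))
    omitting? A = between? k ⁅ x ⁆ (Z ∪ E) A ×-dec ¬? (Y ⊆? A)
    ⊇Z : ∀ {A V} → Between k V (Z ∪ E) A → Disjoint A Z
    ⊇Z b z z∈ z∈Z = avoids b z z∈ (x∈p∪q⁺ (inj₁ z∈Z))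
    ∦E : ∀ {A V} → Between k V (Z ∪ E) A → Disjoint A E
    ∦E b z z∈ z∈E = avoids b z z∈ (x∈p∪q⁺ {p = Z} (inj₂ z∈E))
    splitU : # (between? k ⁅ x ⁆ Z) ≡ # (hitting? k x Z E y) + # omitting?
    splitU = #-split (between? k ⁅ x ⁆ Z) (hitting? k x Z E y) omitting? classify proj₁
      (λ (b , _) → between (size b) (contains b) (⊇Z b))
      exclusive
      where
      exclusive : ∀ {A} → Between k ⁅ x ⁆ Z A × Hits E y A → Between k ⁅ x ⁆ (Z ∪ E) A × ¬ (Y ⊆ A) → ⊥
      exclusive (_ , h) (b , ¬Y⊆) with Hits⁻ {E = E} {y} h
      ... | inj₁ i = Intersects⇒¬Disjoint i (∦E b)
      ... | inj₂ Y⊆ = ¬Y⊆ Y⊆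
      classify : ∀ {A} → Between k ⁅ x ⁆ Z A → (Between k ⁅ x ⁆ Z A × Hits E y A) ⊎ (Between k ⁅ x ⁆ (Z ∪ E) A × ¬ (Y ⊆ A))
      classify {A} b with disjoint⊎intersects A E | Y ⊆? A
      ... | inj₂ i | _ = inj₁ (b , Hits⁺ {E = E} {y} (inj₁ i))
      ... | inj₁ d | yes Y⊆ = inj₁ (b , Hits⁺ {E = E} {y} (inj₂ Y⊆))
      ... | inj₁ d | no ¬Y⊆ = inj₂ (between (size b) (contains b) (Disjoint-∪ (avoids b) d) , ¬Y⊆)
    splitV : # (between? k ⁅ x ⁆ (Z ∪ E)) ≡ # omitting? + # (between? k (⁅ x ⁆ ∪ Y) (Z ∪ E))
    splitV = #-split (between? k ⁅ x ⁆ (Z ∪ E)) omitting? (between? k (⁅ x ⁆ ∪ Y) (Z ∪ E)) classify proj₁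
      (λ b → between (size b) (λ z∈ → contains b (x∈p∪q⁺ (inj₁ z∈))) (avoids b))
      (λ (_ , ¬Y⊆) b → ¬Y⊆ λ z∈ → contains b (x∈p∪q⁺ {p = ⁅ x ⁆} (inj₂ z∈)))
      where
      classify : ∀ {A} → Between k ⁅ x ⁆ (Z ∪ E) A →
                 (Between k ⁅ x ⁆ (Z ∪ E) A × ¬ (Y ⊆ A)) ⊎ Between k (⁅ x ⁆ ∪ Y) (Z ∪ E) A
      classify {A} b with Y ⊆? A
      ... | yes Y⊆ = inj₂ (between (size b) (λ z∈ → [ contains b , Y⊆ ]′ (x∈p∪q⁻ ⁅ x ⁆ Y z∈)) (avoids b))
      ... | no ¬Y⊆ = inj₁ (b , ¬Y⊆)
    ∣x∪Y∣ : ∣ ⁅ x ⁆ ∪ Y ∣ ≡ suc γ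
    ∣x∪Y∣ = trans (∣∪∣-disjoint ⁅ x ⁆ Y (⁅x⁆∦ λ x∈ → let (j , x≡) = ∈-fromFun⁻ y x∈ in y≢x j (sym x≡)))
      (cong₂ _+_ (∣⁅x⁆∣≡1 x) (∣fromFun∣ y-inj))
    #-all : # (between? k (⁅ x ⁆ ∪ Y) (Z ∪ E)) ≡ f₃ C j₃
    #-all = #-between {j = j₃}
      (λ z z∈ z∈ZE → [ (λ z∈x → ⁅x⁆∦ x∉Z∪E z z∈x z∈ZE)
                     , (λ z∈Y → let (j , z≡) = ∈-fromFun⁻ y z∈Y in
                         [ (λ q → y∉Z j (subst (_∈ Z) z≡ q)) , (λ q → y∉E j (subst (_∈ E) z≡ q)) ]′ (x∈p∪q⁻ Z E z∈ZE)) ]′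
                     (x∈p∪q⁻ ⁅ x ⁆ Y z∈))
      (trans (cong (_+ j₃) ∣x∪Y∣) k≡₃)
      (trans (cong₂ (λ c d → c + d + f₃) ∣x∪Y∣ ∣Z∪E∣) n≡₃)

-- The members of a family J¹ᵗ_{γ,r} that avoid Z = [r − 1], around the centre x in place of r.
record Structure {n : ℕ} (k γ t : ℕ) (Z : Subset n) (G : Pred (Subset n) 0ℓ) : Set where
  field
    x : Fin n
    E : Subset n
    x∉Z : x ∉ Z
    x∉E : x ∉ E
    E∦Z : Disjoint E Z
    ∣E∣ : suc ∣ E ∣ ≡ k
    y : Fin γ → Fin n
    y-injective : Injective _≡_ _≡_ y
    y∉Z : ∀ j → y j ∉ Z
    y∉E : ∀ j → y j ∉ E
    y≢x : ∀ j → y j ≢ x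
    B : Fin γ → List (Subset n)
    B-unique : ∀ j → Unique (B j)
    B-length : ∀ j → length (B j) ≡ t ∸ 1
    B-between : ∀ {j b} → b ∈ᴸ B j → Between k ⁅ x ⁆ (Z ∪ E) b
    B∌ : ∀ {j b} → b ∈ᴸ B j → y j ∉ b
    B∋ : ∀ {j b} → b ∈ᴸ B j → ∀ i → i ≢ j → y i ∈ b
    member⁻ : ∀ {A} → G A → (Between k ⁅ x ⁆ Z A × Hits E y A) ⊎ (∃[ j ] A ≡ E ∪ ⁅ y j ⁆) ⊎ (∃[ j ] A ∈ᴸ B j)
    member⁺ : ∀ {A} → (Between k ⁅ x ⁆ Z A × Hits E y A) ⊎ (∃[ j ] A ≡ E ∪ ⁅ y j ⁆) ⊎ (∃[ j ] A ∈ᴸ B j) → G A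

-- The number of sets E ∪ {y} and the structure of G

module Core {n k₃ p′ β q t₁ : ℕ} (k₃≡ : β + p′ ≡ k₃) (2≤k₃ : 2 ≤ k₃)
  {Z : Subset n} {G : Pred (Subset n) 0ℓ} (G? : Decidable G)
  (size-G : ∀ {A} → G A → ∣ A ∣ ≡ 3 + k₃) (G∦Z : ∀ {A} → G A → Disjoint A Z)
  (degree : ∀ {A} → G A → # (disjointPart? G? A) < suc t₁)
  (n≡ : suc (∣ Z ∣ + (3 + k₃ + suc β + q)) ≡ n)
  (ℓ-G : ∀ R → length R < suc β → ∃[ A ] ∃[ B ] (G A × G B × A ∉ᴸ R × B ∉ᴸ R × Disjoint A B))
  (large : (3 + k₃ + suc β + q) C (2 + k₃) + suc q C suc p′ + suc β * suc t₁
             ≤ # G? + suc (suc β + q) C (2 + k₃))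
  (large-q : 2 * p′ + suc t₁ * (3 + k₃) + t₁ < q)
  (S : Star k₃ Z G) where

  open Star S

  -- Among the k-sets through x that avoid Z, there are U in total, V that also miss E, and X that
  -- miss E but contain γ given elements y j. Hence U - V + X of them meet all γ sets E ∪ {y j}. K =
  -- t k bounds the size of a union of t members.
  k γ U V X K : ℕ
  k = 3 + k₃
  γ = suc β
  U = (3 + k₃ + suc β + q) C (2 + k₃)
  V = suc (suc β + q) C (2 + k₃)
  X = suc q C suc p′
  K = suc t₁ * k

  plus : Fin n → Subset n
  plus y = E ∪ ⁅ y ⁆

  centre-or-plus : ∀ {A} → G A → x ∈ A ⊎ (∃[ y ] (y ∉ E × y ≢ x × A ≡ plus y))
  centre-or-plus {A} GA with x ∈? A
  ... | yes x∈ = inj₁ x∈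
  ... | no x∉ with x∈⊎E⊆ GA
  ...   | inj₁ x∈ = inj₁ x∈
  ...   | inj₂ E⊆A with ⊆⇒≡∪⁅⁆ E⊆A (trans (size-G GA) (cong suc (sym ∣E∣)))
  ...     | y , y∉E , A≡ = inj₂ (y , y∉E , (λ where refl → x∉ (subst (x ∈_) (sym A≡) (x∈p∪q⁺ {p = E} (inj₂ (x∈⁅x⁆ x))))) , A≡)

  Extends : Fin n → Set
  Extends y = y ∉ E × y ≢ x × G (plus y)

  extends? : Decidable Extends
  extends? y = ¬? (y ∈? E) ×-dec (¬? (y Fin.≟ x) ×-dec G? (plus y))

  Ys : List (Fin n)
  Ys = filter extends? (allFin n)

  m : ℕ
  m = length Ys

  Ys-unique : Unique Ys
  Ys-unique = Unique.filter⁺ extends? (Unique.allFin⁺ n)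

  ∈-Ys⁺ : ∀ {y} → Extends y → y ∈ᴸ Ys
  ∈-Ys⁺ {y} = ∈-filter⁺ extends? (∈-allFin y)

  ∈-Ys⁻ : ∀ {y} → y ∈ᴸ Ys → Extends y
  ∈-Ys⁻ y∈ = proj₂ (∈-filter⁻ extends? {xs = allFin n} y∈)

  G⁻ : ∀ {A} → G A → x ∈ A ⊎ A ∈ᴸ map plus Ys
  G⁻ GA with centre-or-plus GA
  ... | inj₁ x∈ = inj₁ x∈
  ... | inj₂ (y , y∉E , y≢x , refl) = inj₂ (∈-map⁺ plus (∈-Ys⁺ (y∉E , y≢x , GA)))

  plus? : Decidable (_∈ᴸ map plus Ys)
  plus? A = A ∈ˢ? map plus Ys

  #-plus≤ : # plus? ≤ m
  #-plus≤ = ≤-trans (#≤length plus? id) (≤-reflexive (length-map plus Ys))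

  -- After deletion of the m sets `plus y` all members contain x, so no two are disjoint; fewer than
  -- γ deletions cannot achieve this.
  γ≤m : γ ≤ m
  γ≤m = ≮⇒≥ λ m<γ →
    let (A , B , GA , GB , A∉ , B∉ , d) = ℓ-G (map plus Ys) (≤-<-trans (≤-reflexive (length-map plus Ys)) m<γ)
    in [ (λ x∈A → [ d x x∈A , B∉ ]′ (G⁻ GB)) , A∉ ]′ (G⁻ GA)

  -- G contains two disjoint members, so some degree is at least 1 while every degree is below t.
  -- This matters in `linear`.
  1≤t₁ : 1 ≤ t₁
  1≤t₁ = let (A , B , GA , GB , _ , _ , d) = ℓ-G [] (s≤s z≤n)
         in ≤-pred (≤-trans (s≤s (#≥1 (disjointPart? G? A) (GB , Disjoint-sym d))) (degree GA))

  y∉Z : ∀ {y} → G (plus y) → y ∉ Z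
  y∉Z {y} Gy = G∦Z Gy y (x∈p∪q⁺ {p = E} (inj₂ (x∈⁅x⁆ y)))

  n≡₂ : suc (∣ Z ∣ + ∣ E ∣) + suc (suc β + q) ≡ n
  n≡₂ = trans (cong (λ e → suc (∣ Z ∣ + e) + suc (suc β + q)) ∣E∣) (trans (rearrange ∣ Z ∣ k₃ β q) n≡)
    where
    rearrange : ∀ z k b q → suc (z + (2 + k)) + suc (suc b + q) ≡ suc (z + (3 + k + suc b + q))
    rearrange = solve-∀

  missing? : ∀ {c} (y : Fin c → Fin n) → Decidable (λ A → G A × (∃[ j ] Disjoint A (plus (y j))))
  missing? y A = G? A ×-dec Fin.any? λ j → disjoint? A (plus (y j))

  hitG? : ∀ {c} (y : Fin c → Fin n) → Decidable (λ A → (Between k ⁅ x ⁆ Z A × Hits E y A) × G A)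
  hitG? y A = hitting? k x Z E y A ×-dec G? A

  link : ∀ {A} → G A → x ∈ A → Between k ⁅ x ⁆ Z A
  link {A} GA x∈ = between (size-G GA) (λ z∈ → subst (_∈ A) (sym (x∈⁅y⁆⇒x≡y x z∈)) x∈) (G∦Z GA)

  -- Members through x are tested against only c of the sets E ∪ {y}, with c = γ or γ + 1. The other
  -- such sets enter through their number m alone.
  #-G≤ : ∀ {c} (y : Fin c → Fin n) → # G? ≤ m + (# (hitG? y) + # (missing? y))
  #-G≤ y = ≤-trans (#-cover₂ G? plus? rest? classify)
    (+-mono-≤ #-plus≤ (#-cover₂ rest? (hitG? y) (missing? y) classify′))
    where
    rest? : Decidable (λ A → G A × x ∈ A)
    rest? A = G? A ×-dec (x ∈? A)
    classify : ∀ {A} → G A → A ∈ᴸ map plus Ys ⊎ (G A × x ∈ A)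
    classify GA = [ (λ x∈ → inj₂ (GA , x∈)) , inj₁ ]′ (G⁻ GA)
    classify′ : ∀ {A} → G A × x ∈ A →
      ((Between k ⁅ x ⁆ Z A × Hits E y A) × G A) ⊎ (G A × (∃[ j ] Disjoint A (plus (y j))))
    classify′ {A} (GA , x∈) with Fin.any? (λ j → disjoint? A (plus (y j)))
    ... | yes missed = inj₂ (GA , missed)
    ... | no none = inj₁ ((link GA x∈ , λ j → ¬Disjoint⇒Intersects λ d → none (j , d)) , GA)

  Miss? : ∀ y → Decidable (λ A → G A × Disjoint A (plus y))
  Miss? y = disjointPart? G? (plus y)

  #-missing≤ : ∀ {c} (y : Fin c → Fin n) → (∀ j → G (plus (y j))) → # (missing? y) ≤ c * t₁
  #-missing≤ {c} y Gy = ≤-trans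
    (#-cover (λ j → Miss? (y j)) t₁ (missing? y) (allFin c) (λ (GA , j , d) → j , ∈-allFin j , GA , d)
      (λ {j} _ → ≤-pred (degree (Gy j))))
    (≤-reflexive (cong (_* t₁) (length-tabulate {n = c} id)))

  module _ {c : ℕ} (c≤m : c ≤ m) where

    private
      first = initial {q = c} Ys-unique c≤m

    ys : Fin c → Fin n
    ys = proj₁ first

    ys-injective : Injective _≡_ _≡_ ys
    ys-injective = proj₁ (proj₂ first)

    ys∈ : ∀ j → ys j ∈ᴸ Ys
    ys∈ = proj₂ (proj₂ first)

    ys-extends : ∀ j → Extends (ys j)
    ys-extends j = ∈-Ys⁻ (ys∈ j)

    G-ys : ∀ j → G (plus (ys j))
    G-ys j = proj₂ (proj₂ (ys-extends j))

    #-hitting-ys : ∀ {j₃ f₃} → suc c + j₃ ≡ k → suc c + (∣ Z ∣ + ∣ E ∣) + f₃ ≡ n →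
                   # (hitting? k x Z E ys) + V ≡ U + f₃ C j₃
    #-hitting-ys = #-hitting x∉Z x∉E E∦Z {j₂ = 2 + k₃} refl n≡ n≡₂ ys-injective
      (λ j → y∉Z (G-ys j)) (λ j → proj₁ (ys-extends j)) (λ j → proj₁ (proj₂ (ys-extends j)))

    #-hitG≤ : # (hitG? ys) ≤ # (hitting? k x Z E ys)
    #-hitG≤ = #-mono (hitG? ys) (hitting? k x Z E ys) proj₁

  module Exact (m≡γ : m ≡ γ) where

    γ≤ : γ ≤ m
    γ≤ = γ≤m

    y : Fin γ → Fin n
    y = ys γ≤

    W : ℕ
    W = # (hitting? k x Z E y)

    W+V : W + V ≡ U + X
    W+V = #-hitting-ys γ≤ {suc p′} {suc q} (trans (rearrange₁ β p′) (cong (3 +_) k₃≡))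
      (trans (cong (λ e → suc γ + (∣ Z ∣ + e) + suc q) ∣E∣) (trans (rearrange₂ ∣ Z ∣ k₃ β q) n≡))
      where
      rearrange₁ : ∀ b p → suc (suc b) + suc p ≡ 3 + (b + p)
      rearrange₁ = solve-∀
      rearrange₂ : ∀ z k b q → suc (suc b) + (z + (2 + k)) + suc q ≡ suc (z + (3 + k + suc b + q))
      rearrange₂ = solve-∀

    #-G≤-parts : # G? ≤ γ + (# (hitG? y) + # (missing? y))
    #-G≤-parts = subst (λ c → # G? ≤ c + (# (hitG? y) + # (missing? y))) m≡γ (#-G≤ y)

    missing≤ : # (missing? y) ≤ γ * t₁
    missing≤ = #-missing≤ y (G-ys γ≤)

    upper : # G? + V ≤ U + X + γ * suc t₁
    upper = begin
      # G? + V                                         ≤⟨ +-monoˡ-≤ V (≤-trans #-G≤-parts (+-monoʳ-≤ γ (+-mono-≤ (#-hitG≤ γ≤) missing≤))) ⟩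
      γ + (W + γ * t₁) + V                             ≡⟨ rearrange γ W (γ * t₁) V ⟩
      W + V + (γ + γ * t₁)                             ≡⟨ cong₂ _+_ W+V (sym (*-suc γ t₁)) ⟩
      U + X + γ * suc t₁                               ∎
      where
      open ≤-Reasoning
      rearrange : ∀ a b c d → a + (b + c) + d ≡ b + d + (a + c)
      rearrange = solve-∀

    parts-full : W + V + (γ + γ * t₁) ≤ γ + (# (hitG? y) + # (missing? y)) + V
    parts-full = begin
      W + V + (γ + γ * t₁)                             ≡⟨ cong₂ _+_ W+V (sym (*-suc γ t₁)) ⟩
      U + X + γ * suc t₁                               ≤⟨ large ⟩
      # G? + V                                         ≤⟨ +-monoˡ-≤ V #-G≤-parts ⟩
      γ + (# (hitG? y) + # (missing? y)) + V           ∎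
      where open ≤-Reasoning

    missing-full : γ * t₁ ≤ # (missing? y)
    missing-full = +-cancelˡ-≤ (W + V + γ) _ _ (begin
      W + V + γ + γ * t₁                               ≡⟨ +-assoc (W + V) γ _ ⟩
      W + V + (γ + γ * t₁)                             ≤⟨ parts-full ⟩
      γ + (# (hitG? y) + # (missing? y)) + V           ≤⟨ +-monoˡ-≤ V (+-monoʳ-≤ γ (+-monoˡ-≤ (# (missing? y)) (#-hitG≤ γ≤))) ⟩
      γ + (W + # (missing? y)) + V                     ≡⟨ rearrange γ W (# (missing? y)) V ⟩
      W + V + γ + # (missing? y)                       ∎)
      where
      open ≤-Reasoning
      rearrange : ∀ a b c d → a + (b + c) + d ≡ b + d + a + c
      rearrange = solve-∀

    hitG-full : W ≤ # (hitG? y)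
    hitG-full = +-cancelʳ-≤ (V + (γ + γ * t₁)) _ _ (begin
      W + (V + (γ + γ * t₁))                           ≡⟨ +-assoc W V _ ⟨
      W + V + (γ + γ * t₁)                             ≤⟨ parts-full ⟩
      γ + (# (hitG? y) + # (missing? y)) + V           ≤⟨ +-monoˡ-≤ V (+-monoʳ-≤ γ (+-monoʳ-≤ (# (hitG? y)) missing≤)) ⟩
      γ + (# (hitG? y) + γ * t₁) + V                   ≡⟨ rearrange γ (# (hitG? y)) (γ * t₁) V ⟩
      # (hitG? y) + (V + (γ + γ * t₁))                 ∎)
      where
      open ≤-Reasoning
      rearrange : ∀ a b c d → a + (b + c) + d ≡ b + (d + (a + c))
      rearrange = solve-∀

    miss? : ∀ j → Decidable (λ A → G A × Disjoint A (plus (y j)))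
    miss? j = Miss? (y j)

    miss≤ : ∀ j → # (miss? j) ≤ t₁
    miss≤ j = ≤-pred (degree (G-ys γ≤ j))

    -- γ subfamilies of size at most t₁ whose union has γ t₁ members are disjoint and of size t₁.
    not-coverable : ∀ {Q : Fin γ → Pred (Subset n) 0ℓ} (Q? : ∀ j → Decidable (Q j)) →
      (∀ {A} → G A → ∀ j → Disjoint A (plus (y j)) → ∃[ i ] Q i A) →
      (∀ j → # (Q? j) ≤ t₁) → ∀ j → ¬ (# (Q? j) < t₁)
    not-coverable Q? cover bound j lt = <⇒≱
      (subst (# (missing? y) <_) (cong (_* t₁) (length-tabulate {n = γ} id))
        (#-cover-< Q? t₁ (missing? y) (allFin γ)
          (λ (GA , j , d) → let (i , q) = cover GA j d in i , ∈-allFin i , q) (λ {i} _ → bound i) (∈-allFin j) lt))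
      missing-full

    miss≡ : ∀ j → # (miss? j) ≡ t₁
    miss≡ j = ≤-antisym (miss≤ j) (≮⇒≥ (not-coverable miss? (λ GA i d → i , GA , d) miss≤ j))

    -- If A missed two of the sets, it could be struck from the i-th subfamily and still be covered
    -- by the j-th. The i-th would then have fewer than t₁ members, which the tight count forbids.
    misses-once : ∀ {A i j} → G A → i ≢ j → Disjoint A (plus (y i)) → Disjoint A (plus (y j)) → ⊥
    misses-once {A} {i} {j} GA i≢j di dj = not-coverable Q? cover bound i
      (≤-trans (≤-reflexive (+-comm 1 _)) (≤-trans (+-monoʳ-≤ (# (Q? i)) (#≥1 (_≟ˢ A) refl))
        (≤-trans (#-pack₂ (miss? i) (Q? i) (_≟ˢ A) proj₁ (λ where refl → GA , di) (λ (_ , ≢A) eq → ≢A refl eq)) (miss≤ i))))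
      where
      Q : Fin γ → Pred (Subset n) 0ℓ
      Q l B = (G B × Disjoint B (plus (y l))) × (l ≡ i → B ≢ A)
      Q? : ∀ l → Decidable (Q l)
      Q? l B = miss? l B ×-dec ((l Fin.≟ i) →-dec ¬? (B ≟ˢ A))
      bound : ∀ l → # (Q? l) ≤ t₁
      bound l = ≤-trans (#-mono (Q? l) (miss? l) proj₁) (miss≤ l)
      cover : ∀ {B} → G B → ∀ l → Disjoint B (plus (y l)) → ∃[ l′ ] Q l′ B
      cover {B} GB l d with l Fin.≟ i | B ≟ˢ A
      ... | no l≢i | _ = l , (GB , d) , λ l≡i → contradiction l≡i l≢i
      ... | yes _ | no B≢A = l , (GB , d) , λ _ → B≢A
      -- The struck set A itself is covered through the index j instead.
      ... | yes _ | yes refl = j , (GA , dj) , λ j≡i → contradiction (sym j≡i) i≢j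

    misses-E : ∀ {A j} → Disjoint A (plus (y j)) → Disjoint A E
    misses-E d z z∈ z∈E = d z z∈ (x∈p∪q⁺ (inj₁ z∈E))

    misses⇒centre : ∀ {A j} → G A → Disjoint A (plus (y j)) → x ∈ A
    misses⇒centre {A} {j} GA d with x∈⊎E⊆ GA
    ... | inj₁ x∈ = x∈
    ... | inj₂ E⊆A =
      let (e , e∈ , _) = ∣∣<⇒∃∉ {A = ∅} {E} (subst₂ _<_ (sym (∣⊥∣≡0 n)) (sym ∣E∣) (s≤s z≤n))
      in contradiction e∈ (misses-E {j = j} d e (E⊆A e∈))

    all-ys : ∀ {z} → z ∈ᴸ Ys → ∃[ j ] z ≡ y j
    all-ys z∈ = ∈-tabulate⁻ {f = y} (unique-⊆⇒⊇ Fin._≟_ (Unique.tabulate⁺ (ys-injective γ≤))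
      (λ w∈ → let (j , w≡) = ∈-tabulate⁻ {f = y} w∈ in subst (_∈ᴸ Ys) (sym w≡) (ys∈ γ≤ j))
      (≤-reflexive (trans m≡γ (sym (length-tabulate y)))) z∈)

    structure : Structure k γ (suc t₁) Z G
    structure = record
      { x = x ; E = E ; x∉Z = x∉Z ; x∉E = x∉E ; E∦Z = E∦Z ; ∣E∣ = cong suc ∣E∣
      ; y = y ; y-injective = ys-injective γ≤
      ; y∉Z = λ j → y∉Z (G-ys γ≤ j) ; y∉E = λ j → proj₁ (ys-extends γ≤ j) ; y≢x = λ j → proj₁ (proj₂ (ys-extends γ≤ j))
      -- The block B_j consists of all members disjoint from E ∪ {y j}: `miss≡` gives its size t -
      -- 1, and `misses-once` makes its sets contain every other y i.
      ; B = λ j → enum (miss? j) ; B-unique = λ j → enum-unique (miss? j)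
      ; B-length = λ j → trans (sym (#-def (miss? j))) (miss≡ j)
      ; B-between = B-between ; B∌ = B∌ ; B∋ = B∋ ; member⁻ = member⁻ ; member⁺ = member⁺ }
      where
      B-between : ∀ {j b} → b ∈ᴸ enum (miss? j) → Between k ⁅ x ⁆ (Z ∪ E) b
      B-between {j} {b} b∈ with ∈-enum⁻ (miss? j) b∈
      ... | Gb , d = let l = link Gb (misses⇒centre {j = j} Gb d)
                     in between (Between.size l) (contains l) (Disjoint-∪ (avoids l) (misses-E {j = j} d))
      B∌ : ∀ {j b} → b ∈ᴸ enum (miss? j) → y j ∉ b
      B∌ {j} b∈ y∈ with ∈-enum⁻ (miss? j) b∈
      ... | Gb , d = d (y j) y∈ (x∈p∪q⁺ {p = E} (inj₂ (x∈⁅x⁆ (y j))))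
      B∋ : ∀ {j b} → b ∈ᴸ enum (miss? j) → ∀ i → i ≢ j → y i ∈ b
      B∋ {j} {b} b∈ i i≢j with ∈-enum⁻ (miss? j) b∈ | y i ∈? b
      ... | Gb , d | yes y∈ = y∈
      ... | Gb , d | no y∉ = ⊥-elim (misses-once Gb i≢j
        (Disjoint-∪ (misses-E {j = j} d) (Disjoint-⁅⁆ y∉)) d)
      member⁻ : ∀ {A} → G A → (Between k ⁅ x ⁆ Z A × Hits E y A) ⊎ (∃[ j ] A ≡ plus (y j)) ⊎ (∃[ j ] A ∈ᴸ enum (miss? j))
      member⁻ {A} GA with G⁻ GA
      ... | inj₂ A∈ = let (z , z∈ , A≡) = ∈-map⁻ plus A∈
                          (j , z≡) = all-ys z∈ in inj₂ (inj₁ (j , trans A≡ (cong plus z≡)))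
      ... | inj₁ x∈ with Fin.any? (λ j → disjoint? A (plus (y j)))
      ...   | yes (j , d) = inj₂ (inj₂ (j , ∈-enum⁺ (miss? j) (GA , d)))
      ...   | no none = inj₁ (link GA x∈ , λ j → ¬Disjoint⇒Intersects λ d → none (j , d))
      member⁺ : ∀ {A} → (Between k ⁅ x ⁆ Z A × Hits E y A) ⊎ (∃[ j ] A ≡ plus (y j)) ⊎ (∃[ j ] A ∈ᴸ enum (miss? j)) → G A
      member⁺ (inj₁ h) = proj₂ (#-full (hitG? y) (hitting? k x Z E y) proj₁ hitG-full h)
      member⁺ (inj₂ (inj₁ (j , refl))) = G-ys γ≤ j
      member⁺ (inj₂ (inj₂ (j , A∈))) = proj₁ (∈-enum⁻ (miss? j) A∈)

  q≤ : q ≤ p′ + q C suc p′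
  q≤ = C-linear q p′

  -- With more than γ sets E ∪ {y}, the members through x lose q C (suc p′) ≥ q − p′ sets.
  module _ (γ<m : γ < m) (m≤K : m ≤ K) where

    few-plus-impossible : ⊥
    few-plus-impossible = <⇒≱ large-q (+-cancelʳ-≤ (q C suc p′ + (U + q C p′ + γ * suc t₁)) _ _ (begin
      q + (q C suc p′ + (U + q C p′ + γ * suc t₁))
        ≤⟨ +-monoˡ-≤ _ q≤ ⟩
      p′ + q C suc p′ + (q C suc p′ + (U + q C p′ + γ * suc t₁))
        ≡⟨ arrange₁ p′ (q C suc p′) U (q C p′) (γ * suc t₁) ⟩
      p′ + q C suc p′ + (U + (q C p′ + q C suc p′) + γ * suc t₁)
        ≡⟨ cong (λ c → p′ + q C suc p′ + (U + c + γ * suc t₁)) (pascal q p′) ⟨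
      p′ + q C suc p′ + (U + X + γ * suc t₁)
        ≤⟨ +-monoʳ-≤ (p′ + q C suc p′) large ⟩
      p′ + q C suc p′ + (# G? + V)
        ≤⟨ +-monoʳ-≤ (p′ + q C suc p′) (+-monoˡ-≤ V (≤-trans (#-G≤ y)
             (+-mono-≤ m≤K (+-mono-≤ (#-hitG≤ γ<m) (#-missing≤ y (G-ys γ<m)))))) ⟩
      p′ + q C suc p′ + (K + (W + suc γ * t₁) + V)
        ≡⟨ arrange₂ (p′ + q C suc p′) K W (suc γ * t₁) V ⟩
      p′ + q C suc p′ + (K + suc γ * t₁ + (W + V))
        ≡⟨ cong (λ c → p′ + q C suc p′ + (K + suc γ * t₁ + c)) W+V ⟩
      p′ + q C suc p′ + (K + suc γ * t₁ + (U + q C p′))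
        -- Slack only: it brings the sum to the form of `large-q`, which also serves the case of
        -- more than K sets.
        ≤⟨ m≤m+n _ (p′ + γ) ⟩
      p′ + q C suc p′ + (K + suc γ * t₁ + (U + q C p′)) + (p′ + γ)
        ≡⟨ arrange₃ p′ (q C suc p′) K γ t₁ U (q C p′) ⟩
      2 * p′ + K + t₁ + (q C suc p′ + (U + q C p′ + γ * suc t₁)) ∎))
      where
      open ≤-Reasoning
      y : Fin (suc γ) → Fin n
      y = ys γ<m
      W = # (hitting? k x Z E y)
      W+V : W + V ≡ U + q C p′
      W+V = #-hitting-ys γ<m {p′} {q} (cong (3 +_) k₃≡)
        (trans (cong (λ e → suc (suc γ) + (∣ Z ∣ + e) + q) ∣E∣) (trans (arrange₀ ∣ Z ∣ k₃ β q) n≡))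
        where
        arrange₀ : ∀ z k b q → suc (suc (suc b)) + (z + (2 + k)) + q ≡ suc (z + (3 + k + suc b + q))
        arrange₀ = solve-∀
      arrange₁ : ∀ p c u d g → p + c + (c + (u + d + g)) ≡ p + c + (u + (d + c) + g)
      arrange₁ = solve-∀
      arrange₂ : ∀ a b c d e → a + (b + (c + d) + e) ≡ a + (b + d + (c + e))
      arrange₂ = solve-∀
      arrange₃ : ∀ p c K g t u d → p + c + (K + suc g * t + (u + d)) + (p + g) ≡
                 2 * p + K + t + (c + (u + d + g * suc t))
      arrange₃ = solve-∀

  -- Every y lies outside Z, E and x, and only γ + q + 1 elements remain.
  m≤ : m ≤ suc (γ + q)
  m≤ = +-cancelˡ-≤ (∣ Z ∣ + ∣ E ∣ + 1) _ _ (begin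
    ∣ Z ∣ + ∣ E ∣ + 1 + m                           ≡⟨ sizes ⟨
    ∣ ((Z ∪ E) ∪ ⁅ x ⁆) ∪ fromList Ys ∣             ≤⟨ ∣p∣≤n (((Z ∪ E) ∪ ⁅ x ⁆) ∪ fromList Ys) ⟩
    n                                               ≡⟨ n≡₂ ⟨
    suc (∣ Z ∣ + ∣ E ∣) + suc (γ + q)               ≡⟨ cong (_+ suc (γ + q)) (+-comm 1 (∣ Z ∣ + ∣ E ∣)) ⟩
    ∣ Z ∣ + ∣ E ∣ + 1 + suc (γ + q)                 ∎)
    where
    open ≤-Reasoning
    sizes : ∣ ((Z ∪ E) ∪ ⁅ x ⁆) ∪ fromList Ys ∣ ≡ ∣ Z ∣ + ∣ E ∣ + 1 + m
    sizes = trans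
      (∣∪∣-disjoint ((Z ∪ E) ∪ ⁅ x ⁆) (fromList Ys) λ z z∈ z∈Ys →
        let (z∉E , z≢x , Gz) = ∈-Ys⁻ (∈-fromList⁻ {L = Ys} z∈Ys)
        in [ (λ z∈ZE → [ y∉Z Gz , z∉E ]′ (x∈p∪q⁻ Z E z∈ZE)) , (λ z∈x → z≢x (x∈⁅y⁆⇒x≡y x z∈x)) ]′
             (x∈p∪q⁻ (Z ∪ E) ⁅ x ⁆ z∈))
      (cong₂ _+_ (trans
        (∣∪∣-disjoint (Z ∪ E) ⁅ x ⁆ (Disjoint-⁅⁆ λ x∈ → [ x∉Z , x∉E ]′ (x∈p∪q⁻ Z E x∈)))
        (cong₂ _+_ (∣∪∣-disjoint Z E (Disjoint-sym E∦Z)) (∣⁅x⁆∣≡1 x)))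
        (∣fromList∣ Ys-unique))

  -- With more than K = t k sets E ∪ {y}, some y lies outside any t members through x that
  -- miss E; they are then all disjoint from E ∪ {y}, so there are fewer than t of them.
  module _ (K<m : K < m) where

    bare? : Decidable (λ A → (G A × x ∈ A) × Disjoint A E)
    bare? A = (G? A ×-dec (x ∈? A)) ×-dec disjoint? A E

    #-bare≤ : # bare? ≤ t₁
    #-bare≤ = ≤-pred (≰⇒> λ many →
      let (g , g-inj , gp) = choose bare? many
          G-g = λ j → proj₁ (proj₁ (gp j))
          (y , y∈ , y∉) = ∣∣<⇒∃∉ {A = ⋃ (tabulate g)} {fromList Ys}
            (≤-<-trans (∣⋃∣≤ g λ j → ≤-reflexive (size-G (G-g j))) (≤-trans K<m (≤-reflexive (sym (∣fromList∣ Ys-unique)))))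
          Gy = proj₂ (proj₂ (∈-Ys⁻ (∈-fromList⁻ {L = Ys} y∈)))
      in <⇒≱ (degree Gy) (≤-trans (≤-reflexive (sym (length-tabulate g)))
           (length≤# (Miss? y) (Unique.tabulate⁺ g-inj) λ A∈ → let (j , A≡) = ∈-tabulate⁻ {f = g} A∈ in
             subst (λ A → G A × Disjoint A (plus y)) (sym A≡)
               (G-g j , Disjoint-∪ (proj₂ (gp j)) (Disjoint-⁅⁆ λ y∈g → y∉ (∈-⋃⁺ g j y∈g))))))

    W₀ : ℕ
    W₀ = # (linkMeeting? {k = k} x∉Z x∉E E∦Z {j₂ = 2 + k₃} refl n≡ n≡₂)

    #-G≤-bare : # G? ≤ m + (W₀ + t₁)
    #-G≤-bare = ≤-trans (#-cover₂ G? plus? rest? (λ GA → [ (λ x∈ → inj₂ (GA , x∈)) , inj₁ ]′ (G⁻ GA)))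
      (+-mono-≤ #-plus≤ (≤-trans (#-cover₂ rest? (linkMeeting? {k = k} x∉Z x∉E E∦Z {j₂ = 2 + k₃} refl n≡ n≡₂) bare? λ {A} (GA , x∈) →
        [ (λ d → inj₂ ((GA , x∈) , d)) , (λ i → inj₁ (link GA x∈ , i)) ]′ (disjoint⊎intersects A E))
        (+-monoʳ-≤ W₀ #-bare≤)))
      where
      rest? : Decidable (λ A → G A × x ∈ A)
      rest? A = G? A ×-dec (x ∈? A)

    -- The members through x that meet E number at most U - V. So the remainder X + γ t of the lower
    -- bound must be covered by the sets E ∪ {y} and at most t - 1 members through x missing E.
    excess : X + γ * suc t₁ ≤ suc (γ + q) + t₁
    excess = +-cancelˡ-≤ U _ _ (begin
      U + (X + γ * suc t₁)          ≡⟨ +-assoc U X _ ⟨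
      U + X + γ * suc t₁            ≤⟨ large ⟩
      # G? + V                      ≤⟨ +-monoˡ-≤ V (≤-trans #-G≤-bare (+-monoˡ-≤ (W₀ + t₁) m≤)) ⟩
      suc (γ + q) + (W₀ + t₁) + V   ≡⟨ arrange (suc (γ + q)) W₀ t₁ V ⟩
      W₀ + V + (suc (γ + q) + t₁)   ≡⟨ cong (_+ (suc (γ + q) + t₁)) (#-link-meeting {k = k} x∉Z x∉E E∦Z {j₂ = 2 + k₃} refl n≡ n≡₂) ⟩
      U + (suc (γ + q) + t₁)        ∎)
      where
      open ≤-Reasoning
      arrange : ∀ a b c d → a + (b + c) + d ≡ b + d + (a + c)
      arrange = solve-∀

  -- This is γ = k - 2, where X = q + 1 and the terms linear in q cancel. What remains is γ t₁ ≤ t₁,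
  -- impossible for γ ≥ 2 and t₁ ≥ 1.
  linear : p′ ≡ 0 → suc q C suc p′ + γ * suc t₁ ≤ suc (γ + q) + t₁ → ⊥
  linear p′≡0 le = <⇒≱ t₁<γt₁ (+-cancelˡ-≤ (suc (γ + q)) _ _ (begin
    suc (γ + q) + γ * t₁      ≡⟨ arrange γ q t₁ ⟨
    suc q + γ * suc t₁        ≡⟨ cong (_+ γ * suc t₁) (nC1≡n (suc q)) ⟨
    suc q C 1 + γ * suc t₁    ≡⟨ cong (λ p → suc q C suc p + γ * suc t₁) p′≡0 ⟨
    X + γ * suc t₁            ≤⟨ le ⟩
    suc (γ + q) + t₁          ∎))
    where
    open ≤-Reasoning
    arrange : ∀ g q t → suc q + g * suc t ≡ suc (g + q) + g * t
    arrange = solve-∀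
    1≤β : 1 ≤ β
    1≤β = ≤-trans (≤-trans (s≤s z≤n) 2≤k₃) (≤-reflexive (trans (sym k₃≡) (trans (cong (β +_) p′≡0) (+-identityʳ β))))
    t₁<γt₁ : t₁ < γ * t₁
    t₁<γt₁ = begin-strict
      t₁            <⟨ m<m+n t₁ 1≤t₁ ⟩
      t₁ + t₁       ≡⟨ cong (t₁ +_) (*-identityˡ t₁) ⟨
      t₁ + 1 * t₁   ≤⟨ +-monoʳ-≤ t₁ (*-monoˡ-≤ t₁ 1≤β) ⟩
      γ * t₁        ∎

  -- For p′ ≥ 1, Pascal's rule splits X into two coefficients, each at least q up to a constant.
  -- Their sum is about 2 q or more, against a right-hand side with a single q.
  quadratic : ∀ p″ → p′ ≡ suc p″ → suc q C suc p′ + γ * suc t₁ ≤ suc (γ + q) + t₁ → ⊥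
  quadratic p″ p′≡ le = <⇒≱ large-q (+-cancelˡ-≤ (q + γ) _ _ (begin
    q + γ + q
      ≡⟨ arrange₁ q γ ⟩
    q + q + γ
      ≤⟨ +-mono-≤ (+-mono-≤ (C-linear q p″) (C-linear q (suc p″))) (m≤m*n γ (suc t₁)) ⟩
    p″ + q C suc p″ + (suc p″ + q C suc (suc p″)) + γ * suc t₁
      ≡⟨ arrange₂ p″ (q C suc p″) (q C suc (suc p″)) (γ * suc t₁) ⟩
    suc (2 * p″) + (q C suc p″ + q C suc (suc p″) + γ * suc t₁)
      ≡⟨ cong (λ c → suc (2 * p″) + (c + γ * suc t₁)) (pascal q (suc p″)) ⟨
    suc (2 * p″) + (suc q C suc (suc p″) + γ * suc t₁)
      ≡⟨ cong (λ p → suc (2 * p″) + (suc q C suc p + γ * suc t₁)) p′≡ ⟨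
    suc (2 * p″) + (X + γ * suc t₁)
      ≤⟨ +-monoʳ-≤ (suc (2 * p″)) le ⟩
    suc (2 * p″) + (suc (γ + q) + t₁)
      ≤⟨ m≤m+n _ K ⟩
    suc (2 * p″) + (suc (γ + q) + t₁) + K
      ≡⟨ arrange₃ p″ γ q t₁ K ⟩
    q + γ + (2 * suc p″ + K + t₁)
      ≡⟨ cong (λ p → q + γ + (2 * p + K + t₁)) p′≡ ⟨
    q + γ + (2 * p′ + K + t₁) ∎))
    where
    open ≤-Reasoning
    arrange₁ : ∀ q g → q + g + q ≡ q + q + g
    arrange₁ = solve-∀
    arrange₂ : ∀ p a b c → p + a + (suc p + b) + c ≡ suc (2 * p) + (a + b + c)
    arrange₂ = solve-∀
    arrange₃ : ∀ p g q t K → suc (2 * p) + (suc (g + q) + t) + K ≡ q + g + (2 * suc p + K + t)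
    arrange₃ = solve-∀

  many-plus-impossible : ¬ (K < m)
  many-plus-impossible K<m = split p′ refl
    where
    split : ∀ p → p′ ≡ p → ⊥
    split zero p′≡0 = linear p′≡0 (excess K<m)
    split (suc p″) p′≡ = quadratic p″ p′≡ (excess K<m)

  m≡γ : m ≡ γ
  m≡γ = ≤-antisym (≮⇒≥ λ γ<m → few-plus-impossible γ<m (≮⇒≥ many-plus-impossible)) γ≤m

  core : Structure k γ (suc t₁) Z G × (# G? + V ≤ U + X + γ * suc t₁)
  core = Exact.structure m≡γ , Exact.upper m≡γ

-- Permuting the ground set

module _ {n : ℕ} (σ : Permutation′ n) where

  ⟨$⟩ʳ-injective : Injective _≡_ _≡_ (σ ⟨$⟩ʳ_)
  ⟨$⟩ʳ-injective {i} {j} eq = trans (sym (Perm.inverseˡ σ)) (trans (cong (σ ⟨$⟩ˡ_) eq) (Perm.inverseˡ σ))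

  ∈-image⁻ : ∀ {A c} → c ∈ image σ A → σ ⟨$⟩ˡ c ∈ A
  ∈-image⁻ {A} {c} c∈ = Vec.lookup⇒[]= _ A (trans (sym (Vec.lookup∘tabulate _ c)) (Vec.[]=⇒lookup c∈))

  ∈-image⁺ : ∀ {A c} → σ ⟨$⟩ˡ c ∈ A → c ∈ image σ A
  ∈-image⁺ {A} {c} c∈ = Vec.lookup⇒[]= c _ (trans (Vec.lookup∘tabulate _ c) (Vec.[]=⇒lookup c∈))

  ∈-image⁺ʳ : ∀ {A c} → c ∈ A → σ ⟨$⟩ʳ c ∈ image σ A
  ∈-image⁺ʳ {A} c∈ = ∈-image⁺ (subst (_∈ A) (sym (Perm.inverseˡ σ)) c∈)

  ∈-image⁻ʳ : ∀ {A c} → σ ⟨$⟩ʳ c ∈ image σ A → c ∈ A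
  ∈-image⁻ʳ {A} c∈ = subst (_∈ A) (Perm.inverseˡ σ) (∈-image⁻ c∈)

  ∣∣≤∣image∣ : ∀ A → ∣ A ∣ ≤ ∣ image σ A ∣
  ∣∣≤∣image∣ A = ≤-trans (≤-reflexive (sym (trans (length-map (σ ⟨$⟩ʳ_) (elems A)) (length-elems A))))
    (length≤∣∣ (Unique.map⁺ ⟨$⟩ʳ-injective (elems-unique A)) λ c∈ →
      let (a , a∈ , c≡) = ∈-map⁻ (σ ⟨$⟩ʳ_) c∈ in subst (_∈ image σ A) (sym c≡) (∈-image⁺ʳ {A} (∈-elems⁻ a∈)))

image-flip : ∀ {n} (σ : Permutation′ n) A → image (Perm.flip σ) (image σ A) ≡ A
image-flip σ A = ⊆-antisym
  (λ c∈ → ∈-image⁻ʳ σ (∈-image⁻ (Perm.flip σ) c∈))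
  (λ c∈ → ∈-image⁺ (Perm.flip σ) (∈-image⁺ʳ σ c∈))

module _ {n : ℕ} (σ : Permutation′ n) where

  image-injective : Injective _≡_ _≡_ (image σ)
  image-injective {A} {B} eq = trans (sym (image-flip σ A)) (trans (cong (image (Perm.flip σ)) eq) (image-flip σ B))

  ∣image∣ : ∀ A → ∣ image σ A ∣ ≡ ∣ A ∣
  ∣image∣ A = ≤-antisym
    (≤-trans (∣∣≤∣image∣ (Perm.flip σ) (image σ A)) (≤-reflexive (cong ∣_∣ (image-flip σ A)))) (∣∣≤∣image∣ σ A)

  image-∪⁅⁆ : ∀ E y → image σ (E ∪ ⁅ y ⁆) ≡ image σ E ∪ ⁅ σ ⟨$⟩ʳ y ⁆
  image-∪⁅⁆ E y = ⊆-antisym ⊆ᵢ ⊇ᵢ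
    where
    ⊆ᵢ : image σ (E ∪ ⁅ y ⁆) ⊆ image σ E ∪ ⁅ σ ⟨$⟩ʳ y ⁆
    ⊆ᵢ {c} c∈ with x∈p∪q⁻ E ⁅ y ⁆ (∈-image⁻ σ c∈)
    ... | inj₁ p = x∈p∪q⁺ {p = image σ E} (inj₁ (∈-image⁺ σ {E} p))
    ... | inj₂ p = x∈p∪q⁺ {p = image σ E} (inj₂ (subst (_∈ ⁅ σ ⟨$⟩ʳ y ⁆)
                     (trans (cong (σ ⟨$⟩ʳ_) (sym (x∈⁅y⁆⇒x≡y y p))) (Perm.inverseʳ σ)) (x∈⁅x⁆ _)))
    ⊇ᵢ : image σ E ∪ ⁅ σ ⟨$⟩ʳ y ⁆ ⊆ image σ (E ∪ ⁅ y ⁆)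
    ⊇ᵢ {c} c∈ with x∈p∪q⁻ (image σ E) ⁅ σ ⟨$⟩ʳ y ⁆ c∈
    ... | inj₁ p = ∈-image⁺ σ {E ∪ ⁅ y ⁆} (x∈p∪q⁺ {p = E} (inj₁ (∈-image⁻ σ p)))
    ... | inj₂ p = subst (_∈ image σ (E ∪ ⁅ y ⁆)) (sym (x∈⁅y⁆⇒x≡y _ p))
                     (∈-image⁺ʳ σ {E ∪ ⁅ y ⁆} (x∈p∪q⁺ {p = E} (inj₂ (x∈⁅x⁆ y))))

transpose-at : ∀ {n} (i j : Fin n) → Perm.transpose i j ⟨$⟩ʳ i ≡ j
transpose-at i j rewrite dec-true (i Fin.≟ i) refl = refl

transpose-other : ∀ {n} {i j k : Fin n} → k ≢ i → k ≢ j → Perm.transpose i j ⟨$⟩ʳ k ≡ k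
transpose-other {i = i} {j} {k} k≢i k≢j rewrite dec-false (k Fin.≟ i) k≢i | dec-false (k Fin.≟ j) k≢j = refl

-- The transposition exchanging the current position of x with position z fixes the positions of the
-- v i: these are below z, and they differ from that of x by injectivity.
align-∷ : ∀ {n z} (v : Fin z → Fin n) x → (∀ i → x ≢ v i) → z < n →
          (σ : Permutation′ n) → (∀ i → toℕ (σ ⟨$⟩ʳ v i) ≡ toℕ i) →
          Σ (Permutation′ n) λ τ → ((∀ i → toℕ (τ ⟨$⟩ʳ v i) ≡ toℕ i) × toℕ (τ ⟨$⟩ʳ x) ≡ z)
align-∷ {n} {z} v x x≢v z<n σ aligned = σ Perm.∘ₚ Perm.transpose (σ ⟨$⟩ʳ x) c ,
  (λ i → trans (cong toℕ (transpose-other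
    (λ eq → x≢v i (sym (⟨$⟩ʳ-injective σ eq)))
    (λ eq → <⇒≢ (Fin.toℕ<n i) (trans (sym (aligned i)) (trans (cong toℕ eq) (Fin.toℕ-fromℕ< z<n))))))
    (aligned i)) ,
  trans (cong toℕ (transpose-at (σ ⟨$⟩ʳ x) c)) (Fin.toℕ-fromℕ< z<n)
  where
  c = fromℕ< z<n

align : ∀ {n} z (v : Fin z → Fin n) → Injective _≡_ _≡_ v →
        Σ (Permutation′ n) λ σ → ∀ i → toℕ (σ ⟨$⟩ʳ v i) ≡ toℕ i
align zero v _ = Perm.id , λ ()
align (suc z) v v-inj =
  let (σ , aligned) = align z (v ∘ inject₁) (λ eq → Fin.inject₁-injective (v-inj eq))
      (τ , aligned′ , last) = align-∷ (v ∘ inject₁) (v (fromℕ z)) (λ i eq → Fin.fromℕ≢inject₁ (v-inj eq))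
                                (Fin.injective⇒≤ v-inj) σ aligned
  in τ , λ i → go τ aligned′ last (view i)
  where
  go : ∀ (τ : Permutation′ _) → (∀ i → toℕ (τ ⟨$⟩ʳ v (inject₁ i)) ≡ toℕ i) → toℕ (τ ⟨$⟩ʳ v (fromℕ z)) ≡ z →
       ∀ {i} → View i → toℕ (τ ⟨$⟩ʳ v i) ≡ toℕ i
  go τ aligned′ last ‵fromℕ = trans last (sym (Fin.toℕ-fromℕ z))
  go τ aligned′ last (‵inject₁ i) = trans (aligned′ i) (sym (Fin.toℕ-inject₁ i))

-- Moving the extremal structure into standard position

module Transport {n k r′ γ t : ℕ} {v : Fin r′ → Fin n} {F : List (Subset n)}
  (size-F : ∀ {A} → A ∈ᴸ F → ∣ A ∣ ≡ k)
  (meets-F : ∀ {A} → ∣ A ∣ ≡ k → Intersects A (fromFun v) → A ∈ᴸ F)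
  (S : Structure k γ t (fromFun v) (λ A → A ∈ᴸ F × Disjoint A (fromFun v)))
  (τ : Permutation′ n) (τv : ∀ i → toℕ (τ ⟨$⟩ʳ v i) ≡ toℕ i) (τx : toℕ (τ ⟨$⟩ʳ Structure.x S) ≡ r′) where

  open Structure S

  Z : Subset n
  Z = fromFun v

  low⇒Z : ∀ {c} → toℕ c < r′ → τ ⟨$⟩ˡ c ∈ Z
  low⇒Z {c} lt = subst (_∈ Z) (trans (sym (Perm.inverseˡ τ)) (cong (τ ⟨$⟩ˡ_)
    (Fin.toℕ-injective (trans (τv (fromℕ< lt)) (Fin.toℕ-fromℕ< lt))))) (∈-fromFun⁺ v (fromℕ< lt))

  Z⇒low : ∀ {c} → c ∈ Z → toℕ (τ ⟨$⟩ʳ c) < r′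
  Z⇒low c∈ = let (i , c≡) = ∈-fromFun⁻ v c∈ in
    subst (_< r′) (sym (trans (cong (toℕ ∘ (τ ⟨$⟩ʳ_)) c≡) (τv i))) (Fin.toℕ<n i)

  centre : ∀ {c} → toℕ c ≡ r′ → τ ⟨$⟩ˡ c ≡ x
  centre eq = trans (cong (τ ⟨$⟩ˡ_) (Fin.toℕ-injective (trans eq (sym τx)))) (Perm.inverseˡ τ)

  low⇒Z⊎x : ∀ {c} → toℕ c < suc r′ → τ ⟨$⟩ˡ c ∈ Z ⊎ τ ⟨$⟩ˡ c ≡ x
  low⇒Z⊎x (s≤s le) = [ (inj₁ ∘ low⇒Z) , (inj₂ ∘ centre) ]′ (m≤n⇒m<n∨m≡n le)

  high : ∀ {c} → τ ⟨$⟩ˡ c ∉ Z → τ ⟨$⟩ˡ c ≢ x → suc r′ ≤ toℕ c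
  high c∉ c≢ = ≮⇒≥ λ lt → [ c∉ , c≢ ]′ (low⇒Z⊎x lt)

  y′ : Fin γ → Fin n
  y′ j = τ ⟨$⟩ʳ y j

  y′⁻ : ∀ {c j} → c ≡ y′ j → τ ⟨$⟩ˡ c ≡ y j
  y′⁻ refl = Perm.inverseˡ τ

  Z∌b : ∀ {j b c} → b ∈ᴸ B j → c ∈ b → c ∉ Z
  Z∌b b∈ c∈b c∈Z = avoids (B-between b∈) _ c∈b (x∈p∪q⁺ (inj₁ c∈Z))

  E∌b : ∀ {j b c} → b ∈ᴸ B j → c ∈ b → c ∉ E
  E∌b b∈ c∈b c∈E = avoids (B-between b∈) _ c∈b (x∈p∪q⁺ {p = Z} (inj₂ c∈E))

  -- Since τ sends Z to [r - 1] and the centre x to the element r, the images of the y j, of E and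
  -- of the blocks are admissible parameters. The full stars come from `meets-F`, the rest from
  -- `member⁻` and `member⁺`.
  isJFamily : IsJFamily n k (suc r′) γ t (λ A → A ∈ᴸ map (image τ) F)
  isJFamily = y′ , (λ eq → y-injective (⟨$⟩ʳ-injective τ eq)) ,
    (λ j → high (subst (_∉ Z) (sym (Perm.inverseˡ τ)) (y∉Z j)) (λ eq → y≢x j (trans (sym (Perm.inverseˡ τ)) eq))) ,
    image τ E , trans (∣image∣ τ E) (cong (_∸ 1) ∣E∣) ,
    (λ c c∈ → let τc∈ = ∈-image⁻ τ c∈ in
      high (λ q → E∦Z _ τc∈ q) (λ eq → x∉E (subst (_∈ E) eq τc∈)) ,
      λ j c≡ → y∉E j (subst (_∈ E) (y′⁻ c≡) τc∈)) ,
    (λ j → map (image τ) (B j)) , (λ j → Unique.map⁺ (image-injective τ) (B-unique j)) ,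
    (λ j → trans (length-map (image τ) (B j)) (B-length j)) , blocks ,
    λ A ∣A∣ → mk⇔ (to ∣A∣) (from ∣A∣)
    where
    blocks : ∀ j b → b ∈ᴸ map (image τ) (B j) → ∣ b ∣ ≡ k × Disjoint b (image τ E) ×
      (∀ c → (toℕ c < suc r′ ⊎ ∃[ i ] c ≡ y′ i) → (c ∉ b ⇔ (toℕ c < r′ ⊎ c ≡ y′ j)))
    blocks j b b∈ with ∈-map⁻ (image τ) b∈
    ... | b₀ , b₀∈ , refl = trans (∣image∣ τ b₀) (Between.size (B-between b₀∈)) ,
      (λ c c∈b c∈E → E∌b b₀∈ (∈-image⁻ τ c∈b) (∈-image⁻ τ c∈E)) ,
      λ c c∈J → mk⇔ (absent c c∈J) (present c)
      where
      absent : ∀ c → (toℕ c < suc r′ ⊎ ∃[ i ] c ≡ y′ i) → c ∉ image τ b₀ → toℕ c < r′ ⊎ c ≡ y′ j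
      absent c (inj₁ (s≤s le)) c∉ with m≤n⇒m<n∨m≡n le
      ... | inj₁ lt = inj₁ lt
      -- Position r′ is the element r, the image of the centre, and every set of a block contains
      -- the centre.
      ... | inj₂ eq = contradiction (∈-image⁺ τ (contains (B-between b₀∈)
                        (subst (_∈ ⁅ x ⁆) (sym (centre eq)) (x∈⁅x⁆ x)))) c∉
      absent c (inj₂ (i , c≡)) c∉ with i Fin.≟ j
      ... | yes refl = inj₂ c≡
      ... | no i≢j = contradiction (∈-image⁺ τ (subst (_∈ b₀) (sym (y′⁻ c≡)) (B∋ b₀∈ i i≢j))) c∉
      present : ∀ c → toℕ c < r′ ⊎ c ≡ y′ j → c ∉ image τ b₀
      present c (inj₁ lt) c∈ = Z∌b b₀∈ (∈-image⁻ τ c∈) (low⇒Z lt)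
      present c (inj₂ c≡) c∈ = B∌ b₀∈ (subst (_∈ b₀) (y′⁻ c≡) (∈-image⁻ τ c∈))
    Member : Subset n → Set
    Member A = (∃[ a ] (a ∈ A × toℕ a < r′))
      ⊎ ((∃[ a ] (a ∈ A × toℕ a ≡ r′)) × (∀ a → a ∈ A → ¬ (toℕ a < r′)) × (∀ j → Intersects A (image τ E ∪ ⁅ y′ j ⁆)))
      ⊎ (∃[ j ] A ≡ image τ E ∪ ⁅ y′ j ⁆) ⊎ (∃[ j ] A ∈ᴸ map (image τ) (B j))
    to : ∀ {A} → ∣ A ∣ ≡ k → A ∈ᴸ map (image τ) F → Member A
    to _ A∈ with ∈-map⁻ (image τ) A∈
    ... | A₀ , A₀∈ , refl with disjoint⊎intersects A₀ Z
    ...   | inj₂ (z , z∈A , z∈Z) = inj₁ (τ ⟨$⟩ʳ z , ∈-image⁺ʳ τ z∈A , Z⇒low z∈Z)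
    ...   | inj₁ d with member⁻ (A₀∈ , d)
    ...     | inj₁ (l , h) = inj₂ (inj₁ ((τ ⟨$⟩ʳ x , ∈-image⁺ʳ τ (contains l (x∈⁅x⁆ x)) , τx) ,
                (λ a a∈ lt → d _ (∈-image⁻ τ a∈) (low⇒Z lt)) ,
                λ j → let (z , z∈A , z∈) = h j in τ ⟨$⟩ʳ z , ∈-image⁺ʳ τ z∈A ,
                  subst (τ ⟨$⟩ʳ z ∈_) (image-∪⁅⁆ τ E (y j)) (∈-image⁺ʳ τ z∈)))
    ...     | inj₂ (inj₁ (j , A₀≡)) = inj₂ (inj₂ (inj₁ (j , trans (cong (image τ) A₀≡) (image-∪⁅⁆ τ E (y j)))))
    ...     | inj₂ (inj₂ (j , A₀∈B)) = inj₂ (inj₂ (inj₂ (j , ∈-map⁺ (image τ) A₀∈B)))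
    from : ∀ {A} → ∣ A ∣ ≡ k → Member A → A ∈ᴸ map (image τ) F
    from {A} ∣A∣ mem = subst (_∈ᴸ map (image τ) F) A≡ (∈-map⁺ (image τ) (A₀∈ mem))
      where
      -- The three kinds of membership are checked on the preimage of A, where the structure is
      -- known.
      A₀ = image (Perm.flip τ) A
      A≡ : image τ A₀ ≡ A
      A≡ = image-flip (Perm.flip τ) A
      ∣A₀∣ : ∣ A₀ ∣ ≡ k
      ∣A₀∣ = trans (∣image∣ (Perm.flip τ) A) ∣A∣
      pull : ∀ {c} → c ∈ A → τ ⟨$⟩ˡ c ∈ A₀
      pull = ∈-image⁺ʳ (Perm.flip τ)
      push : ∀ {c} → c ∈ A₀ → τ ⟨$⟩ʳ c ∈ A
      push = ∈-image⁻ (Perm.flip τ)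
      A₀∈ : Member A → A₀ ∈ᴸ F
      A₀∈ (inj₁ (a , a∈ , lt)) = meets-F ∣A₀∣ (_ , pull a∈ , low⇒Z lt)
      A₀∈ (inj₂ (inj₁ ((a , a∈ , a≡) , none , h))) = proj₁ (member⁺ (inj₁
        (between ∣A₀∣ (λ z∈ → subst (_∈ A₀) (trans (centre a≡) (sym (x∈⁅y⁆⇒x≡y x z∈))) (pull a∈))
                 (λ z z∈ z∈Z → none _ (push z∈) (Z⇒low z∈Z)) ,
         λ j → let (z , z∈A , z∈) = h j in τ ⟨$⟩ˡ z , pull z∈A ,
           ∈-image⁻ τ (subst (z ∈_) (sym (image-∪⁅⁆ τ E (y j))) z∈))))
      A₀∈ (inj₂ (inj₂ (inj₁ (j , A≡′)))) = proj₁ (member⁺ (inj₂ (inj₁ (j ,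
        image-injective τ (trans A≡ (trans A≡′ (sym (image-∪⁅⁆ τ E (y j)))))))))
      A₀∈ (inj₂ (inj₂ (inj₂ (j , A∈B)))) = proj₁ (member⁺ (inj₂ (inj₂ (j ,
        let (b , b∈ , A≡b) = ∈-map⁻ (image τ) A∈B in
        subst (_∈ᴸ B j) (sym (image-injective τ (trans A≡ A≡b))) b∈))))

-- The size of J

length-concat-tabulate : ∀ {A : Set} {γ c} (f : Fin γ → List A) → (∀ j → length (f j) ≡ c) →
                         length (concat (tabulate f)) ≡ γ * c
length-concat-tabulate {γ = zero} f _ = refl
length-concat-tabulate {γ = suc γ} f eq = trans (length-++ (f zero))
  (cong₂ _+_ (eq zero) (length-concat-tabulate (f ∘ suc) (eq ∘ suc)))

J-length : ∀ {n j₂ j₃ r′ γ t f₁ f₂ f₃} (F : List (Subset n)) → Unique F → (∀ {A} → A ∈ᴸ F → ∣ A ∣ ≡ suc j₂) →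
  suc γ + j₃ ≡ suc j₂ → suc (r′ + f₁) ≡ n → suc (r′ + j₂) + f₂ ≡ n → suc γ + (r′ + j₂) + f₃ ≡ n →
  IsJFamily n (suc j₂) (suc r′) γ t (_∈ᴸ F) →
  length F + suc f₁ C suc j₂ + f₂ C j₂ ≡ n C suc j₂ + (f₁ C j₂ + f₃ C j₃) + (γ + γ * (t ∸ 1))
J-length {n} {j₂} {j₃} {r′} {γ} {t} {f₁} {f₂} {f₃} F F-unique size-F k≡₃ n≡₁ n≡₂ n≡₃
  (y , y-inj , y-high , E , ∣E∣ , E-high , B , B-unique , B-length , B-prop , F⇔) = begin
  length F + suc f₁ C k + f₂ C j₂
    ≡⟨ cong (λ l → l + suc f₁ C k + f₂ C j₂) (≤-antisym (unique-⊆⇒length-≤ F-unique F⊆L) (unique-⊆⇒length-≤ L-unique L⊆F)) ⟩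
  length L + suc f₁ C k + f₂ C j₂
    ≡⟨ cong (λ l → l + suc f₁ C k + f₂ C j₂) length-L ⟩
  # (meets? k Z) + (# H? + (γ + γ * (t ∸ 1))) + suc f₁ C k + f₂ C j₂
    ≡⟨ rearrange (# (meets? k Z)) (# H?) _ (suc f₁ C k) (f₂ C j₂) ⟩
  # (meets? k Z) + suc f₁ C k + (# H? + f₂ C j₂) + (γ + γ * (t ∸ 1))
    ≡⟨ cong₂ (λ a b → a + b + (γ + γ * (t ∸ 1))) (#-meets {k = k} {suc f₁} {Z} (trans (cong (_+ suc f₁) ∣Z∣) (trans (+-suc r′ f₁) n≡₁))) #H ⟩
  n C k + (f₁ C j₂ + f₃ C j₃) + (γ + γ * (t ∸ 1)) ∎
  where
  open ≡-Reasoning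
  rearrange : ∀ a b c d e → a + (b + c) + d + e ≡ a + d + (b + e) + c
  rearrange = solve-∀
  k : ℕ
  k = suc j₂
  r′<n : r′ < n
  r′<n = ≤-trans (s≤s (m≤m+n r′ f₁)) (≤-reflexive n≡₁)
  low : Fin r′ → Fin n
  low i = inject≤ i (<⇒≤ r′<n)
  Z : Subset n
  Z = fromFun low
  ∣Z∣ : ∣ Z ∣ ≡ r′
  ∣Z∣ = ∣fromFun∣ (Fin.inject≤-injective (<⇒≤ r′<n) (<⇒≤ r′<n) _ _)
  Z⇒low : ∀ {c} → c ∈ Z → toℕ c < r′
  Z⇒low c∈ = let (i , c≡) = ∈-fromFun⁻ low c∈ in
    subst (_< r′) (sym (trans (cong toℕ c≡) (Fin.toℕ-inject≤ i (<⇒≤ r′<n)))) (Fin.toℕ<n i)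
  low⇒Z : ∀ {c} → toℕ c < r′ → c ∈ Z
  low⇒Z {c} lt = subst (_∈ Z)
    (Fin.toℕ-injective (trans (Fin.toℕ-inject≤ (fromℕ< lt) (<⇒≤ r′<n)) (Fin.toℕ-fromℕ< lt))) (∈-fromFun⁺ low (fromℕ< lt))
  x : Fin n
  x = fromℕ< r′<n
  x≡ : toℕ x ≡ r′
  x≡ = Fin.toℕ-fromℕ< r′<n
  x∉Z : x ∉ Z
  x∉Z x∈ = <⇒≢ (Z⇒low x∈) x≡
  x∉E : x ∉ E
  x∉E x∈ = <⇒≢ (proj₁ (E-high x x∈)) (sym x≡)
  y≢x : ∀ j → y j ≢ x
  y≢x j eq = <⇒≢ (y-high j) (sym (trans (cong toℕ eq) x≡))
  y∉E : ∀ j → y j ∉ E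
  y∉E j y∈ = proj₂ (E-high (y j) y∈) j refl
  high∉Z : ∀ {c} → suc r′ ≤ toℕ c → c ∉ Z
  high∉Z le c∈ = <⇒≱ (Z⇒low c∈) (<⇒≤ le)
  E∦Z : Disjoint E Z
  E∦Z c c∈ = high∉Z (proj₁ (E-high c c∈))
  plus : Fin γ → Subset n
  plus j = E ∪ ⁅ y j ⁆
  y∈plus : ∀ j → y j ∈ plus j
  y∈plus j = x∈p∪q⁺ {p = E} (inj₂ (x∈⁅x⁆ (y j)))
  plus⁻ : ∀ {j c} → c ∈ plus j → c ∈ E ⊎ c ≡ y j
  plus⁻ {j} c∈ = [ inj₁ , (λ p → inj₂ (x∈⁅y⁆⇒x≡y (y j) p)) ]′ (x∈p∪q⁻ E ⁅ y j ⁆ c∈)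
  plus-high : ∀ {j c} → c ∈ plus j → suc r′ ≤ toℕ c
  plus-high {j} {c} c∈ with plus⁻ {j} c∈
  ... | inj₁ c∈E = proj₁ (E-high c c∈E)
  ... | inj₂ refl = y-high j
  plus-inj : Injective _≡_ _≡_ plus
  plus-inj {i} {j} eq with plus⁻ {j} (subst (y i ∈_) eq (y∈plus i))
  ... | inj₁ y∈E = contradiction y∈E (y∉E i)
  ... | inj₂ y≡ = y-inj y≡
  H? = hitting? k x Z E y
  #H : # H? + f₂ C j₂ ≡ f₁ C j₂ + f₃ C j₃
  #H = #-hitting x∉Z x∉E E∦Z {j₂} {f₁} {f₂} refl (trans (cong (λ z → suc (z + f₁)) ∣Z∣) n≡₁)
    (trans (cong₂ (λ z e → suc (z + e) + f₂) ∣Z∣ ∣E∣) n≡₂) {j₃ = j₃} {f₃} y-inj (λ j → high∉Z (y-high j)) y∉E y≢x k≡₃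
    (trans (cong₂ (λ z e → suc γ + (z + e) + f₃) ∣Z∣ ∣E∣) n≡₃)
  b∉ : ∀ {j b c} → b ∈ᴸ B j → toℕ c < r′ ⊎ c ≡ y j → c ∉ b
  b∉ {j} {b} {c} b∈ p = Equivalence.from (proj₂ (proj₂ (B-prop j b b∈)) c
    ([ (λ lt → inj₁ (m<n⇒m<1+n lt)) , (λ eq → inj₂ (j , eq)) ]′ p)) p
  x∈b : ∀ {j b} → b ∈ᴸ B j → x ∈ b
  x∈b {j} {b} b∈ = decidable-stable (x ∈? b) λ x∉ →
    [ (λ lt → <⇒≢ lt x≡) , (λ eq → y≢x j (sym eq)) ]′
      (Equivalence.to (proj₂ (proj₂ (B-prop j b b∈)) x (inj₁ (s≤s (≤-reflexive x≡)))) x∉)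
  L₁ L₂ L₃ L₄ L : List (Subset n)
  L₁ = enum (meets? k Z)
  L₂ = enum H?
  L₃ = tabulate plus
  L₄ = concat (tabulate B)
  L = L₁ ++ L₂ ++ L₃ ++ L₄
  L₃⁻ : ∀ {A} → A ∈ᴸ L₃ → ∃[ j ] A ≡ plus j
  L₃⁻ = ∈-tabulate⁻ {f = plus}
  L₄⁻ : ∀ {A} → A ∈ᴸ L₄ → ∃[ j ] A ∈ᴸ B j
  L₄⁻ {A} A∈ = let (Bⱼ , A∈B , B∈) = ∈-concat⁻′ (tabulate B) A∈
                   (j , B≡) = ∈-tabulate⁻ {f = B} B∈ in j , subst (A ∈ᴸ_) B≡ A∈B
  length-L : length L ≡ # (meets? k Z) + (# H? + (γ + γ * (t ∸ 1)))
  length-L = trans (length-++ L₁) (cong₂ _+_ (sym (#-def (meets? k Z)))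
    (trans (length-++ L₂) (cong₂ _+_ (sym (#-def H?))
      (trans (length-++ L₃) (cong₂ _+_ (length-tabulate plus) (length-concat-tabulate B B-length))))))
  L₂₃₄⁻ : ∀ {A} → A ∈ᴸ L₂ ++ L₃ ++ L₄ → (Between k ⁅ x ⁆ Z A × Hits E y A) ⊎ (∃[ j ] A ≡ plus j) ⊎ (∃[ j ] A ∈ᴸ B j)
  L₂₃₄⁻ A∈ with ∈-++⁻ L₂ A∈
  ... | inj₁ p = inj₁ (∈-enum⁻ H? p)
  ... | inj₂ A∈′ with ∈-++⁻ L₃ A∈′
  ...   | inj₁ p = inj₂ (inj₁ (L₃⁻ p))
  ...   | inj₂ p = inj₂ (inj₂ (L₄⁻ p))
  L-unique : Unique L
  L-unique = Unique.++⁺ (enum-unique (meets? k Z))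
    (Unique.++⁺ (enum-unique H?)
      (Unique.++⁺ (Unique.tabulate⁺ plus-inj)
        (Unique.concat⁺ (All.tabulate⁺ B-unique) (AllPairs.tabulate⁺ B-apart))
        λ (p , q) → plus-apart (L₃⁻ p) (L₄⁻ q))
      λ (p , q) → hit-apart (∈-enum⁻ H? p) (∈-++⁻ L₃ q))
    λ (p , q) → meets-apart (proj₂ (∈-enum⁻ (meets? k Z) p)) (L₂₃₄⁻ q)
    where
    -- A set of a block omits exactly one of the elements y, and this element identifies the block.
    B-apart : ∀ {i j} → i ≢ j → ∀ {A} → A ∈ᴸ B i × A ∈ᴸ B j → ⊥
    B-apart {i} {j} i≢j {A} (p , q) =
      [ (λ lt → high∉Z (y-high j) (low⇒Z lt)) , (λ eq → i≢j (sym (y-inj eq))) ]′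
        (Equivalence.to (proj₂ (proj₂ (B-prop i A p)) (y j) (inj₂ (j , refl))) (b∉ q (inj₂ refl)))
    plus-apart : ∀ {A} → ∃[ j ] A ≡ plus j → ∃[ j ] A ∈ᴸ B j → ⊥
    plus-apart (j , refl) (i , A∈) = <⇒≢ (plus-high {j} (x∈b A∈)) (sym x≡)
    hit-apart : ∀ {A} → Between k ⁅ x ⁆ Z A × Hits E y A → A ∈ᴸ L₃ ⊎ A ∈ᴸ L₄ → ⊥
    hit-apart (l , _) (inj₁ p) with L₃⁻ p
    ... | j , refl = <⇒≢ (plus-high {j} (contains l (x∈⁅x⁆ x))) (sym x≡)
    hit-apart (_ , h) (inj₂ q) with L₄⁻ q
    ... | j , A∈ with h j
    ...   | z , z∈A , z∈ with plus⁻ {j} z∈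
    ...     | inj₁ z∈E = proj₁ (proj₂ (B-prop j _ A∈)) z z∈A z∈E
    ...     | inj₂ z≡ = b∉ A∈ (inj₂ z≡) z∈A
    meets-apart : ∀ {A} → Intersects A Z →
      (Between k ⁅ x ⁆ Z A × Hits E y A) ⊎ (∃[ j ] A ≡ plus j) ⊎ (∃[ j ] A ∈ᴸ B j) → ⊥
    meets-apart i (inj₁ (l , _)) = Intersects⇒¬Disjoint i (avoids l)
    meets-apart (z , z∈A , z∈Z) (inj₂ (inj₁ (j , refl))) = high∉Z (plus-high {j} z∈A) z∈Z
    meets-apart (z , z∈A , z∈Z) (inj₂ (inj₂ (j , A∈))) = b∉ A∈ (inj₁ (Z⇒low z∈Z)) z∈A
  L⊆F : ∀ {A} → A ∈ᴸ L → A ∈ᴸ F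
  L⊆F {A} A∈ with ∈-++⁻ L₁ A∈
  ... | inj₁ p = let (∣A∣ , z , z∈A , z∈Z) = ∈-enum⁻ (meets? k Z) p
                 in Equivalence.from (F⇔ A ∣A∣) (inj₁ (z , z∈A , Z⇒low z∈Z))
  ... | inj₂ q with L₂₃₄⁻ q
  ...   | inj₁ (l , h) = Equivalence.from (F⇔ A (Between.size l)) (inj₂ (inj₁
            ((x , contains l (x∈⁅x⁆ x) , x≡) , (λ a a∈ lt → avoids l a a∈ (low⇒Z lt)) , h)))
  ...   | inj₂ (inj₁ (j , refl)) = Equivalence.from
            (F⇔ A (trans (∣∪⁅⁆∣ (y∉E j)) (cong suc ∣E∣))) (inj₂ (inj₂ (inj₁ (j , refl))))
  ...   | inj₂ (inj₂ (j , A∈B)) = Equivalence.from (F⇔ A (proj₁ (B-prop j A A∈B))) (inj₂ (inj₂ (inj₂ (j , A∈B))))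
  F⊆L : ∀ {A} → A ∈ᴸ F → A ∈ᴸ L
  F⊆L {A} A∈ with Equivalence.to (F⇔ A (size-F A∈)) A∈
  ... | inj₁ (a , a∈ , lt) = ∈-++⁺ˡ (∈-enum⁺ (meets? k Z) (size-F A∈ , a , a∈ , low⇒Z lt))
  ... | inj₂ (inj₁ ((a , a∈ , a≡) , none , h)) = ∈-++⁺ʳ L₁ (∈-++⁺ˡ (∈-enum⁺ H?
          (between (size-F A∈)
            (λ z∈ → subst (_∈ A) (trans (Fin.toℕ-injective (trans a≡ (sym x≡))) (sym (x∈⁅y⁆⇒x≡y x z∈))) a∈)
            (λ z z∈ z∈Z → none z z∈ (Z⇒low z∈Z)) , h)))
  ... | inj₂ (inj₂ (inj₁ (j , refl))) = ∈-++⁺ʳ L₁ (∈-++⁺ʳ L₂ (∈-++⁺ˡ (∈-tabulate⁺ {f = plus} j)))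
  ... | inj₂ (inj₂ (inj₂ (j , A∈B))) = ∈-++⁺ʳ L₁ (∈-++⁺ʳ L₂ (∈-++⁺ʳ L₃ (∈-concat⁺′ A∈B (∈-tabulate⁺ {f = B} j))))

-- From a family attaining the bound to J

-- Here r = suc r′, γ = suc β, t = suc t₁ and p′ = k − γ − 2; the conditions stars and heavies
-- are in the form consumed by C-ratio.
record Large (k₃ r′ β p′ t₁ σ q n : ℕ) : Set where
  field
    n≡ : suc (r′ + (3 + k₃ + suc β + q)) ≡ n
    stars : suc (suc k₃) * (r′ + (budget σ r′ (3 + k₃) * (budget σ r′ (3 + k₃) + σ) + σ)) + suc k₃ ≤ n
    heavies : suc k₃ * (suc t₁ + suc t₁ + (3 + k₃) * (3 + k₃) * (3 + k₃ + suc t₁) + (2 + k₃) * suc (r′ + (2 + k₃))) + k₃ ≤ n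
    plusses : 2 * p′ + suc t₁ * (3 + k₃) + t₁ < q

module Extremal {k₃ r′ β p′ t₁ q n : ℕ} (k₃≡ : β + p′ ≡ k₃) (2≤k₃ : 2 ≤ k₃)
  (s : Fin (suc r′) → ℕ) (anti : ∀ i j → i Fin.≤ j → s j ≤ s i) (t≡ : suc t₁ ≡ s (fromℕ r′))
  (big-n : Large k₃ r′ β p′ t₁ (s zero) q n)
  (F : List (Subset n)) (F-unique : Unique F) (size-F : ∀ {A} → A ∈ᴸ F → ∣ A ∣ ≡ 3 + k₃)
  (free-F : ¬ ContainsCompleteMultipartite F (1 Vector.∷ s))
  (ℓ-F : ℓ≥ F (suc (suc r′)) (suc β))
  (large : n C (3 + k₃) + suc q C suc p′ + suc β * suc t₁
             ≤ length F + (3 + k₃ + suc β + q) C (3 + k₃) + suc (suc β + q) C (2 + k₃)) where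

  open Large big-n

  k γ t σ M U V X R : ℕ
  k = 3 + k₃
  γ = suc β
  t = suc t₁
  σ = s zero
  M = 3 + k₃ + suc β + q
  U = M C (2 + k₃)
  V = suc (suc β + q) C (2 + k₃)
  X = suc q C suc p′
  R = M C k

  s≤σ : ∀ i → s i ≤ σ
  s≤σ i = anti zero i z≤n

  t≤σ : t ≤ σ
  t≤σ = ≤-trans (≤-reflexive t≡) (s≤σ (fromℕ r′))

  k≤n : k ≤ n
  k≤n = ≤-trans (≤-trans (m≤m+n k (suc β)) (m≤m+n (k + suc β) q)) (≤-trans (m≤n+m M (suc r′)) (≤-reflexive n≡))

  module B = Bigs s σ (≤-trans (s≤s z≤n) t≤σ) s≤σ F size-F free-F

  C₂≥1 : 1 ≤ n C suc k₃
  C₂≥1 = C-pos (≤-trans (≤-trans (n≤1+n (suc k₃)) (n≤1+n _)) k≤n)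

  C₃≥1 : 1 ≤ n C k₃
  C₃≥1 = C-pos (≤-trans (≤-trans (n≤1+n k₃) (≤-trans (n≤1+n (suc k₃)) (n≤1+n _))) k≤n)

  V≤U : V ≤ U
  V≤U = C-mono-≤ (2 + k₃) (+-monoˡ-≤ q (s≤s (m≤n+m (suc β) (2 + k₃))))

  -- With the lower-order terms dropped, F is at least as large as a union of r - 1 full stars; the
  -- search for big elements starts from this.
  large-F : n C k ≤ length F + suc M C k
  large-F = begin
    n C k                         ≤⟨ ≤-trans (m≤m+n (n C k) (X + γ * t)) (≤-reflexive (sym (+-assoc (n C k) X _))) ⟩
    n C k + X + γ * t             ≤⟨ large ⟩
    length F + R + V              ≤⟨ +-monoʳ-≤ (length F + R) V≤U ⟩
    length F + R + U              ≡⟨ trans (+-assoc (length F) R U) (cong (length F +_) (+-comm R U)) ⟩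
    length F + (U + R)            ≡⟨ cong (length F +_) (pascal M (2 + k₃)) ⟨
    length F + suc M C k          ∎
    where open ≤-Reasoning

  stars-found = B.bigs C₂≥1 {N = suc M} (trans (+-suc r′ M) n≡) F-unique large-F
                  (C-ratio (r′ + (B.D * B.θ + σ)) n (suc k₃) stars) r′ ≤-refl

  module Around (v : Fin r′ → Fin n) (v-injective : Injective _≡_ _≡_ v) (v-big : ∀ i → B.Big (v i)) where

    Z : Subset n
    Z = fromFun v

    ∣Z∣ : ∣ Z ∣ ≡ r′
    ∣Z∣ = ∣fromFun∣ v-injective

    G : Pred (Subset n) 0ℓ
    G A = A ∈ᴸ F × Disjoint A Z

    G? : Decidable G
    G? = B.avoiding? Z

    degree : ∀ {A} → G A → # (disjointPart? G? A) < t
    degree {A} (A∈ , d) = subst (# (disjointPart? G? A) <_) (sym t≡) (B.degree< C₂≥1 v-injective v-big A∈ d)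

    ℓ-G : ∀ Rs → length Rs < γ → ∃[ A ] ∃[ B ] (G A × G B × A ∉ᴸ Rs × B ∉ᴸ Rs × Disjoint A B)
    ℓ-G Rs lt = disjoint-pair v (ℓ-F Rs lt)

    M₁ : ℕ
    M₁ = # (meets? k Z)

    nCk≡ : n C k ≡ M₁ + (U + R)
    nCk≡ = trans (sym (#-meets {k = k} {suc M} {Z} (trans (cong (_+ suc M) ∣Z∣) (trans (+-suc r′ M) n≡))))
      (cong (M₁ +_) (pascal M (2 + k₃)))

    met? : Decidable (λ A → A ∈ᴸ F × Intersects A Z)
    met? A = B.member? A ×-dec intersects? A Z

    met≤ : # met? ≤ M₁
    met≤ = #-mono met? (meets? k Z) λ (A∈ , i) → size-F A∈ , i

    length-F≤ : length F ≤ # met? + # G?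
    length-F≤ = ≤-trans (length≤# B.member? F-unique id) (#-cover₂ B.member? met? G? λ {A} A∈ →
      [ (λ d → inj₂ (A∈ , d)) , (λ i → inj₁ (A∈ , i)) ]′ (disjoint⊎intersects A Z))

    balance : M₁ + (U + R) + X + γ * t ≤ # met? + # G? + R + V
    balance = begin
      M₁ + (U + R) + X + γ * t     ≡⟨ cong (λ c → c + X + γ * t) nCk≡ ⟨
      n C k + X + γ * t            ≤⟨ large ⟩
      length F + R + V             ≤⟨ +-monoˡ-≤ V (+-monoˡ-≤ R length-F≤) ⟩
      # met? + # G? + R + V        ∎
      where open ≤-Reasoning

    -- At most M₁ members of F meet Z, so what the bound asks for beyond M₁ must be supplied by G.
    large-G : U + X + γ * t ≤ # G? + V
    large-G = +-cancelˡ-≤ (M₁ + R) _ _ (begin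
      M₁ + R + (U + X + γ * t)      ≡⟨ rearrange₁ M₁ R U X (γ * t) ⟩
      M₁ + (U + R) + X + γ * t      ≤⟨ balance ⟩
      # met? + # G? + R + V         ≤⟨ +-monoˡ-≤ V (+-monoˡ-≤ R (+-monoˡ-≤ (# G?) met≤)) ⟩
      M₁ + # G? + R + V             ≡⟨ rearrange₂ M₁ (# G?) R V ⟩
      M₁ + R + (# G? + V)           ∎)
      where
      open ≤-Reasoning
      rearrange₁ : ∀ a b c d e → a + b + (c + d + e) ≡ a + (c + b) + d + e
      rearrange₁ = solve-∀
      rearrange₂ : ∀ a b c d → a + b + c + d ≡ a + c + (b + d)
      rearrange₂ = solve-∀

    C₂ C₃ θ w a : ℕ
    C₂ = n C suc k₃
    C₃ = n C k₃
    θ = k + t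
    w = suc (r′ + (2 + k₃))
    a = suc (suc β + q)

    -- By Pascal U - V is at least (k - 1) C(a, k - 2), and C(a, k - 2) falls short of C₂ by at most
    -- w C₃, as w + a = n. So G exceeds (k - 2) C₂ by C₂ up to multiples of C₃, and `heavies` makes
    -- C₂ absorb them. The quantities V and (k - 1) w C₃ are added on both sides to avoid
    -- subtraction.
    heavy-room : t + t + suc k₃ * C₂ + k * k * (θ * C₃) < # G?
    heavy-room = +-cancelʳ-≤ ((2 + k₃) * (w * C₃) + V) _ _ (begin
      suc (t + t + suc k₃ * C₂ + k * k * (θ * C₃)) + ((2 + k₃) * (w * C₃) + V)
        ≡⟨ arrange₁ t (suc k₃ * C₂) k θ C₃ (2 + k₃) w V ⟩
      1 + V + (suc k₃ * C₂ + ((t + t) * 1 + (k * k * θ + (2 + k₃) * w) * C₃))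
        -- The constant 2 t is also turned into a multiple of C₃, so that a single use of `C-ratio`
        -- disposes of all lower-order terms.
        ≤⟨ +-monoʳ-≤ (1 + V) (+-monoʳ-≤ (suc k₃ * C₂) (+-monoˡ-≤ _ (*-monoʳ-≤ (t + t) C₃≥1))) ⟩
      1 + V + (suc k₃ * C₂ + ((t + t) * C₃ + (k * k * θ + (2 + k₃) * w) * C₃))
        ≡⟨ cong (λ c → 1 + V + (suc k₃ * C₂ + c)) (arrange₂ (t + t) (k * k * θ) ((2 + k₃) * w) C₃) ⟩
      1 + V + (suc k₃ * C₂ + (t + t + k * k * θ + (2 + k₃) * w) * C₃)
        ≤⟨ +-monoʳ-≤ (1 + V) (+-monoʳ-≤ (suc k₃ * C₂) (C-ratio (t + t + k * k * θ + (2 + k₃) * w) n k₃ heavies)) ⟩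
      1 + V + (suc k₃ * C₂ + C₂)
        ≡⟨ cong (1 + V +_) (+-comm (suc k₃ * C₂) C₂) ⟩
      1 + V + (2 + k₃) * C₂
        ≤⟨ +-monoʳ-≤ (1 + V) (*-monoʳ-≤ (2 + k₃) C₂≤) ⟩
      1 + V + (2 + k₃) * (a C suc k₃ + w * C₃)
        ≡⟨ arrange₃ V (2 + k₃) (a C suc k₃) (w * C₃) ⟩
      1 + (V + (2 + k₃) * (a C suc k₃)) + (2 + k₃) * (w * C₃)
        ≤⟨ +-monoˡ-≤ _ (s≤s (C-increment-≥ (2 + k₃) a (suc k₃))) ⟩
      1 + ((2 + k₃) + a) C (2 + k₃) + (2 + k₃) * (w * C₃)
        ≡⟨ cong (λ m → 1 + m C (2 + k₃) + (2 + k₃) * (w * C₃)) (arrange₄ k₃ β q) ⟩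
      1 + U + (2 + k₃) * (w * C₃)
        -- The unit needed for strictness is taken from γ t = 1 + t₁ + β t.
        ≤⟨ +-monoˡ-≤ _ (s≤s (m≤m+n U (X + (t₁ + β * t)))) ⟩
      1 + (U + (X + (t₁ + β * t))) + (2 + k₃) * (w * C₃)
        ≡⟨ cong (_+ (2 + k₃) * (w * C₃)) (arrange₅ U X t₁ (β * t)) ⟩
      U + X + γ * t + (2 + k₃) * (w * C₃)
        ≤⟨ +-monoˡ-≤ _ large-G ⟩
      # G? + V + (2 + k₃) * (w * C₃)
        ≡⟨ trans (+-assoc (# G?) V _) (cong (# G? +_) (+-comm V _)) ⟩
      # G? + ((2 + k₃) * (w * C₃) + V) ∎)
      where
      open ≤-Reasoning
      arrange₁ : ∀ t b k θ c e w V → suc (t + t + b + k * k * (θ * c)) + (e * (w * c) + V) ≡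
                 1 + V + (b + ((t + t) * 1 + (k * k * θ + e * w) * c))
      arrange₁ = solve-∀
      arrange₂ : ∀ x y z c → x * c + (y + z) * c ≡ (x + y + z) * c
      arrange₂ = solve-∀
      arrange₃ : ∀ V e x y → 1 + V + e * (x + y) ≡ 1 + (V + e * x) + e * y
      arrange₃ = solve-∀
      arrange₄ : ∀ k b q → 2 + k + suc (suc b + q) ≡ 3 + k + suc b + q
      arrange₄ = solve-∀
      arrange₅ : ∀ u x t b → 1 + (u + (x + (t + b))) ≡ u + x + (suc t + b)
      arrange₅ = solve-∀
      w+a≡n : w + a ≡ n
      w+a≡n = trans (arrange₆ r′ k₃ β q) n≡
        where
        arrange₆ : ∀ r k b q → suc (r + (2 + k)) + suc (suc b + q) ≡ suc (r + (3 + k + suc b + q))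
        arrange₆ = solve-∀
      C₂≤ : C₂ ≤ a C suc k₃ + w * C₃
      C₂≤ = subst (λ m → m C suc k₃ ≤ a C suc k₃ + w * (m C k₃)) w+a≡n (C-increment-≤ w a k₃)

    size-G : ∀ {A} → G A → ∣ A ∣ ≡ k
    size-G = size-F ∘ proj₁

    G∦Z : ∀ {A} → G A → Disjoint A Z
    G∦Z = proj₂

    centred : Star k₃ Z G
    centred = let (A , A′ , GA , GA′ , _ , _ , d) = ℓ-G [] (s≤s z≤n)
              in Heavy.heavy-star G? size-G G∦Z degree C₃≥1 GA GA′ d heavy-room

    core : Structure k γ t Z G × (# G? + V ≤ U + X + γ * t)
    core = Core.core {q = q} k₃≡ 2≤k₃ G? size-G G∦Z degree
      (trans (cong (λ z → suc (z + M)) ∣Z∣) n≡) ℓ-G large-G plusses centred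

    -- `core` bounds G from above by what remains of the total, so `balance` leaves no room for a
    -- missing k-set among those that meet Z.
    all-meet : ∀ {A} → ∣ A ∣ ≡ k → Intersects A Z → A ∈ᴸ F
    all-meet s i = proj₁ (#-full met? (meets? k Z) (λ (A∈ , i) → size-F A∈ , i)
      (+-cancelʳ-≤ (U + R + X + γ * t) _ _ (begin
        M₁ + (U + R + X + γ * t)               ≡⟨ rearrange₁ M₁ (U + R) X (γ * t) ⟩
        M₁ + (U + R) + X + γ * t               ≤⟨ balance ⟩
        # met? + # G? + R + V                  ≡⟨ rearrange₂ (# met?) (# G?) R V ⟩
        # met? + (# G? + V) + R                ≤⟨ +-monoˡ-≤ R (+-monoʳ-≤ (# met?) (proj₂ core)) ⟩
        # met? + (U + X + γ * t) + R           ≡⟨ rearrange₃ (# met?) U X (γ * t) R ⟩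
        # met? + (U + R + X + γ * t)           ∎)) (s , i))
      where
      open ≤-Reasoning
      rearrange₁ : ∀ a b c d → a + (b + c + d) ≡ a + b + c + d
      rearrange₁ = solve-∀
      rearrange₂ : ∀ a b c d → a + b + c + d ≡ a + (b + d) + c
      rearrange₂ = solve-∀
      rearrange₃ : ∀ a b c d e → a + (b + c + d) + e ≡ a + (b + e + c + d)
      rearrange₃ = solve-∀

    isJ : ∃[ τ ] IsJFamily n k (suc r′) γ (s (fromℕ r′)) (λ A → A ∈ᴸ map (image τ) F)
    isJ =
      let S = proj₁ core
          (σ , aligned) = align r′ v v-injective
          (τ , τv , τx) = align-∷ v (Structure.x S)
            (λ i eq → Structure.x∉Z S (subst (_∈ Z) (sym eq) (∈-fromFun⁺ v i)))
            (≤-trans (s≤s (m≤m+n r′ M)) (≤-reflexive n≡)) σ aligned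
      in τ , subst (λ t → IsJFamily n k (suc r′) γ t (λ A → A ∈ᴸ map (image τ) F)) t≡
               (Transport.isJFamily {t = t} size-F all-meet S τ τv τx)

  extremal : ∃[ τ ] IsJFamily n k (suc r′) γ (s (fromℕ r′)) (λ A → A ∈ᴸ map (image τ) F)
  extremal = let (v , v-injective , v-big) = stars-found in Around.isJ v v-injective v-big

image-J-length : ∀ {n k₃ r′ β p′ q t} → β + p′ ≡ k₃ → suc (r′ + (3 + k₃ + suc β + q)) ≡ n → 1 ≤ t →
  (F : List (Subset n)) → Unique F → (∀ {A} → A ∈ᴸ F → ∣ A ∣ ≡ 3 + k₃) →
  (τ : Permutation′ n) → IsJFamily n (3 + k₃) (suc r′) (suc β) t (λ A → A ∈ᴸ map (image τ) F) →
  length F + (3 + k₃ + suc β + q) C (3 + k₃) + suc (suc β + q) C (2 + k₃) ≡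
  n C (3 + k₃) + suc q C suc p′ + suc β * t
image-J-length {n} {k₃} {r′} {β} {p′} {q} {t} k₃≡ n≡ 1≤t F F-unique size-F τ J = +-cancelˡ-≡ U _ _ (begin
  -- U is added because the count of J contains C(n - r + 1, k), which is U + R by Pascal; it is
  -- cancelled again at the end.
  U + (length F + R + V)                                ≡⟨ arrange₁ U (length F) R V ⟩
  length F + (U + R) + V                                ≡⟨ cong₂ (λ l c → l + c + V) (length-map (image τ) F) (pascal M (2 + k₃)) ⟨
  length (map (image τ) F) + suc M C (3 + k₃) + V       ≡⟨ J-length {j₂ = 2 + k₃} {suc p′} {t = t} {f₁ = M} {suc (suc β + q)} {suc q}
                                                             (map (image τ) F) (Unique.map⁺ (image-injective τ) F-unique) size-F′
                                                             (trans (arrange₂ β p′) (cong (3 +_) k₃≡)) n≡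
                                                             (trans (arrange₃ r′ k₃ β q) n≡) (trans (arrange₄ r′ k₃ β q) n≡) J ⟩
  n C (3 + k₃) + (U + X) + (suc β + suc β * (t ∸ 1))    ≡⟨ cong (n C (3 + k₃) + (U + X) +_) (trans (sym (*-suc (suc β) (t ∸ 1))) (cong (suc β *_) (m+[n∸m]≡n 1≤t))) ⟩
  n C (3 + k₃) + (U + X) + suc β * t                    ≡⟨ arrange₅ (n C (3 + k₃)) U X (suc β * t) ⟩
  U + (n C (3 + k₃) + X + suc β * t)                    ∎)
  where
  open ≡-Reasoning
  M = 3 + k₃ + suc β + q
  U = M C (2 + k₃)
  R = M C (3 + k₃)
  V = suc (suc β + q) C (2 + k₃)
  X = suc q C suc p′
  size-F′ : ∀ {A} → A ∈ᴸ map (image τ) F → ∣ A ∣ ≡ 3 + k₃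
  size-F′ A∈ = let (A₀ , A₀∈ , A≡) = ∈-map⁻ (image τ) A∈ in
    trans (cong ∣_∣ A≡) (trans (∣image∣ τ A₀) (size-F A₀∈))
  arrange₁ : ∀ u l r v → u + (l + r + v) ≡ l + (u + r) + v
  arrange₁ = solve-∀
  arrange₂ : ∀ b p → suc (suc b) + suc p ≡ 3 + (b + p)
  arrange₂ = solve-∀
  arrange₃ : ∀ r k b q → suc (r + (2 + k)) + suc (suc b + q) ≡ suc (r + (3 + k + suc b + q))
  arrange₃ = solve-∀
  arrange₄ : ∀ r k b q → suc (suc b) + (r + (2 + k)) + suc q ≡ suc (r + (3 + k + suc b + q))
  arrange₄ = solve-∀
  arrange₅ : ∀ c u x g → c + (u + x) + g ≡ u + (c + x + g)
  arrange₅ = solve-∀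

-- The threshold for n and the two directions

theorem4 : (k r′ β : ℕ) (s : Fin (suc r′) → ℕ) →
    5 ≤ k →
    (∀ i j → i Fin.≤ j → s j ≤ s i) →
    (∀ i → 1 ≤ s i) →
    suc β ≤ k ∸ 2 →
    ∃[ n₀ ] ∀ n → n₀ ≤ n →
    (F : List (Subset n)) → Unique F → All (λ A → ∣ A ∣ ≡ k) F →
    ¬ ContainsCompleteMultipartite F (1 Vector.∷ s) →
    ℓ≥ F (suc (suc r′)) (suc β) →
    (length F + (n ∸ suc r′) C k + (n ∸ (k + suc r′) + 1) C (k ∸ 1)
    ≤ n C k + (n ∸ (k + suc r′ + suc β) + 1) C (k ∸ suc β ∸ 1) + suc β * s (fromℕ r′))
    × ((length F + (n ∸ suc r′) C k + (n ∸ (k + suc r′) + 1) C (k ∸ 1)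
    ≡ n C k + (n ∸ (k + suc r′ + suc β) + 1) C (k ∸ suc β ∸ 1) + suc β * s (fromℕ r′))
    ⇔ (∃[ σ ] IsJFamily n k (suc r′) (suc β) (s (fromℕ r′)) (λ A → A ∈ᴸ map (image σ) F)))
theorem4 (suc (suc (suc k₃))) r′ β s (s≤s (s≤s (s≤s 2≤k₃))) anti pos (s≤s β≤k₃) =
  -- c = k + r + γ makes the subtraction q = n - c exact. A, H and P + 1 are the thresholds for big
  -- elements, for heavy pairs and for the number of sets E ∪ {y}; their sum bounds q, and thus n,
  -- from below.
  c + (A + (H + suc P)) , λ n n₀≤n F F-unique sizes free-F ℓ-F → main n n₀≤n F F-unique (All.lookup sizes) free-F ℓ-F
  where
  k p′ t t₁ σ c A H P : ℕ
  k = 3 + k₃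
  p′ = k₃ ∸ β
  t = s (fromℕ r′)
  t₁ = t ∸ 1
  σ = s zero
  c = k + suc r′ + suc β
  A = suc (suc k₃) * (r′ + (budget σ r′ k * (budget σ r′ k + σ) + σ)) + suc k₃
  H = suc k₃ * (suc t₁ + suc t₁ + k * k * (k + suc t₁) + (2 + k₃) * suc (r′ + (2 + k₃))) + k₃
  P = 2 * p′ + suc t₁ * k + t₁
  k₃≡ : β + p′ ≡ k₃
  k₃≡ = m+[n∸m]≡n β≤k₃
  t≡ : suc t₁ ≡ t
  t≡ = m+[n∸m]≡n (pos (fromℕ r′))
  main : ∀ n → c + (A + (H + suc P)) ≤ n → (F : List (Subset n)) → Unique F → (∀ {A} → A ∈ᴸ F → ∣ A ∣ ≡ k) →
    ¬ ContainsCompleteMultipartite F (1 Vector.∷ s) → ℓ≥ F (suc (suc r′)) (suc β) →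
    (length F + (n ∸ suc r′) C k + (n ∸ (k + suc r′) + 1) C (k ∸ 1)
      ≤ n C k + (n ∸ c + 1) C (k ∸ suc β ∸ 1) + suc β * t)
    × ((length F + (n ∸ suc r′) C k + (n ∸ (k + suc r′) + 1) C (k ∸ 1)
      ≡ n C k + (n ∸ c + 1) C (k ∸ suc β ∸ 1) + suc β * t)
      ⇔ (∃[ σ ] IsJFamily n k (suc r′) (suc β) t (λ A → A ∈ᴸ map (image σ) F)))
  main n n₀≤n F F-unique size-F free-F ℓ-F =
    -- `Goal` abstracts the arguments of the binomial coefficients, so that the truncated
    -- subtractions of the statement can be exchanged for sums in q and p′.
    subst₂ (λ m d → Goal (n ∸ suc r′) (n ∸ (k + suc r′) + 1) m d) (+-comm 1 q) (sym p≡)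
      (subst₂ (λ m m′ → Goal m m′ (suc q) (suc p′)) (sym M≡) (sym a≡) goal)
    where
    Goal : ℕ → ℕ → ℕ → ℕ → Set
    Goal m m′ m″ d = (length F + m C k + m′ C (k ∸ 1) ≤ n C k + m″ C d + suc β * t)
      × ((length F + m C k + m′ C (k ∸ 1) ≡ n C k + m″ C d + suc β * t)
        ⇔ (∃[ σ ] IsJFamily n k (suc r′) (suc β) t (λ A → A ∈ᴸ map (image σ) F)))
    q M : ℕ
    q = n ∸ c
    M = k + suc β + q
    c+q≡n : c + q ≡ n
    c+q≡n = m+[n∸m]≡n (≤-trans (m≤m+n c _) n₀≤n)
    q≥ : A + (H + suc P) ≤ q
    q≥ = +-cancelˡ-≤ c _ _ (≤-trans n₀≤n (≤-reflexive (sym c+q≡n)))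
    q≤n : q ≤ n
    q≤n = m∸n≤m n c
    n≡ : suc r′ + M ≡ n
    n≡ = trans (arrange k r′ β q) c+q≡n
      where
      arrange : ∀ k r b q → suc r + (k + suc b + q) ≡ k + suc r + suc b + q
      arrange = solve-∀
    M≡ : n ∸ suc r′ ≡ M
    M≡ = trans (cong (_∸ suc r′) (sym n≡)) (m+n∸m≡n (suc r′) M)
    a≡ : n ∸ (k + suc r′) + 1 ≡ suc (suc β + q)
    a≡ = trans (cong (λ m → m ∸ (k + suc r′) + 1) (trans (sym c+q≡n) (+-assoc (k + suc r′) (suc β) q)))
      (trans (cong (_+ 1) (m+n∸m≡n (k + suc r′) (suc β + q))) (+-comm _ 1))
    p≡ : k ∸ suc β ∸ 1 ≡ suc p′
    p≡ = cong (_∸ 1) (trans (cong (_∸ β) (trans (cong (2 +_) (sym k₃≡)) (arrange β p′))) (m+n∸m≡n β (2 + p′)))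
      where
      arrange : ∀ b p → 2 + (b + p) ≡ b + (2 + p)
      arrange = solve-∀
    big-n : Large k₃ r′ β p′ t₁ σ q n
    big-n = record
      { n≡ = n≡
      ; stars = ≤-trans (≤-trans (m≤m+n A _) q≥) q≤n
      ; heavies = ≤-trans (≤-trans (≤-trans (m≤m+n H (suc P)) (m≤n+m (H + suc P) A)) q≥) q≤n
      ; plusses = ≤-trans (≤-trans (m≤n+m (suc P) H) (m≤n+m (H + suc P) A)) q≥ }
    forward : n C k + suc q C suc p′ + suc β * t ≤ length F + M C k + suc (suc β + q) C (2 + k₃) →
              ∃[ σ ] IsJFamily n k (suc r′) (suc β) t (λ A → A ∈ᴸ map (image σ) F)
    forward large = Extremal.extremal {p′ = p′} {q = q} k₃≡ 2≤k₃ s anti t≡ big-n F F-unique size-F free-F ℓ-F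
      (≤-trans (≤-reflexive (cong (λ u → n C k + suc q C suc p′ + suc β * u) t≡)) large)
    backward : ∃[ σ ] IsJFamily n k (suc r′) (suc β) t (λ A → A ∈ᴸ map (image σ) F) →
               length F + M C k + suc (suc β + q) C (2 + k₃) ≡ n C k + suc q C suc p′ + suc β * t
    backward (τ , J) = image-J-length {p′ = p′} {q = q} k₃≡ n≡ (pos (fromℕ r′)) F F-unique size-F τ J
    goal : Goal M (suc (suc β + q)) (suc q) (suc p′)
    -- If the inequality does not hold outright, its converse does. Then F is a copy of J by
    -- `forward`, and by `backward` its size equals the bound.
    goal = [ id , (λ ge → ≤-reflexive (backward (forward ge))) ]′
             (≤-total (length F + M C k + suc (suc β + q) C (2 + k₃)) (n C k + suc q C suc p′ + suc β * t)) ,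
           mk⇔ (λ eq → forward (≤-reflexive (sym eq))) backward
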